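{- For each integer $t \geq 3$, the Erd\H{o}s-P\'osa property holds for $W_t$-models with a bounding function $f$ satisfying $f(k) = O(k \log k)$. Equivalently: for every integer $t\ge 3$ there is a constant $c=c(t)$ such that for every integer $k \geq 1$ and every graph $G$, either $G$ has $k$ pairwise vertex-disjoint $W_t$-models, or there is a set $X \subseteq V(G)$ with $|X| \leq c\, k \log k$ such that $G - X$ has no $W_t$-model.
   Context: All graphs are finite and simple. $W_t$ denotes the wheel on $t+1$ vertices: a cycle on $t$ vertices together with one additional vertex adjacent to all vertices of the cycle. For a graph $H$, an $H$-model $\mathcal{M}$ in a graph $G$ is a collection $\{S_x \subseteq G : x \in V(H)\}$ of pairwise vertex-disjoint connected subgraphs of $G$ such that $S_x$ and $S_y$ are joined by an edge of $G$ for every edge $xy \in E(H)$; its vertex set is the union of the vertex sets of the $S_x$, and two models are disjoint if their vertex sets are disjoint. $\nu_H(G)$ is the maximum number of pairwise disjoint $H$-models in $G$, and $\tau_H(G)$ is the minimum size of a set $X \subseteq V(G)$ such that $G - X$ has no $H$-model. The Erd\H{o}s-P\'osa property holds for $H$-models with bounding function $f\colon \mathbb{N} \to \mathbb{R}$ if $\tau_H(G) \leq f(\nu_H(G))$ for every graph $G$. -}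

module Defs where

open import Data.Nat using (ℕ; zero; suc; _+_; _*_; _≤_; _≡ᵇ_)
open import Data.Nat.Logarithm using (⌊log₂_⌋)
open import Data.Fin using (Fin; zero; suc; toℕ)
open import Data.Fin.Subset using (Subset; _∉_; ∣_∣)
open import Data.Bool using (Bool; true; false; _∨_; _∧_)
open import Data.Maybe using (Maybe; just; nothing)
open import Data.Product using (Σ; ∃; _×_; _,_)
open import Data.Sum using (_⊎_)
open import Relation.Nullary using (¬_)
open import Relation.Binary.PropositionalEquality using (_≡_; _≢_)

record Graph (n : ℕ) : Set where
  field
    adj    : Fin n → Fin n → Bool
    sym    : ∀ u v → adj u v ≡ adj v u
    irrefl : ∀ v → adj v v ≡ false
open Graph public

data Walk {n : ℕ} (G : Graph n) (P : Fin n → Set) : Fin n → Fin n → Set where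
  here : ∀ {u} → P u → Walk G P u u
  step : ∀ {u v w} → P u → adj G u v ≡ true → Walk G P v w → Walk G P u w

-- An H-model in G, where H is given by its adjacency relation on Fin h.
-- Each vertex of G is assigned to at most one branch set (so branch sets are
-- pairwise vertex-disjoint); S_x = { v | assign v ≡ just x }.
record Model {n h : ℕ} (G : Graph n) (adjH : Fin h → Fin h → Bool) : Set where
  field
    assign    : Fin n → Maybe (Fin h)
    nonempty  : ∀ x → ∃ λ v → assign v ≡ just x
    connected : ∀ x u v → assign u ≡ just x → assign v ≡ just x →
                Walk G (λ w → assign w ≡ just x) u v
    edges     : ∀ x y → adjH x y ≡ true →
                Σ (Fin n) λ u → Σ (Fin n) λ v →
                  assign u ≡ just x × assign v ≡ just y × adj G u v ≡ true
open Model public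

InModel : ∀ {n h} {G : Graph n} {adjH : Fin h → Fin h → Bool} →
          Model G adjH → Fin n → Set
InModel M v = assign M v ≢ nothing

PairwiseDisjoint : ∀ {n h k} {G : Graph n} {adjH : Fin h → Fin h → Bool} →
                   (Fin k → Model G adjH) → Set
PairwiseDisjoint {k = k} Ms =
  ∀ (i j : Fin k) → i ≢ j → ∀ v → InModel (Ms i) v → ¬ InModel (Ms j) v

-- G - X has an H-model: an H-model of G avoiding every vertex of X
-- (G - X is the induced subgraph on V(G) ∖ X).
HasModelAvoiding : ∀ {n h} (G : Graph n) (adjH : Fin h → Fin h → Bool) →
                   Subset n → Set
HasModelAvoiding G adjH X =
  Σ (Model G adjH) λ M → ∀ v → InModel M v → v ∉ X

isNext : (t : ℕ) → Fin t → Fin t → Bool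
isNext t i j = (suc (toℕ i) ≡ᵇ toℕ j) ∨ ((suc (toℕ i) ≡ᵇ t) ∧ (toℕ j ≡ᵇ 0))

wheelLink : (t : ℕ) → Fin (suc t) → Fin (suc t) → Bool
wheelLink t zero    zero    = false
wheelLink t zero    (suc _) = true
wheelLink t (suc _) zero    = false
wheelLink t (suc i) (suc j) = isNext t i j

-- Wheel W_t on Fin (suc t): vertex zero is the hub, suc i (i : Fin t) are
-- the rim vertices forming the cycle 0,1,...,t-1,0.
wheelAdj : (t : ℕ) → Fin (suc t) → Fin (suc t) → Bool
wheelAdj t x y = wheelLink t x y ∨ wheelLink t y x

{-# OPTIONS --safe #-}
-- Let X be a minimum hitting set, τ = |X|. It suffices to find either τ / O(1) disjoint models, or one
-- model that O(log τ) vertices separate from all models meeting it: removing the latter lowers τ by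
-- O(log τ), so in a subgraph with τ = c k log k this can be done k times.
--
-- A graph on N vertices with many edges has a W_t-model on O(log N) vertices, found by breadth-first
-- search. A graph with a haven of large constant order has a W_t-model, found by depth-first search and
-- Menger's theorem; in particular G − X has no such haven. Hence an inclusion-minimal connected piece of
-- G − X with few outside neighbours in G − X but many in X is cut by O(1) vertices into parts with O(1)
-- neighbours. If there are τ disjoint such pieces, contracting them next to X gives a dense minor. If not,
-- there is Z ⊇ X with |Z| = O(τ) such that every component of G − Z has O(1) neighbours.
--
-- Contracting enough of these components gives a minor I of G with O(τ) vertices. Unless I has a model on
-- O(log τ) vertices, all its contractions with bounded classes are sparse, so contracting a suitable star
-- forest swallows a constant fraction of the remaining edges; after O(1) rounds, deleting ετ vertices
-- breaks I into bounded pieces. Either k of the pieces contain models, or deleting the vertices of Z in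
-- all pieces that do gives a hitting set smaller than X.
--
-- The argument is classical and runs under double negation, which is removed at the end because both
-- alternatives of the theorem are decidable.
module Submission where

open import Defs
open import Data.Nat using (ℕ; zero; suc; _+_; _*_; _∸_; _^_; _≤_; _<_; z≤n; s≤s; _≤?_; _<?_; _≡ᵇ_; ⌊_/2⌋; nonZero; >-nonZero)
open import Data.Nat.Logarithm using (⌊log₂_⌋; ⌊log₂⌋-mono-≤; ⌊log₂[2^n]⌋≡n)
open import Data.Nat.Properties hiding (_≟_)
open import Data.Nat.Solver using (module +-*-Solver)
open import Data.Fin using (Fin; zero; suc; toℕ; _≟_)
open import Data.Fin.Properties using (any?; all?; injective⇒≤)
open import Data.Fin.Subset using (Subset; ∣_∣)
open import Data.Fin.Subset.Properties using (anySubset?) renaming (_∈?_ to _∈ˢ?_)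
open import Data.Bool using (Bool; true; false; _∧_; _∨_; not; if_then_else_)
open import Data.Bool.Properties using (∧-comm)
open import Data.Maybe using (Maybe; just; nothing)
open import Data.Maybe.Properties using (just-injective)
open import Data.List using (List; []; _∷_; _++_; length; map; filter; allFin; lookup; concatMap)
open import Data.List.Properties using (++-assoc; ++-identityʳ; length-++; length-tabulate; length-filter; filter-notAll; length-map)
open import Data.List.Membership.Propositional using (_∈_; _∉_)
open import Data.List.Membership.Propositional.Properties using (∈-++⁺ˡ; ∈-++⁺ʳ; ∈-++⁻; ∈-allFin; ∈-filter⁺; ∈-filter⁻; ∈-lookup; ∈-concat⁺′; ∈-map⁺; ∈-map⁻)
open import Data.List.Relation.Unary.Any using (Any; here; there; index)
open import Data.List.Relation.Unary.Any.Properties using (lookup-index)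
open import Data.List.Relation.Unary.All using (All; []; _∷_)
open import Data.List.Relation.Unary.AllPairs using ([]; _∷_)
open import Data.List.Relation.Unary.Unique.Propositional using (Unique)
open import Data.List.Relation.Unary.Unique.Propositional.Properties using (allFin⁺) renaming (filter⁺ to unique-filter; map⁺ to unique-map)
open import Data.Vec using (Vec; []; _∷_; tabulate) renaming (lookup to lookupᵛ)
open import Data.Vec.Properties using (lookup∘tabulate; lookup⇒[]=)
open import Data.Product using (Σ; ∃; _×_; _,_; proj₁; proj₂)
open import Data.Sum using (_⊎_; inj₁; inj₂; [_,_]′)
open import Data.Empty using (⊥; ⊥-elim)
open import Function using (_∘_; id; case_of_)
open import Relation.Nullary using (¬_; Dec; yes; no; contradiction; ¬?)
open import Relation.Nullary.Decidable using (_×-dec_; _⊎-dec_; _→-dec_; ⌊_⌋) renaming (map′ to dec-map)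
open import Relation.Binary.PropositionalEquality using (_≡_; _≢_; refl; trans; cong; cong₂; subst; subst₂; module ≡-Reasoning) renaming (sym to ≡-sym)
import Data.Fin.Subset as FS
import Data.List.Membership.DecPropositional as DecMem
import Data.List.Relation.Unary.All as All
import Data.Maybe.Properties as Maybe

open +-*-Solver using (solve; _:=_; _:+_; _:*_) renaming (con to num)

-- Dense subgraphs yield small models only in minors of the graph, and lifting a model can enlarge
-- its branch sets without bound. What survives lifting is not size but cost: `Cheap k P` asks for
-- at most `k` vertices that meet every model meeting `P`. A vertex set that misses a hitting set
-- and has few outside neighbours is cheap however large it is, since a model that enters it must
-- leave it to reach the hitting set. Cost is subadditive, so a model on O(log τ) vertices of a
-- minor lifts to one of cost O(log τ) if the contracted sets have bounded cost. This is why pieces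
-- with many neighbours in the hitting set are cut up and partly reassembled before they are
-- contracted. The logarithm has a single source, the depth of breadth-first search in a graph with
-- fewer than 2^Λ vertices. The constants are chosen in an order that avoids circularity: the haven
-- order `s`, then `D'`, `D₁`, `D₂`, and last `e` and `K`. One circle remains, as Λ contains the
-- logarithm of the constant 2^a of the theorem; it is broken because 2^a outgrows every fixed
-- multiple of `a`.

DN : Set → Set
DN A = ¬ ¬ A

infixl 1 _>>=_
_>>=_ : {A : Set} {B : Set} → DN A → (A → DN B) → DN B
(m >>= f) k = m (λ x → f x k)

return : {A : Set} → A → DN A
return x k = k x

em : (A : Set) → DN (Dec A)
em A k = k (no (λ x → k (yes x)))

dn-map : {A : Set} {B : Set} → (A → B) → DN A → DN B
dn-map f m k = m (k ∘ f)

-- Over a finite index set the double negation shift holds by induction. It turns existence under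
-- `DN` at each vertex into a choice function under one `DN`.
dn-Fin : ∀ {n} {P : Fin n → Set} → (∀ i → DN (P i)) → DN (∀ i → P i)
dn-Fin {n = zero} h k = k (λ ())
dn-Fin {n = suc n} {P} h = do
  p₀ ← h zero
  p ← dn-Fin (h ∘ suc)
  return λ { zero → p₀ ; (suc i) → p i }

_∈?_ : ∀ {n} (v : Fin n) (L : List (Fin n)) → Dec (v ∈ L)
v ∈? L = DecMem._∈?_ _≟_ v L

dn-list : ∀ {n} {P : Fin n → Set} (L : List (Fin n)) →
          (∀ v → v ∈ L → DN (P v)) → DN (∀ v → v ∈ L → P v)
dn-list L h = dn-Fin λ v → case v ∈? L of λ
  { (yes v∈L) → dn-map (λ p _ → p) (h v v∈L)
  ; (no v∉L) → return (λ v∈L → contradiction v∈L v∉L) }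

-- Choose witnesses greedily: when the choice gets stuck, those found so far are all there are. The
-- alternatives between many neighbours and few, and between many models and a small hitting set,
-- are instances.
pick : ∀ {n} (P : Fin n → Set) (k : ℕ) →
       DN ((∃ λ L → Unique L × length L ≡ k × (∀ v → v ∈ L → P v))
           ⊎ (∃ λ L → length L < k × (∀ v → P v → v ∈ L)))
pick P zero = return (inj₁ ([] , [] , refl , λ _ ()))
pick P (suc k) = pick P k >>= λ
  { (inj₂ (L , L< , cov)) → return (inj₂ (L , m<n⇒m<1+n L< , cov))
  ; (inj₁ (L , uL , L≡ , sat)) → em (∃ λ v → P v × v ∉ L) >>= λ
    { (yes (v , Pv , v∉L)) → return (inj₁ (v ∷ L ,
          All.tabulate (λ x∈L v≡x → v∉L (subst (_∈ L) (≡-sym v≡x) x∈L)) ∷ uL ,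
          cong suc L≡ , λ { _ (here refl) → Pv ; w (there w∈) → sat w w∈ }))
    ; (no ∄) → return (inj₂ (L , s≤s (≤-reflexive L≡) , λ v Pv → case v ∈? L of λ
          { (yes p) → p ; (no q) → contradiction (v , Pv , q) ∄ })) } }

enum : ∀ {n} (P : Fin n → Set) →
       DN (∃ λ L → Unique L × (∀ v → P v → v ∈ L) × (∀ v → v ∈ L → P v))
enum {n = n} P = do
  P? ← dn-Fin (λ v → em (P v))
  return (filter P? (allFin n) , unique-filter P? (allFin⁺ n) ,
          (λ v Pv → ∈-filter⁺ P? (∈-allFin v) Pv) ,
          (λ v v∈ → proj₂ (∈-filter⁻ P? {xs = allFin n} v∈)))

-- Duplicate-free lists of vertices

remove : ∀ {n} → Fin n → List (Fin n) → List (Fin n)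
remove v = filter (λ u → ¬? (u ≟ v))

∈-remove⁺ : ∀ {n} {v u : Fin n} {L} → u ∈ L → u ≢ v → u ∈ remove v L
∈-remove⁺ u∈L u≢v = ∈-filter⁺ _ u∈L u≢v

∈-remove⁻ : ∀ {n} {v u : Fin n} {L} → u ∈ remove v L → u ∈ L × u ≢ v
∈-remove⁻ {v = v} = ∈-filter⁻ (λ u → ¬? (u ≟ v))

length-remove : ∀ {n} {v : Fin n} {L} → v ∈ L → length (remove v L) < length L
length-remove {v = v} {L} v∈L = filter-notAll _ L (lose-any v∈L)
  where
  lose-any : ∀ {L} → v ∈ L → Any (λ u → ¬ (u ≢ v)) L
  lose-any (here refl) = here (λ p → p refl)
  lose-any (there p) = there (lose-any p)

∉-All : ∀ {n} {v : Fin n} {L} → All (v ≢_) L → v ∉ L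
∉-All (p ∷ _) (here refl) = p refl
∉-All (_ ∷ ps) (there q) = ∉-All ps q

All-∉ : ∀ {n} {v : Fin n} {L} → v ∉ L → All (v ≢_) L
All-∉ {L = []} _ = []
All-∉ {L = x ∷ L} q = (λ e → q (here e)) ∷ All-∉ (q ∘ there)

unique-⊆ : ∀ {n} {L M : List (Fin n)} → Unique L → (∀ v → v ∈ L → v ∈ M) → length L ≤ length M
unique-⊆ {L = []} _ _ = z≤n
unique-⊆ {L = x ∷ L} {M} (x∉ ∷ uL) sub = ≤-trans
  (s≤s (unique-⊆ uL (λ v v∈ → ∈-remove⁺ (sub v (there v∈)) (λ { refl → ∉-All x∉ v∈ }))))
  (length-remove (sub x (here refl)))

length-allFin : ∀ n → length (allFin n) ≡ n
length-allFin n = length-tabulate id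

unique-bound : ∀ {n} {L : List (Fin n)} → Unique L → length L ≤ n
unique-bound {n} uL = ≤-trans (unique-⊆ uL (λ v _ → ∈-allFin v)) (≤-reflexive (length-allFin n))

unique-++ : ∀ {n} {L M : List (Fin n)} → Unique L → Unique M → (∀ v → v ∈ L → v ∉ M) → Unique (L ++ M)
unique-++ {L = []} _ uM _ = uM
unique-++ {L = x ∷ L} {M} (x∉ ∷ uL) uM dis =
  All-∉ (λ x∈ → [ ∉-All x∉ , dis x (here refl) ]′ (∈-++⁻ L x∈)) ∷ unique-++ uL uM (λ v → dis v ∘ there)

share : ∀ {n} {L M : List (Fin n)} → Unique L → Unique M → n < length L + length M →
        ∃ λ v → v ∈ L × v ∈ M
share {n} {L} {M} uL uM big with any? (λ v → (v ∈? L) ×-dec (v ∈? M))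
... | yes p = p
... | no ∄ = contradiction
  (subst (_≤ n) (length-++ L) (unique-bound (unique-++ uL uM (λ v p q → ∄ (v , p , q)))))
  (<⇒≱ big)

length-concatMap : ∀ {A : Set} {B : Set} (f : A → List B) {c} (L : List A) →
  (∀ x → x ∈ L → length (f x) ≤ c) → length (concatMap f L) ≤ length L * c
length-concatMap f [] _ = z≤n
length-concatMap f {c} (x ∷ L) h = ≤-trans (≤-reflexive (length-++ (f x)))
  (+-mono-≤ (h x (here refl)) (length-concatMap f L (λ y → h y ∘ there)))

∈-concatMap⁺ : ∀ {A : Set} {B : Set} (f : A → List B) {L x y} → x ∈ L → y ∈ f x → y ∈ concatMap f L
∈-concatMap⁺ f x∈L y∈ = ∈-concat⁺′ y∈ (∈-map⁺ f x∈L)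

∈-concatMap⁻ : ∀ {A : Set} {B : Set} (f : A → List B) {L y} → y ∈ concatMap f L → ∃ λ x → x ∈ L × y ∈ f x
∈-concatMap⁻ f {x ∷ L} y∈ with ∈-++⁻ (f x) y∈
... | inj₁ p = x , here refl , p
... | inj₂ q with x' , x'∈ , y∈' ← ∈-concatMap⁻ f {L} q = x' , there x'∈ , y∈'

Disjoint : ∀ {n} → List (Fin n) → List (Fin n) → Set
Disjoint L M = ∀ v → v ∈ L → v ∉ M

-- Walks and paths

module _ {n : ℕ} where

  Rel : Set₁
  Rel = Fin n → Fin n → Set

  Sym : Rel → Set
  Sym R = ∀ {u v} → R u v → R v u

  -- The adjacency of `Walk` becomes an arbitrary relation, because Menger's theorem adds edges one
  -- at a time and the haven argument restricts edges to a vertex set.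
  data Wk (R : Rel) (P : Fin n → Set) : Fin n → Fin n → Set where
    stop : ∀ {u} → P u → Wk R P u u
    go   : ∀ {u v w} → P u → R u v → Wk R P v w → Wk R P u w

  Without : (Fin n → Set) → (Fin n → Set) → Fin n → Set
  Without P Q v = P v × ¬ Q v

  Minus : (Fin n → Set) → List (Fin n) → Fin n → Set
  Minus P L = Without P (_∈ L)

  wk-start : ∀ {R P u v} → Wk R P u v → P u
  wk-start (stop p) = p
  wk-start (go p _ _) = p

  wk-end : ∀ {R P u v} → Wk R P u v → P v
  wk-end (stop p) = p
  wk-end (go _ _ w) = wk-end w

  infixr 5 _⊙_
  _⊙_ : ∀ {R P u v w} → Wk R P u v → Wk R P v w → Wk R P u w
  stop _ ⊙ w = w
  go p r w ⊙ w' = go p r (w ⊙ w')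

  wk-rev : ∀ {R P u v} → Sym R → Wk R P u v → Wk R P v u
  wk-rev s (stop p) = stop p
  wk-rev s (go p r w) = wk-rev s w ⊙ go (wk-start w) (s r) (stop p)

  wk-map : ∀ {R R' P Q u v} → (∀ {x y} → R x y → R' x y) → (∀ x → P x → Q x) →
           Wk R P u v → Wk R' Q u v
  wk-map f g (stop p) = stop (g _ p)
  wk-map f g (go p r w) = go (g _ p) (f r) (wk-map f g w)

  wk-mono : ∀ {R P Q u v} → (∀ x → P x → Q x) → Wk R P u v → Wk R Q u v
  wk-mono = wk-map id

  -- Each vertex is certified through the initial part of the walk that leads to it; with `Q` a
  -- component this shows that a walk stays in the component of its start.
  wk-refine : ∀ {R P Q u v} → Wk R P u v → (∀ x → Wk R P u x → Q x) → Wk R Q u v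
  wk-refine (stop p) h = stop (h _ (stop p))
  wk-refine (go p r w) h = go (h _ (stop p)) r (wk-refine w (λ x w' → h x (go p r w')))

  wk-snoc : ∀ {R P u v w} → Wk R P u v → R v w → P w → Wk R P u w
  wk-snoc w r p = w ⊙ go (wk-end w) r (stop p)

  private
    last-exit′ : ∀ {R P s k} u → Wk R P s k → k ≢ u →
      Wk R (Without P (_≡ u)) s k ⊎ ∃ λ u' → R u u' × Wk R (Without P (_≡ u)) u' k
    last-exit′ u (stop p) k≢u = inj₁ (stop (p , k≢u))
    last-exit′ {s = s} u (go p r w) k≢u with last-exit′ u w k≢u | s ≟ u
    ... | inj₂ h | _ = inj₂ h
    ... | inj₁ w' | yes refl = inj₂ (_ , r , w')
    ... | inj₁ w' | no s≢u = inj₁ (go (p , s≢u) r w')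

  -- Behind its last visit to `u` the walk avoids `u`, so recursive searches may discard `u` for
  -- good.
  last-exit : ∀ {R P u k} → Wk R P u k → k ≢ u →
    ∃ λ u' → R u u' × Wk R (Without P (_≡ u)) u' k
  last-exit {u = u} w k≢u with last-exit′ u w k≢u
  ... | inj₁ w' = contradiction refl (proj₂ (wk-start w'))
  ... | inj₂ h = h

  first-hit : ∀ {R P Q u w} → (∀ x → Dec (Q x)) → Wk R P u w → Q w →
    ∃ λ w' → Q w' × P w' × (u ≡ w' ⊎ ∃ λ y → Wk R (Without P Q) u y × R y w')
  first-hit Q? (stop p) q = _ , q , p , inj₁ refl
  first-hit {u = u} Q? (go p r w) q with Q? u
  ... | yes qu = u , qu , p , inj₁ refl
  ... | no ¬qu with first-hit Q? w q
  ... | w' , qw , pw , inj₁ refl = w' , qw , pw , inj₂ (u , stop (p , ¬qu) , r)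
  ... | w' , qw , pw , inj₂ (y , wy , ry) = w' , qw , pw , inj₂ (y , go (p , ¬qu) r wy , ry)

  data Path (R : Rel) : Fin n → List (Fin n) → Fin n → Set where
    one : ∀ {u} → Path R u (u ∷ []) u
    _∷_ : ∀ {u v w L} → R u v → Path R v L w → Path R u (u ∷ L) w

  path-map : ∀ {R R' u L w} → (∀ {x y} → R x y → R' x y) → Path R u L w → Path R' u L w
  path-map f one = one
  path-map f (r ∷ p) = f r ∷ path-map f p

  path-head : ∀ {R u L w} → Path R u L w → u ∈ L
  path-head one = here refl
  path-head (_ ∷ _) = here refl

  path-last : ∀ {R u L w} → Path R u L w → w ∈ L
  path-last one = here refl
  path-last (_ ∷ p) = there (path-last p)

  path-++ : ∀ {R u L v v' L' w} → Path R u L v → R v v' → Path R v' L' w → Path R u (L ++ L') w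
  path-++ one r q = r ∷ q
  path-++ (r' ∷ p) r q = r' ∷ path-++ p r q

  path-suffix : ∀ {R u L w x} → Path R u L w → x ∈ L →
    ∃ λ A → ∃ λ B → L ≡ A ++ B × Path R x B w
  path-suffix one (here refl) = [] , _ , refl , one
  path-suffix (r ∷ p) (here refl) = [] , _ , refl , r ∷ p
  path-suffix {u = u} (r ∷ p) (there x∈) with path-suffix p x∈
  ... | A , B , refl , q = u ∷ A , B , refl , q

  path-prefix : ∀ {R u L w x} → Path R u L w → x ∈ L →
    ∃ λ A → ∃ λ B → L ≡ A ++ B × Path R u A x
  path-prefix one (here refl) = _ , [] , refl , one
  path-prefix {L = u ∷ L} (r ∷ p) (here refl) = u ∷ [] , L , refl , one
  path-prefix {u = u} (r ∷ p) (there x∈) with path-prefix p x∈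
  ... | A , B , refl , q = u ∷ A , B , refl , r ∷ q

  path-wk : ∀ {R u L w} → Path R u L w → ∀ x → x ∈ L → Wk R (_∈ L) x w
  path-wk one _ (here refl) = stop (here refl)
  path-wk (r ∷ p) _ (here refl) = go (here refl) r (wk-mono (λ _ → there) (path-wk p _ (path-head p)))
  path-wk (r ∷ p) x (there x∈) = wk-mono (λ _ → there) (path-wk p x x∈)

  unique-++ʳ : ∀ (A : List (Fin n)) {B} → Unique (A ++ B) → Unique B
  unique-++ʳ [] u = u
  unique-++ʳ (x ∷ A) (_ ∷ u) = unique-++ʳ A u

  unique-++ˡ : ∀ (A : List (Fin n)) {B} → Unique (A ++ B) → Unique A
  unique-++ˡ [] u = []
  unique-++ˡ (x ∷ A) (x∉ ∷ u) = All-∉ (λ x∈ → ∉-All x∉ (∈-++⁺ˡ x∈)) ∷ unique-++ˡ A u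

  unique-++-disjoint : ∀ (A : List (Fin n)) {B} → Unique (A ++ B) → Disjoint A B
  unique-++-disjoint (x ∷ A) (x∉ ∷ u) _ (here refl) v∈B = ∉-All x∉ (∈-++⁺ʳ A v∈B)
  unique-++-disjoint (x ∷ A) (x∉ ∷ u) v (there v∈A) v∈B = unique-++-disjoint A u v v∈A v∈B

  simple-path : ∀ {R P u w} → Wk R P u w →
    ∃ λ L → Path R u L w × Unique L × (∀ x → x ∈ L → P x)
  simple-path (stop p) = _ , one , [] ∷ [] , λ { _ (here refl) → p }
  simple-path {u = u} (go p r w) with simple-path w
  ... | L , pa , uL , sat with u ∈? L
  ... | no u∉ = u ∷ L , r ∷ pa , All-∉ u∉ ∷ uL , λ { _ (here refl) → p ; x (there x∈) → sat x x∈ }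
  ... | yes u∈ with path-suffix pa u∈
  ... | A , B , refl , q = B , q , unique-++ʳ A uL , λ x x∈ → sat x (∈-++⁺ʳ A x∈)

  Conn : Rel → (Fin n → Set) → Set
  Conn R P = ∀ u v → P u → P v → Wk R P u v

  conn-root : ∀ {R P} → Sym R → ∀ r → (∀ x → P x → Wk R P x r) → Conn R P
  conn-root s r h u v pu pv = h u pu ⊙ wk-rev s (h v pv)

  path-conn : ∀ {R u L w} → Sym R → Path R u L w → Conn R (_∈ L)
  path-conn s p = conn-root s _ (path-wk p)

  Comp : Rel → (Fin n → Set) → Fin n → Fin n → Set
  Comp R P v u = Wk R P v u

  comp-conn : ∀ {R P v} → Sym R → Conn R (Comp R P v)
  comp-conn {v = v} s = conn-root s v (λ x w → wk-rev s (wk-refine w (λ _ w' → w')))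

  Adj : Graph n → Rel
  Adj G u v = adj G u v ≡ true

  adj-sym : (G : Graph n) → Sym (Adj G)
  adj-sym G {u} {v} e = trans (Graph.sym G v u) e

  adj-irr : (G : Graph n) → ∀ {u v} → Adj G u v → u ≢ v
  adj-irr G {u} e refl with () ← trans (≡-sym e) (irrefl G u)

  to-walk : ∀ {G P u v} → Wk (Adj G) P u v → Walk G P u v
  to-walk (stop p) = here p
  to-walk (go p r w) = step p r (to-walk w)

  from-walk : ∀ {G P u v} → Walk G P u v → Wk (Adj G) P u v
  from-walk (here p) = stop p
  from-walk (step p r w) = go p r (from-walk w)

-- Models and wheels

∨-true : ∀ {x y} → x ∨ y ≡ true → x ≡ true ⊎ y ≡ true
∨-true {true} _ = inj₁ refl
∨-true {false} e = inj₂ e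

∨-trueˡ : ∀ {x y} → x ≡ true → x ∨ y ≡ true
∨-trueˡ refl = refl

∨-trueʳ : ∀ {x y} → y ≡ true → x ∨ y ≡ true
∨-trueʳ {true} _ = refl
∨-trueʳ {false} e = e

∧-true : ∀ {x y} → x ∧ y ≡ true → x ≡ true × y ≡ true
∧-true {true} e = refl , e

∧-intro : ∀ {x y} → x ≡ true → y ≡ true → x ∧ y ≡ true
∧-intro refl e = e

≡ᵇ-true : ∀ {m k} → (m ≡ᵇ k) ≡ true → m ≡ k
≡ᵇ-true {zero} {zero} _ = refl
≡ᵇ-true {suc m} {suc k} e = cong suc (≡ᵇ-true e)

module _ {n : ℕ} where

  private
    owner : ∀ {h} (sets : Fin h → List (Fin n)) v → Dec (∃ λ x → v ∈ sets x) → Maybe (Fin h)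
    owner sets v (yes (x , _)) = just x
    owner sets v (no _) = nothing

  list-model : ∀ {h} (G : Graph n) (adjH : Fin h → Fin h → Bool) (sets : Fin h → List (Fin n)) →
    (∀ x → ∃ λ v → v ∈ sets x) →
    (∀ x y v → v ∈ sets x → v ∈ sets y → x ≡ y) →
    (∀ x → Conn (Adj G) (_∈ sets x)) →
    (∀ x y → adjH x y ≡ true → ∃ λ u → ∃ λ v → u ∈ sets x × v ∈ sets y × Adj G u v) →
    Σ (Model G adjH) λ M → ∀ v → InModel M v → ∃ λ x → v ∈ sets x
  list-model G adjH sets ne dis con edg = M , inside
    where
    asg : Fin n → Maybe (Fin _)
    asg v = owner sets v (any? (λ x → v ∈? sets x))
    to : ∀ {v x} → v ∈ sets x → asg v ≡ just x
    to {v} {x} p with any? (λ x → v ∈? sets x)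
    ... | yes (y , q) = cong just (dis y x v q p)
    ... | no ∄ = contradiction (x , p) ∄
    from : ∀ {v x} → asg v ≡ just x → v ∈ sets x
    from {v} e with any? (λ x → v ∈? sets x)
    from {v} refl | yes (y , q) = q
    M : Model G adjH
    M = record
      { assign = asg
      ; nonempty = λ x → proj₁ (ne x) , to (proj₂ (ne x))
      ; connected = λ x u v p q → to-walk (wk-mono (λ _ → to) (con x u v (from p) (from q)))
      ; edges = λ x y e → case edg x y e of λ { (u , v , p , q , r) → u , v , to p , to q , r } }
    inside : ∀ v → InModel M v → ∃ λ x → v ∈ sets x
    inside v ne with any? (λ x → v ∈? sets x)
    ... | yes p = p
    ... | no _ = contradiction refl ne

  record Arcs (R : Rel) (Q : Fin n → Set) (t : ℕ) (u : Fin n) (L : List (Fin n)) (w : Fin n) : Set where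
    field
      arc      : Fin (suc t) → List (Fin n)
      arc-path : ∀ i → ∃ λ a → ∃ λ b → Path R a (arc i) b
      marked   : ∀ i → ∃ λ v → v ∈ arc i × Q v
      arc-sub  : ∀ i v → v ∈ arc i → v ∈ L
      arc-dis  : ∀ i j v → v ∈ arc i → v ∈ arc j → i ≡ j
      next     : ∀ i j → toℕ j ≡ suc (toℕ i) → ∃ λ a → ∃ λ b → a ∈ arc i × b ∈ arc j × R a b
      first    : u ∈ arc zero
      last     : ∀ i → toℕ i ≡ t → w ∈ arc i

  private
    -- The cut comes right behind the first vertex in `Q`. A second such vertex is required so that
    -- the remaining path is nonempty.
    cut : ∀ {R : Rel} {Q : Fin n → Set} {u L w} (Q? : ∀ x → Dec (Q x)) → Path R u L w → 2 ≤ length (filter Q? L) →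
      ∃ λ A → ∃ λ B → ∃ λ x → ∃ λ v → L ≡ A ++ B × Path R u A x × Q x × x ∈ A × R x v × Path R v B w ×
        length (filter Q? L) ≡ suc (length (filter Q? B))
    cut {u = u} Q? one h with Q? u
    cut Q? one (s≤s ()) | yes _
    cut Q? one () | no _
    cut {u = u} {L = _ ∷ L} Q? (r ∷ p) h with Q? u
    ... | yes q = u ∷ [] , L , u , _ , refl , one , q , here refl , r , p , refl
    ... | no _ with cut Q? p h
    ... | A , B , x , v , refl , pA , q , x∈ , r' , pB , e =
      u ∷ A , B , x , v , refl , r ∷ pA , q , there x∈ , r' , pB , e

  arcs : ∀ {R : Rel} {Q : Fin n → Set} (Q? : ∀ x → Dec (Q x)) t {u L w} → Path R u L w → Unique L →
    suc t ≤ length (filter Q? L) → Arcs R Q t u L w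
  arcs {Q = Q} Q? zero {u} {L} {w} p uL h = record
    { arc = λ _ → L ; arc-path = λ _ → _ , _ , p
    ; marked = λ _ → mk h
    ; arc-sub = λ _ _ → id ; arc-dis = λ { zero zero _ _ _ → refl }
    ; next = λ { zero zero () } ; first = path-head p ; last = λ _ _ → path-last p }
    where
    mk : ∀ {L} → 1 ≤ length (filter Q? L) → ∃ λ v → v ∈ L × Q v
    mk {L} h with filter Q? L in eq
    mk {L} () | []
    ... | v ∷ _ with ∈-filter⁻ Q? {v} {L} (subst (v ∈_) (≡-sym eq) (here refl))
    ... | v∈ , q = v , v∈ , q
  arcs Q? (suc t) {u} {L} {w} p uL h with cut Q? p (≤-trans (s≤s (s≤s z≤n)) h)
  ... | A , B , x , v , refl , pA , q , x∈A , r , pB , e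
    with arcs Q? t pB (unique-++ʳ A uL) (≤-pred (≤-trans h (≤-reflexive e)))
  ... | S = record
    { arc = λ { zero → A ; (suc i) → S.arc i }
    ; arc-path = λ { zero → _ , _ , pA ; (suc i) → S.arc-path i }
    ; marked = λ { zero → x , x∈A , q ; (suc i) → S.marked i }
    ; arc-sub = λ { zero _ → ∈-++⁺ˡ ; (suc i) y → ∈-++⁺ʳ A ∘ S.arc-sub i y }
    ; arc-dis = λ { zero zero _ _ _ → refl
                  ; zero (suc j) y a b → ⊥-elim (dis y a (S.arc-sub j y b))
                  ; (suc i) zero y a b → ⊥-elim (dis y b (S.arc-sub i y a))
                  ; (suc i) (suc j) y a b → cong suc (S.arc-dis i j y a b) }
    ; next = λ { zero (suc zero) _ → x , v , x∈A , S.first , r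
               ; zero (suc (suc j)) ()
               ; (suc i) (suc j) e → S.next i j (suc-injective e) }
    ; first = path-head pA
    ; last = λ { (suc i) e → S.last i (suc-injective e) } }
    where
    module S = Arcs S
    dis : Disjoint A B
    dis = unique-++-disjoint A uL

  private
    isNext-true : ∀ {t} (i j : Fin t) → isNext t i j ≡ true →
      toℕ j ≡ suc (toℕ i) ⊎ (suc (toℕ i) ≡ t × toℕ j ≡ 0)
    isNext-true i j e with ∨-true e
    ... | inj₁ p = inj₁ (≡-sym (≡ᵇ-true p))
    ... | inj₂ q with ∧-true q
    ... | a , b = inj₂ (≡ᵇ-true a , ≡ᵇ-true b)

  -- Cut the cycle into `suc t` consecutive arcs with a mark in each: the arcs are the rim, and the
  -- closing edge joins the last arc to the first. The wheel obtained has `suc t` rim vertices.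
  wheel : (G : Graph n) (t : ℕ) {u w : Fin n} {L : List (Fin n)} →
    Path (Adj G) u L w → Unique L → Adj G w u →
    (hub : List (Fin n)) → Conn (Adj G) (_∈ hub) → Disjoint hub L →
    (marks : List (Fin n)) → Unique marks → length marks ≡ suc t →
    (∀ v → v ∈ marks → v ∈ L × ∃ λ h → h ∈ hub × Adj G h v) →
    Σ (Model G (wheelAdj (suc t))) λ M → ∀ v → InModel M v → v ∈ L ⊎ v ∈ hub
  wheel G t {u} {w} {L} p uL close hub chub dhub marks umarks lmarks spoke =
    proj₁ built , λ v m → where-is v (proj₂ built v m)
    where
    A : Arcs (Adj G) (_∈ marks) t u L w
    A = arcs (_∈? marks) t p uL (≤-trans (≤-reflexive (≡-sym lmarks))
          (unique-⊆ umarks (λ v v∈ → ∈-filter⁺ (_∈? marks) (proj₁ (spoke v v∈)) v∈)))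
    open Arcs A
    sets : Fin (suc (suc t)) → List (Fin n)
    sets zero = hub
    sets (suc i) = arc i
    Touch : Fin (suc (suc t)) → Fin (suc (suc t)) → Set
    Touch x y = ∃ λ a → ∃ λ b → a ∈ sets x × b ∈ sets y × Adj G a b
    touch-sym : ∀ {x y} → Touch x y → Touch y x
    touch-sym {_} {_} (a , b , p , q , r) = b , a , q , p , adj-sym G r
    hub-arc : ∀ i → Touch zero (suc i)
    hub-arc i with marked i
    ... | v , v∈ , m with spoke v m
    ... | _ , h , h∈ , r = h , v , h∈ , v∈ , r
    link : ∀ x y → wheelLink (suc t) x y ≡ true → Touch x y
    link zero (suc j) _ = hub-arc j
    link (suc i) (suc j) e with isNext-true i j e
    ... | inj₁ q = next i j q
    link (suc i) (suc zero) e | inj₂ (q , _) = w , u , last i (suc-injective q) , first , close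
    edg : ∀ x y → wheelAdj (suc t) x y ≡ true → Touch x y
    edg x y e with ∨-true e
    ... | inj₁ q = link x y q
    ... | inj₂ q = touch-sym {y} {x} (link y x q)
    dis : ∀ x y v → v ∈ sets x → v ∈ sets y → x ≡ y
    dis zero zero _ _ _ = refl
    dis zero (suc j) v a b = ⊥-elim (dhub v a (arc-sub j v b))
    dis (suc i) zero v a b = ⊥-elim (dhub v b (arc-sub i v a))
    dis (suc i) (suc j) v a b = cong suc (arc-dis i j v a b)
    built = list-model G (wheelAdj (suc t)) sets
      (λ { zero → case hub-arc zero of λ { (h , _ , h∈ , _) → h , h∈ }
         ; (suc i) → case marked i of λ { (v , v∈ , _) → v , v∈ } })
      dis
      (λ { zero → chub ; (suc i) → case arc-path i of λ { (_ , _ , q) → path-conn (adj-sym G) q } })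
      edg
    where-is : ∀ v → (∃ λ x → v ∈ sets x) → v ∈ L ⊎ v ∈ hub
    where-is v (zero , q) = inj₂ q
    where-is v (suc i , q) = inj₁ (arc-sub i v q)

  private
    bindM : ∀ {h} → Maybe (Fin n) → (Fin n → Maybe (Fin h)) → Maybe (Fin h)
    bindM (just i) f = f i
    bindM nothing f = nothing

  -- Only edges of `Q` between vertices of the model have to be realised in `G`. Hence the
  -- contraction may be chosen after the model, with just the classes that this model uses.
  lift : ∀ {h} {adjH : Fin h → Fin h → Bool} → (∀ x → ∃ λ y → adjH x y ≡ true) →
    (G Q : Graph n) (c : Fin n → Maybe (Fin n)) →
    (∀ i → Conn (Adj G) (λ v → c v ≡ just i)) →
    (M : Model Q adjH) →
    (∀ i j → InModel M i → InModel M j → Adj Q i j → ∃ λ u → ∃ λ v → c u ≡ just i × c v ≡ just j × Adj G u v) →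
    Σ (Model G adjH) λ M' → ∀ v → InModel M' v → ∃ λ i → c v ≡ just i × InModel M i
  lift {h} {adjH} nbr G Q c con M real = M' , inside
    where
    asg : Fin n → Maybe (Fin h)
    asg v = bindM (c v) (assign M)
    into : ∀ {v i x} → c v ≡ just i → assign M i ≡ just x → asg v ≡ just x
    into {v} p q rewrite p = q
    out : ∀ {v x} → asg v ≡ just x → ∃ λ i → c v ≡ just i × assign M i ≡ just x
    out {v} e with c v in eq
    ... | just i = i , refl , e
    inM : ∀ {i x} → assign M i ≡ just x → InModel M i
    inM p q with () ← trans (≡-sym p) q
    edg : ∀ x y → adjH x y ≡ true → ∃ λ u → ∃ λ v → asg u ≡ just x × asg v ≡ just y × Adj G u v
    edg x y e with edges M x y e
    ... | i , j , pi , pj , r with real i j (inM pi) (inM pj) r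
    ... | u , v , cu , cv , r' = u , v , into cu pi , into cv pj , r'
    walk : ∀ {x i j} → Wk (Adj Q) (λ k → assign M k ≡ just x) i j → ∀ u v → c u ≡ just i → c v ≡ just j →
      Wk (Adj G) (λ k → asg k ≡ just x) u v
    walk (stop p) u v cu cv = wk-mono (λ _ q → into q p) (con _ u v cu cv)
    walk (go p r w) u v cu cv with real _ _ (inM p) (inM (wk-start w)) r
    ... | a , b , ca , cb , r' = wk-mono (λ _ q → into q p) (con _ u a cu ca) ⊙
      go (into ca p) r' (walk w b v cb cv)
    M' : Model G adjH
    M' = record
      { assign = asg
      -- A class of `c` may be empty, so a vertex of the branch set is taken from the end of a
      -- realised edge; `nbr` provides the edge.
      ; nonempty = λ x → case nbr x of λ { (y , e) → case edg x y e of λ { (u , _ , p , _) → u , p } }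
      ; connected = λ x u v p q → case out p of λ { (i , ci , ai) → case out q of λ { (j , cj , aj) →
          to-walk (walk (from-walk (connected M x i j ai aj)) u v ci cj) } }
      ; edges = edg }
    inside : ∀ v → InModel M' v → ∃ λ i → c v ≡ just i × InModel M i
    inside v ne with c v
    ... | just i = i , refl , ne
    ... | nothing = contradiction refl ne

  wheel-nbr : ∀ t → 1 ≤ t → (x : Fin (suc t)) → ∃ λ y → wheelAdj t x y ≡ true
  wheel-nbr (suc t) _ zero = suc zero , refl
  wheel-nbr (suc t) _ (suc i) = zero , refl

-- Menger's theorem

unique-lookup : ∀ {n} {L : List (Fin n)} → Unique L → ∀ i j → lookup L i ≡ lookup L j → i ≡ j
unique-lookup {L = x ∷ L} _ zero zero _ = refl
unique-lookup {L = x ∷ L} (x∉ ∷ _) zero (suc j) e = ⊥-elim (∉-All x∉ (subst (_∈ L) (≡-sym e) (∈-lookup j)))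
unique-lookup {L = x ∷ L} (x∉ ∷ _) (suc i) zero e = ⊥-elim (∉-All x∉ (subst (_∈ L) e (∈-lookup i)))
unique-lookup {L = x ∷ L} (_ ∷ u) (suc i) (suc j) e = cong suc (unique-lookup u i j e)

injective⇒onto : ∀ {k p} (f : Fin k → Fin p) → (∀ i j → f i ≡ f j → i ≡ j) → p ≤ k → ∀ j → ∃ λ i → f i ≡ j
injective⇒onto {k} {p} f inj p≤k j with any? (λ i → f i ≟ j)
... | yes h = h
... | no ∄ = contradiction (injective⇒≤ {f = g} g-inj) (<⇒≱ (s≤s p≤k))
  where
  g : Fin (suc k) → Fin p
  g zero = j
  g (suc i) = f i
  g-inj : ∀ {x y} → g x ≡ g y → x ≡ y
  g-inj {zero} {zero} _ = refl
  g-inj {zero} {suc y} e = ⊥-elim (∄ (y , ≡-sym e))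
  g-inj {suc x} {zero} e = ⊥-elim (∄ (x , e))
  g-inj {suc x} {suc y} e = cong suc (inj x y e)

module _ {n : ℕ} where

  -- Disjoint connected sets stand in for disjoint paths: unions of them are formed without any care
  -- for simplicity, and paths are extracted only where needed.
  record Linkage (R : Rel {n}) (A B : Fin n → Set) (k : ℕ) : Set where
    field
      T     : Fin k → List (Fin n)
      dis   : ∀ i j v → v ∈ T i → v ∈ T j → i ≡ j
      con   : ∀ i → Conn R (_∈ T i)
      meetA : ∀ i → ∃ λ a → a ∈ T i × A a
      meetB : ∀ i → ∃ λ b → b ∈ T i × B b

  Separates : Rel {n} → (A B : Fin n → Set) → List (Fin n) → Set
  Separates R A B S = ∀ a b → A a → B b → ¬ Wk R (_∉ S) a b

  Edge : List (Fin n × Fin n) → Rel {n}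
  Edge l u v = (u , v) ∈ l ⊎ (v , u) ∈ l

  edge-sym : ∀ l → Sym (Edge l)
  edge-sym l (inj₁ p) = inj₂ p
  edge-sym l (inj₂ p) = inj₁ p

  private
    -- `T` is reduced to a path from `a` to its first vertex `p` in `P`. By `reach`, sets trimmed
    -- from opposite sides of a separator can meet only on it.
    record Trimmed (R : Rel {n}) (T P : List (Fin n)) (a : Fin n) : Set where
      field
        T°    : List (Fin n)
        p     : Fin n
        p∈P   : p ∈ P
        sub   : ∀ v → v ∈ T° → v ∈ T
        p∈    : p ∈ T°
        a∈    : a ∈ T°
        con°  : Conn R (_∈ T°)
        reach : ∀ v → v ∈ T° → v ≡ p ⊎ Wk R (_∉ P) a v

    trim : ∀ {R : Rel} {T P a p} → Sym R → Conn R (_∈ T) → a ∈ T → p ∈ T → p ∈ P → Trimmed R T P a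
    trim {R} {T} {P} {a} {p} s con a∈ p∈ p∈P with first-hit (_∈? P) (con a p a∈ p∈) p∈P
    ... | p' , p'∈P , p'∈T , inj₁ refl = record
      { T° = p' ∷ [] ; p = p' ; p∈P = p'∈P ; sub = λ { _ (here refl) → p'∈T }
      ; p∈ = here refl ; a∈ = here refl
      ; con° = λ { _ _ (here refl) (here refl) → stop (here refl) }
      ; reach = λ { _ (here refl) → inj₁ refl } }
    ... | p' , p'∈P , p'∈T , inj₂ (y , w , r) with simple-path w
    ... | L , pa , _ , sat = record
      { T° = p' ∷ L ; p = p' ; p∈P = p'∈P
      ; sub = λ { _ (here refl) → p'∈T ; v (there q) → proj₁ (sat v q) }
      ; p∈ = here refl ; a∈ = there (path-head pa)
      ; con° = conn-root s p' λ { _ (here refl) → stop (here refl)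
                                ; x (there q) → wk-snoc (wk-mono (λ _ → there) (path-wk pa x q)) r (here refl) }
      ; reach = λ { _ (here refl) → inj₁ refl
                  ; v (there q) → inj₂ (wk-mono (λ z z∈ → proj₂ (sat z z∈)) (path-conn s pa a v (path-head pa) q)) } }

    -- Until it meets `x ∷ S`, a walk from `A` cannot use the new edge, since `y` is out of reach.
    -- So it is a walk of the old graph, and `S'` blocks it from `x ∷ S`; if it never met `x ∷ S`,
    -- it would join `A` to `B` past `S`.
    push : ∀ {R R' : Rel} {A B : Fin n → Set} {x y S S'} →
      (∀ {u v} → R' u v → R u v ⊎ (u ≡ x × v ≡ y) ⊎ (u ≡ y × v ≡ x)) →
      Separates R A B S → (∀ a → A a → ¬ Wk R (_∉ S) a y) →
      Separates R A (_∈ (x ∷ S)) S' → Separates R' A B S'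
    push {R} {R'} {A} {B} {x} {y} {S} {S'} split sep ¬y sep' a b Aa Bb w = start (a ∈? (x ∷ S))
      where
      run : ∀ {u} → Wk R (λ v → v ∉ S' × v ∉ (x ∷ S)) a u → ¬ Wk R' (_∉ S') u b
      run w (stop _) = sep a b Aa Bb (wk-mono (λ v q → proj₂ q ∘ there) w)
      run w (go p r w') with split r
      ... | inj₂ (inj₁ (refl , _)) = proj₂ (wk-end w) (here refl)
      ... | inj₂ (inj₂ (refl , _)) = ¬y a Aa (wk-mono (λ v q → proj₂ q ∘ there) w)
      run {u} w (go {v = v} p r w') | inj₁ r' with v ∈? (x ∷ S)
      ... | yes v∈ = sep' a v Aa v∈ (wk-snoc (wk-mono (λ _ → proj₁) w) r' (wk-start w'))
      ... | no v∉ = run (wk-snoc w r' (wk-start w' , v∉)) w'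
      start : ¬ Dec (a ∈ (x ∷ S))
      start (yes a∈) = sep' a a Aa a∈ (stop (wk-start w))
      start (no a∉) = run (stop (wk-start w , a∉)) w

    -- The `k` disjoint sets from `A` end in `x ∷ S`, which has at most `k` entries, so they use
    -- every position exactly once; likewise for `B` and `y ∷ S`. Sets with the same position are
    -- united: at position zero through the new edge, elsewhere at a common vertex of `S`.
    module Glue {R R' : Rel {n}} {A B : Fin n → Set} {x y : Fin n} {S : List (Fin n)} {k : ℕ}
      (s : Sym R) (s' : Sym R') (S<k : length S < k)
      (incl : ∀ {u v} → R u v → R' u v) (xy : R' x y)
      (sep : Separates R A B S) (¬x : ∀ b → B b → ¬ Wk R (_∉ S) b x) (¬y : ∀ a → A a → ¬ Wk R (_∉ S) a y)
      (LA : Linkage R A (_∈ (x ∷ S)) k) (LB : Linkage R B (_∈ (y ∷ S)) k)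
      (TA : ∀ i → Trimmed R (Linkage.T LA i) (x ∷ S) (proj₁ (Linkage.meetA LA i)))
      (TB : ∀ i → Trimmed R (Linkage.T LB i) (y ∷ S) (proj₁ (Linkage.meetA LB i))) where
      module LA = Linkage LA
      module LB = Linkage LB
      open Trimmed
      f g : Fin k → Fin (suc (length S))
      f i = index (p∈P (TA i))
      g i = index (p∈P (TB i))
      fp : ∀ i → p (TA i) ≡ lookup (x ∷ S) (f i)
      fp i = lookup-index (p∈P (TA i))
      gp : ∀ i → p (TB i) ≡ lookup (y ∷ S) (g i)
      gp i = lookup-index (p∈P (TB i))
      p∈LA : ∀ i → lookup (x ∷ S) (f i) ∈ LA.T i
      p∈LA i = subst (_∈ LA.T i) (fp i) (sub (TA i) _ (p∈ (TA i)))
      p∈LB : ∀ i → lookup (y ∷ S) (g i) ∈ LB.T i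
      p∈LB i = subst (_∈ LB.T i) (gp i) (sub (TB i) _ (p∈ (TB i)))
      f-inj : ∀ i j → f i ≡ f j → i ≡ j
      f-inj i j e = LA.dis i j _ (p∈LA i) (subst (λ z → lookup (x ∷ S) z ∈ LA.T j) (≡-sym e) (p∈LA j))
      g-inj : ∀ i j → g i ≡ g j → i ≡ j
      g-inj i j e = LB.dis i j _ (p∈LB i) (subst (λ z → lookup (y ∷ S) z ∈ LB.T j) (≡-sym e) (p∈LB j))

      module Inv (inv : Fin k → Fin k) (g-inv : ∀ i → g (inv i) ≡ f i) where
        U : Fin k → List (Fin n)
        U i = T° (TA i) ++ T° (TB (inv i))
        join : ∀ m {a b P} → a ≡ lookup (x ∷ S) m → b ≡ lookup (y ∷ S) m → P a → P b → Wk R' P a b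
        join zero refl refl Pa Pb = go Pa xy (stop Pb)
        join (suc m) refl refl Pa Pb = stop Pa
        bridge : ∀ i → Wk R' (_∈ U i) (p (TA i)) (p (TB (inv i)))
        bridge i = join (f i) (fp i) (trans (gp (inv i)) (cong (lookup (y ∷ S)) (g-inv i)))
          (∈-++⁺ˡ (p∈ (TA i))) (∈-++⁺ʳ (T° (TA i)) (p∈ (TB (inv i))))
        U-con : ∀ i → Conn R' (_∈ U i)
        U-con i = conn-root s' (p (TA i)) λ v v∈ → case ∈-++⁻ (T° (TA i)) v∈ of λ
          { (inj₁ q) → wk-map incl (λ _ → ∈-++⁺ˡ) (con° (TA i) v (p (TA i)) q (p∈ (TA i)))
          ; (inj₂ q) → wk-map incl (λ _ → ∈-++⁺ʳ (T° (TA i))) (con° (TB (inv i)) v _ q (p∈ (TB (inv i))))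
                         ⊙ wk-rev s' (bridge i) }
        -- The same vertex may occur at different positions of the two lists. Membership in one of
        -- the disjoint sets then decides which index it has.
        ends : ∀ i j v → (a b : Fin (suc (length S))) → f i ≡ a → f j ≡ b → v ≡ lookup (x ∷ S) a → v ≡ lookup (y ∷ S) b →
          v ∈ LA.T i → v ∈ LB.T (inv j) → i ≡ j
        ends i j v zero zero ea eb _ _ _ _ = f-inj i j (trans ea (≡-sym eb))
        ends i j v a (suc b) ea eb va vb p q = LA.dis i j v p
          (subst (_∈ LA.T j) (≡-sym vb) (subst (λ z → lookup (x ∷ S) z ∈ LA.T j) eb (p∈LA j)))
        ends i j v (suc a) zero ea eb va vb p q = f-inj i j (trans (≡-sym (g-inv i)) (trans (cong g same) (g-inv j)))
          where
          same : inv i ≡ inv j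
          same = LB.dis (inv i) (inv j) v (subst (_∈ LB.T (inv i)) (≡-sym va)
            (subst (λ z → lookup (y ∷ S) z ∈ LB.T (inv i)) (trans (g-inv i) ea) (p∈LB (inv i)))) q
        AB : ∀ i j v → v ∈ T° (TA i) → v ∈ T° (TB (inv j)) → i ≡ j
        AB i j v p q with reach (TA i) v p | reach (TB (inv j)) v q
        ... | inj₂ w | inj₂ w' = ⊥-elim (sep _ _ (proj₂ (proj₂ (LA.meetA i))) (proj₂ (proj₂ (LB.meetA (inv j))))
                (wk-mono (λ _ h → h ∘ there) w ⊙ wk-rev s (wk-mono (λ _ h → h ∘ there) w')))
        ... | inj₁ e | inj₂ w' = ⊥-elim (at e (p∈P (TA i)))
          where
          at : ∀ {z} → v ≡ z → z ∈ (x ∷ S) → ⊥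
          at refl (here refl) = ¬x _ (proj₂ (proj₂ (LB.meetA (inv j)))) (wk-mono (λ _ h → h ∘ there) w')
          at refl (there m) = wk-end w' (there m)
        ... | inj₂ w | inj₁ e = ⊥-elim (at e (p∈P (TB (inv j))))
          where
          at : ∀ {z} → v ≡ z → z ∈ (y ∷ S) → ⊥
          at refl (here refl) = ¬y _ (proj₂ (proj₂ (LA.meetA i))) (wk-mono (λ _ h → h ∘ there) w)
          at refl (there m) = wk-end w (there m)
        ... | inj₁ e | inj₁ e' = ends i j v (f i) (f j) refl refl (trans e (fp i))
                (trans e' (trans (gp (inv j)) (cong (lookup (y ∷ S)) (g-inv j))))
                (sub (TA i) v p) (sub (TB (inv j)) v q)
        U-dis : ∀ i j v → v ∈ U i → v ∈ U j → i ≡ j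
        U-dis i j v p q with ∈-++⁻ (T° (TA i)) p | ∈-++⁻ (T° (TA j)) q
        ... | inj₁ a | inj₁ b = LA.dis i j v (sub (TA i) v a) (sub (TA j) v b)
        ... | inj₁ a | inj₂ b = AB i j v a b
        ... | inj₂ a | inj₁ b = ≡-sym (AB j i v b a)
        ... | inj₂ a | inj₂ b = f-inj i j (trans (≡-sym (g-inv i)) (trans
                (cong g (LB.dis (inv i) (inv j) v (sub (TB (inv i)) v a) (sub (TB (inv j)) v b))) (g-inv j)))
        result : Linkage R' A B k
        result = record
          { T = U ; dis = U-dis ; con = U-con
          ; meetA = λ i → _ , ∈-++⁺ˡ (a∈ (TA i)) , proj₂ (proj₂ (LA.meetA i))
          ; meetB = λ i → _ , ∈-++⁺ʳ (T° (TA i)) (a∈ (TB (inv i))) , proj₂ (proj₂ (LB.meetA (inv i))) }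

      result : Linkage R' A B k
      result = Inv.result (λ i → proj₁ (onto (f i))) (λ i → proj₂ (onto (f i)))
        where
        onto : ∀ j → ∃ λ i → g i ≡ j
        onto = injective⇒onto g g-inj S<k

    glue : ∀ {R R' : Rel {n}} {A B : Fin n → Set} {x y S k} → Sym R → Sym R' → length S < k →
      (∀ {u v} → R u v → R' u v) → R' x y →
      Separates R A B S → (∀ b → B b → ¬ Wk R (_∉ S) b x) → (∀ a → A a → ¬ Wk R (_∉ S) a y) →
      Linkage R A (_∈ (x ∷ S)) k → Linkage R B (_∈ (y ∷ S)) k → Linkage R' A B k
    glue {R} {A = A} {B = B} {x = x} {y = y} {S = S} s s' S<k incl xy sep ¬x ¬y LA LB =
      Glue.result s s' S<k incl xy sep ¬x ¬y LA LB (trims A x LA) (trims B y LB)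
      where
      trims : ∀ C z (L : Linkage R C (_∈ (z ∷ S)) _) → ∀ i → Trimmed R (Linkage.T L i) (z ∷ S) (proj₁ (Linkage.meetA L i))
      trims C z L i = trim s (con i) (proj₁ (proj₂ (meetA i))) (proj₁ (proj₂ (meetB i))) (proj₂ (proj₂ (meetB i)))
        where open Linkage L

    Menger : Rel → Set₁
    Menger R = ∀ (A B : Fin n → Set) k → DN ((∃ λ S → length S < k × Separates R A B S) ⊎ Linkage R A B k)

    weaken : ∀ {R R' : Rel} {A B k} → (∀ {u v} → R u v → R' u v) → Linkage R A B k → Linkage R' A B k
    weaken incl L = record { T = T ; dis = dis ; con = λ i u v p q → wk-map incl (λ _ → id) (con i u v p q)
                           ; meetA = meetA ; meetB = meetB }
      where open Linkage L

    -- Göring's induction step: when S separates A from B without the new edge xy and A reaches x but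
    -- not y, link A to x ∷ S and B to y ∷ S.
    add-edge : ∀ {R R' : Rel} → Sym R → Sym R' → ∀ x y → (∀ {u v} → R u v → R' u v) → R' x y →
      (∀ {u v} → R' u v → R u v ⊎ (u ≡ x × v ≡ y) ⊎ (u ≡ y × v ≡ x)) → Menger R → Menger R'
    add-edge {R} {R'} s s' x y incl xy split men A B k = men A B k >>= λ
      { (inj₂ L) → return (inj₂ (weaken incl L))
      ; (inj₁ (S , S<k , sep)) → em (Reach S x) >>= λ rx → em (Reach S y) >>= λ ry → decide S S<k sep rx ry }
      where
      Reach : List (Fin n) → Fin n → Set
      Reach S v = ∃ λ a → A a × Wk R (_∉ S) a v
      closed : ∀ {S u w} → (Reach S x → Reach S y) → (Reach S y → Reach S x) → Reach S u → Wk R' (_∉ S) u w → Reach S w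
      closed f g r (stop _) = r
      closed f g r (go p e w) with split e
      ... | inj₁ e' = closed f g (proj₁ r , proj₁ (proj₂ r) , wk-snoc (proj₂ (proj₂ r)) e' (wk-start w)) w
      ... | inj₂ (inj₁ (refl , refl)) = closed f g (f r) w
      ... | inj₂ (inj₂ (refl , refl)) = closed f g (g r) w
      Goal : Set
      Goal = (∃ λ S → length S < k × Separates R' A B S) ⊎ Linkage R' A B k
      same : ∀ {S} → Separates R A B S → (Reach S x → Reach S y) → (Reach S y → Reach S x) → Separates R' A B S
      same sep f g a b Aa Bb w with closed f g (a , Aa , stop (wk-start w)) w
      ... | a' , Aa' , w' = sep a' b Aa' Bb w'
      one-side : ∀ {S} x' y' → (∀ {u v} → R' u v → R u v ⊎ (u ≡ x' × v ≡ y') ⊎ (u ≡ y' × v ≡ x')) → R' x' y' →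
        length S < k → Separates R A B S → Reach S x' → ¬ Reach S y' → DN Goal
      one-side {S} x' y' split' e S<k sep (a₀ , Aa₀ , w₀) ¬ry = men A (_∈ (x' ∷ S)) k >>= λ
        { (inj₁ (S' , S'<k , sep')) → return (inj₁ (S' , S'<k , push {R} {R'} {A} {B} split' sep ¬y sep'))
        ; (inj₂ LA) → men B (_∈ (y' ∷ S)) k >>= λ
          { (inj₁ (S' , S'<k , sep')) → return (inj₁ (S' , S'<k , λ a b Aa Bb w →
                push {R} {R'} {B} {A} (λ r → case split' r of λ { (inj₁ q) → inj₁ q ; (inj₂ (inj₁ q)) → inj₂ (inj₂ q) ; (inj₂ (inj₂ q)) → inj₂ (inj₁ q) })
                  sep˘ ¬x sep' b a Bb Aa (wk-rev s' w)))
          ; (inj₂ LB) → return (inj₂ (glue s s' S<k incl e sep ¬x ¬y LA LB)) } }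
        where
        ¬y : ∀ a → A a → ¬ Wk R (_∉ S) a y'
        ¬y a Aa w = ¬ry (a , Aa , w)
        ¬x : ∀ b → B b → ¬ Wk R (_∉ S) b x'
        ¬x b Bb w = sep a₀ b Aa₀ Bb (w₀ ⊙ wk-rev s w)
        sep˘ : Separates R B A S
        sep˘ b a Bb Aa w = sep a b Aa Bb (wk-rev s w)
      decide : ∀ S → length S < k → Separates R A B S → Dec (Reach S x) → Dec (Reach S y) → DN Goal
      -- Both ends of the new edge lie on the same side of `S`, so `S` still separates.
      decide S S<k sep (yes rx) (yes ry) = return (inj₁ (S , S<k , same sep (λ _ → ry) (λ _ → rx)))
      decide S S<k sep (no ¬rx) (no ¬ry) = return (inj₁ (S , S<k , same sep (λ r → contradiction r ¬rx) (λ r → contradiction r ¬ry)))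
      decide S S<k sep (yes rx) (no ¬ry) = one-side x y split xy S<k sep rx ¬ry
      decide S S<k sep (no ¬rx) (yes ry) = one-side y x
        (λ r → case split r of λ { (inj₁ q) → inj₁ q ; (inj₂ (inj₁ q)) → inj₂ (inj₂ q) ; (inj₂ (inj₂ q)) → inj₂ (inj₁ q) })
        (s' xy) S<k sep ry ¬rx

    no-edges : Menger (Edge [])
    no-edges A B k = pick (λ v → A v × B v) k >>= λ
      { (inj₂ (S , S<k , cov)) → return (inj₁ (S , S<k , λ
          { a .a Aa Ba (stop a∉) → a∉ (cov a (Aa , Ba))
          ; a b Aa Bb (go _ (inj₁ ()) _) ; a b Aa Bb (go _ (inj₂ ()) _) }))
      ; (inj₁ (L , uL , refl , sat)) → return (inj₂ (record
          { T = λ i → lookup L i ∷ []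
          ; dis = λ { i j v (here p) (here q) → unique-lookup uL i j (trans (≡-sym p) q) }
          ; con = λ { i _ _ (here refl) (here refl) → stop (here refl) }
          ; meetA = λ i → _ , here refl , proj₁ (sat _ (∈-lookup i))
          ; meetB = λ i → _ , here refl , proj₂ (sat _ (∈-lookup i)) })) }

    menger-edges : ∀ l → Menger (Edge l)
    menger-edges [] = no-edges
    menger-edges ((x , y) ∷ l) = add-edge (edge-sym l) (edge-sym _) x y
      (λ { (inj₁ p) → inj₁ (there p) ; (inj₂ p) → inj₂ (there p) }) (inj₁ (here refl))
      (λ { (inj₁ (here refl)) → inj₂ (inj₁ (refl , refl)) ; (inj₁ (there p)) → inj₁ (inj₁ p)
         ; (inj₂ (here refl)) → inj₂ (inj₂ (refl , refl)) ; (inj₂ (there p)) → inj₁ (inj₂ p) })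
      (menger-edges l)

  menger : ∀ {R : Rel {n}} → Sym R → (∀ u v → Dec (R u v)) → ∀ (A B : Fin n → Set) k →
    DN ((∃ λ S → length S < k × Separates R A B S) ⊎ Linkage R A B k)
  menger {R} s R? A B k = menger-edges l A B k >>= λ
    { (inj₁ (S , S<k , sep)) → return (inj₁ (S , S<k , λ a b Aa Bb w → sep a b Aa Bb (wk-map to (λ _ → id) w)))
    ; (inj₂ L) → return (inj₂ (weaken from L)) }
    where
    nbrs : Fin n → List (Fin n × Fin n)
    nbrs u = map (u ,_) (filter (R? u) (allFin n))
    l = concatMap nbrs (allFin n)
    to : ∀ {u v} → R u v → Edge l u v
    to {u} {v} r = inj₁ (∈-concatMap⁺ nbrs (∈-allFin u) (∈-map⁺ (u ,_) (∈-filter⁺ (R? u) (∈-allFin v) r)))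
    sound : ∀ {u v} → (u , v) ∈ l → R u v
    sound p with ∈-concatMap⁻ nbrs {allFin n} p
    ... | w , _ , q with ∈-map⁻ (w ,_) q
    ... | v , v∈ , refl = proj₂ (∈-filter⁻ (R? w) {xs = allFin n} v∈)
    from : ∀ {u v} → Edge l u v → R u v
    from (inj₁ p) = sound p
    from (inj₂ p) = s (sound p)

-- Havens force wheels

-- The total order of the separators of four path segments, which have orders 2t+1, t, 2t+1 and t.
havenOrder : ℕ → ℕ
havenOrder t = t + (suc (t + t) + (t + (suc (t + t) + 0)))

module Haven {n : ℕ} (G : Graph n) (Ω : Fin n → Set) {b : ℕ} (B : Fin b → Fin n) where

  private
    R : Rel {n}
    R = Adj G
    sR : Sym R
    sR = adj-sym G

  -- Two majorities of the indices of `B` share an index. Therefore the components singled out by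
  -- `Big` for different deleted sets always meet, as the sides of a haven must.
  Maj : (Fin n → Set) → Set
  Maj K = ∃ λ J → Unique J × b < length J + length J × (∀ i → i ∈ J → K (B i))

  Big : List (Fin n) → Fin n → Set
  Big S v = Maj (Wk R (Minus Ω S) v)

  Sep : List (Fin n) → List (Fin n) → Set
  Sep S A = ∀ a → a ∈ A → ¬ Big S a

  maj-meet : ∀ K K' → Maj K → Maj K' → ∃ λ v → K v × K' v
  maj-meet K K' (J , uJ , bJ , inJ) (J' , uJ' , bJ' , inJ') with share uJ uJ' (half (length J) (length J') bJ bJ')
    where
    half : ∀ x y → b < x + x → b < y + y → b < x + y
    half x y p q with ≤-total x y
    ... | inj₁ x≤y = <-≤-trans p (+-monoʳ-≤ x x≤y)
    ... | inj₂ y≤x = <-≤-trans q (+-monoˡ-≤ y y≤x)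
  ... | i , i∈ , i∈' = B i , inJ i i∈ , inJ' i i∈'

  big-meet : ∀ {S v S' v'} → Big S v → Big S' v' → ∃ λ w → Wk R (Minus Ω S) v w × Wk R (Minus Ω S') v' w
  big-meet = maj-meet _ _

  big-start : ∀ {S v} → Big S v → Minus Ω S v
  big-start {S} {v} h with big-meet {S} {v} {S} {v} h h
  ... | _ , w , _ = wk-start w

  big-mono : ∀ {S S' v} → (∀ x → x ∈ S' → x ∈ S) → Big S v → Big S' v
  big-mono sub (J , uJ , bJ , inJ) = J , uJ , bJ , λ i i∈ → wk-mono (λ x q → proj₁ q , proj₂ q ∘ sub x) (inJ i i∈)

  big-move : ∀ {S u v} → Big S v → Wk R (Minus Ω S) v u → Big S u
  big-move (J , uJ , bJ , inJ) w = J , uJ , bJ , λ i i∈ → wk-rev sR w ⊙ inJ i i∈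

  -- `Big` is constant on components, so every vertex of the walk is big, and `L` contains no big
  -- vertex.
  big-avoids : ∀ {S L v u} → Sep S L → Big S v → Wk R (Minus Ω S) v u → Wk R (λ x → Minus Ω L x × Big S x) v u
  big-avoids sep big w = wk-refine w λ x w' →
    (proj₁ (wk-end w') , λ x∈ → sep x x∈ (big-move big w')) , big-move big w'

  sep-++ : ∀ {S S' A A'} → Sep S A → Sep S' A' → Sep (S ++ S') (A ++ A')
  sep-++ {S} {A = A} p q a a∈ big with ∈-++⁻ A a∈
  ... | inj₁ h = p a h (big-mono (λ _ → ∈-++⁺ˡ) big)
  ... | inj₂ h = q a h (big-mono (λ _ → ∈-++⁺ʳ S) big)

  sep-∷ : ∀ {S A} u → Sep S A → Sep (u ∷ S) (u ∷ A)
  sep-∷ u p _ (here refl) big = proj₂ (big-start big) (here refl)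
  sep-∷ u p a (there a∈) big = p a a∈ (big-mono (λ _ → there) big)

  Linked : ℕ → List (Fin n) → Set
  Linked q A = ¬ ∃ λ S → length S < q × Sep S A

  linked-big : ∀ {q A S} → Linked q A → length S < q → DN (∃ λ a → a ∈ A × Big S a)
  linked-big {S = S} lk S<q k = lk (S , S<q , λ a a∈ big → k (a , a∈ , big))

  Attached : Fin n → List (Fin n) → Set
  Attached u P = ∀ x L → P ≡ x ∷ L → R x u

  -- The depth-first path P can be prolonged by u towards the big component of its complement.
  Next : List (Fin n) → Set
  Next P = ∃ λ u → ∃ λ S → ∃ λ v → Attached u P × Sep S P × Big S v × Wk R (Minus Ω P) u v

  -- The stretch `σ` is cut off from the big component by `q` vertices but not by fewer. Paths are
  -- listed with the newest vertex first, so `tl` is where `σ` is attached to the older path `P`.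
  record Segment (P : List (Fin n)) (q : ℕ) : Set where
    field
      σ : List (Fin n)
      hd tl : Fin n
      path : Path R hd σ tl
      att : Attached tl P
      uniq : Unique (σ ++ P)
      inΩ : ∀ v → v ∈ σ → Ω v
      linked : Linked q σ
      S : List (Fin n)
      S≤ : length S ≤ q
      sep : Sep S σ
      nxt : Next (σ ++ P)

  private
    -- The two big components meet, so there is a walk from `u` into the big component of `S'`,
    -- which does not contain `u`. The vertex behind the last visit to `u` prolongs the path.
    next-step : ∀ {u L S S' v v'} → Sep S L → Big S v → Wk R (Minus Ω L) u v →
      Sep S' (u ∷ L) → Big S' v' → Next (u ∷ L)
    next-step {u} {L} {S} {S'} {v} {v'} sep big w sep' big' with big-meet {S} {v} {S'} {v'} big big'
    ... | x , wx , wx' with last-exit (w ⊙ wk-mono (λ _ → proj₁) (big-avoids sep big wx) ⊙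
                wk-rev sR (wk-mono (λ z q → proj₁ (proj₁ q) , proj₂ (proj₁ q) ∘ there) (big-avoids sep' big' wx')))
              (λ { refl → sep' _ (here refl) big' })
    ... | u' , r , w' = u' , S' , v' , (λ { _ _ refl → r }) , sep' , big' ,
      wk-mono (λ { z ((oz , z∉) , z≢) → oz , λ { (here e) → z≢ e ; (there m) → z∉ m } }) w'

  -- One more vertex raises the order of a separator of `σ` by at most one. So `σ` grows until fewer
  -- than `q` vertices no longer suffice, and then `q` do. All separators in play have total order
  -- at most `s`, which keeps a big component in existence; the path cannot grow beyond `n`
  -- vertices.
  segment : ∀ {s} → (∀ S → length S ≤ s → DN (∃ λ v → Big S v)) →
    ∀ P SP q → Unique P → Sep SP P → q + length SP ≤ s → 1 ≤ q → Next P → DN (Segment P q)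
  segment {s} maj P SP q uP sepP bound 1≤q nxtP =
    grow (suc n) [] [] 1≤q (λ _ ()) (inj₁ refl) uP (λ _ ()) nxtP (s≤s (m≤m+n n (length P)))
    where
    prolong : ∀ {u σ} → (σ ≡ [] ⊎ ∃ λ hd → ∃ λ tl → Path R hd σ tl × Attached tl P) → Attached u (σ ++ P) →
      ∃ λ tl → Path R u (u ∷ σ) tl × Attached tl P
    prolong {u} (inj₁ refl) att = u , one , att
    prolong {u} (inj₂ (hd , tl , one , a)) att = tl , sR (att _ _ refl) ∷ one , a
    prolong {u} (inj₂ (hd , tl , r ∷ p , a)) att = tl , sR (att _ _ refl) ∷ r ∷ p , a
    grow : ∀ fuel σ S → length S < q → Sep S σ →
      (σ ≡ [] ⊎ ∃ λ hd → ∃ λ tl → Path R hd σ tl × Attached tl P) →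
      Unique (σ ++ P) → (∀ v → v ∈ σ → Ω v) → Next (σ ++ P) → n < fuel + length (σ ++ P) → DN (Segment P q)
    grow zero σ S _ _ _ u _ _ lt = contradiction (unique-bound u) (<⇒≱ lt)
    grow (suc fuel) σ S S<q sepS cur uσ oσ (u , S₀ , v₀ , att , sep₀ , big₀ , w₀) lt =
      maj ((u ∷ S) ++ SP) (≤-trans (≤-reflexive (length-++ (u ∷ S))) (≤-trans (+-monoˡ-≤ (length SP) S<q) bound)) >>= λ
        { (v' , big') → let nx = next-step sep₀ big₀ w₀ sep' big' in
          em (∃ λ S'' → length S'' < q × Sep S'' (u ∷ σ)) >>= λ
          { (yes (S'' , S''<q , sep'')) → grow fuel (u ∷ σ) S'' S''<q sep'' (inj₂ new) uniq' o' nx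
              (≤-trans lt (≤-reflexive (≡-sym (+-suc fuel _))))
          ; (no ¬sep) → return (record
              { σ = u ∷ σ ; hd = u ; tl = proj₁ new′ ; path = proj₁ (proj₂ new′) ; att = proj₂ (proj₂ new′)
              ; uniq = uniq' ; inΩ = o' ; linked = ¬sep ; S = u ∷ S ; S≤ = S<q ; sep = sep-∷ u sepS ; nxt = nx }) } }
      where
      sep' : Sep ((u ∷ S) ++ SP) ((u ∷ σ) ++ P)
      sep' = sep-++ (sep-∷ u sepS) sepP
      uniq' : Unique ((u ∷ σ) ++ P)
      uniq' = All-∉ (proj₂ (wk-start w₀)) ∷ uσ
      o' : ∀ v → v ∈ u ∷ σ → Ω v
      o' _ (here refl) = proj₁ (wk-start w₀)
      o' v (there m) = oσ v m
      new′ : ∃ λ tl → Path R u (u ∷ σ) tl × Attached tl P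
      new′ = prolong cur att
      new : ∃ λ hd → ∃ λ tl → Path R hd (u ∷ σ) tl × Attached tl P
      new = u , new′

  record Cycle (L : List (Fin n)) : Set where
    field
      {first last} : Fin n
      path : Path R first L last
      close : R last first
      uniq : Unique L

  -- Shorten the walk to end at its first vertex in `σ₃` and, read backwards from there, at its
  -- first in `σ₁`. What is left is a detour internally disjoint from the path, and it closes the
  -- stretch of the path that runs through `σ₂`.
  close-path : ∀ {σ₁ σ₂ σ₃ X h₁ t₁ h₂ t₂ h₃ t₃ a c} →
    Path R h₁ σ₁ t₁ → Path R h₂ σ₂ t₂ → Path R h₃ σ₃ t₃ → R h₁ t₂ → R h₂ t₃ →
    Unique (σ₃ ++ σ₂ ++ σ₁) → (∀ v → v ∈ σ₃ ++ σ₂ ++ σ₁ → Ω v × v ∉ X) →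
    a ∈ σ₁ → c ∈ σ₃ → Wk R (λ v → Ω v × v ∉ σ₂ × v ∉ X) a c →
    ∃ λ L → Cycle L × (∀ v → v ∈ σ₂ → v ∈ L) × (∀ v → v ∈ L → Ω v × v ∉ X)
  close-path {σ₁} {σ₂} {σ₃} {X} {h₁} {t₁} {h₂} {t₂} {h₃} {t₃} {a} {c} p₁ p₂ p₃ r₁ r₂ u okP a∈ c∈ w
    with first-hit (_∈? σ₃) w c∈
  ... | b , b∈ , _ , inj₁ refl = ⊥-elim (unique-++-disjoint σ₃ u a b∈ (∈-++⁺ʳ σ₂ a∈))
  ... | b , b∈ , _ , inj₂ (y , wy , ry) with path-suffix p₃ b∈ | first-hit (_∈? σ₁) (wk-rev sR wy) a∈
  ... | A₃ , B₃ , refl , pB | z , z∈ , _ , inner with path-prefix p₁ z∈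
  ... | A₁ , B₁ , refl , pA = finish inner
    where
    core : List (Fin n)
    core = B₃ ++ σ₂ ++ A₁
    pcore : Path R b core z
    pcore = path-++ pB (sR r₂) (path-++ p₂ (sR r₁) pA)
    u₃ : Unique (B₃ ++ σ₂ ++ A₁ ++ B₁)
    u₃ = unique-++ʳ A₃ (subst Unique (++-assoc A₃ B₃ (σ₂ ++ A₁ ++ B₁)) u)
    inP : ∀ v → v ∈ core → v ∈ (A₃ ++ B₃) ++ σ₂ ++ A₁ ++ B₁
    inP v m with ∈-++⁻ B₃ m
    ... | inj₁ q = ∈-++⁺ˡ (∈-++⁺ʳ A₃ q)
    ... | inj₂ q with ∈-++⁻ σ₂ q
    ... | inj₁ q' = ∈-++⁺ʳ (A₃ ++ B₃) (∈-++⁺ˡ q')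
    ... | inj₂ q' = ∈-++⁺ʳ (A₃ ++ B₃) (∈-++⁺ʳ σ₂ (∈-++⁺ˡ q'))
    ucore : Unique core
    ucore = unique-++ (unique-++ˡ B₃ u₃)
      (unique-++ (unique-++ˡ σ₂ u₂) (unique-++ˡ A₁ (unique-++ʳ σ₂ u₂)) (λ v m q → unique-++-disjoint σ₂ u₂ v m (∈-++⁺ˡ q)))
      (λ v m q → unique-++-disjoint B₃ u₃ v m ([ ∈-++⁺ˡ , ∈-++⁺ʳ σ₂ ∘ ∈-++⁺ˡ ]′ (∈-++⁻ σ₂ q)))
      where
      u₂ : Unique (σ₂ ++ A₁ ++ B₁)
      u₂ = unique-++ʳ B₃ u₃
    Goal : Set
    Goal = ∃ λ L → Cycle L × (∀ v → v ∈ σ₂ → v ∈ L) × (∀ v → v ∈ L → Ω v × v ∉ X)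
    finish : (y ≡ z ⊎ ∃ λ y' → Wk R (Without (Without (λ v → Ω v × v ∉ σ₂ × v ∉ X) (_∈ (A₃ ++ B₃))) (_∈ (A₁ ++ B₁))) y y' × R y' z) → Goal
    -- The detour is a single edge.
    finish (inj₁ refl) = core , record { path = pcore ; close = ry ; uniq = ucore } ,
      (λ v m → ∈-++⁺ʳ B₃ (∈-++⁺ˡ m)) , (λ v m → okP v (inP v m))
    finish (inj₂ (y' , wy' , ry')) with simple-path (wk-rev sR wy')
    ... | I , pI , uI , sat = core ++ I ,
      record { path = path-++ pcore (sR ry') pI ; close = ry
             ; uniq = unique-++ ucore uI (λ v m q → apart v m (sat v q)) } ,
      (λ v m → ∈-++⁺ˡ (∈-++⁺ʳ B₃ (∈-++⁺ˡ m))) ,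
      (λ v m → case ∈-++⁻ core m of λ
        { (inj₁ q) → okP v (inP v q)
        ; (inj₂ q) → case sat v q of λ { (((o , _ , x) , _) , _) → o , x } })
      where
      apart : ∀ v → v ∈ core → ¬ Without (Without (λ v → Ω v × v ∉ σ₂ × v ∉ X) (_∈ (A₃ ++ B₃))) (_∈ (A₁ ++ B₁)) v
      apart v m (((_ , ∉₂ , _) , ∉₃) , ∉₁) with ∈-++⁻ B₃ m
      ... | inj₁ q = ∉₃ (∈-++⁺ʳ A₃ q)
      ... | inj₂ q with ∈-++⁻ σ₂ q
      ... | inj₁ q' = ∉₂ q'
      ... | inj₂ q' = ∉₁ (∈-++⁺ˡ q')

  private
    -- `menger` deletes vertices but knows no ambient vertex set, so the restriction to `Ω` is put
    -- into the edges.
    RΩ : Rel {n}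
    RΩ u v = R u v × Ω u × Ω v

    wk-Ω : ∀ {S u v} → Wk R (Minus Ω S) u v → Wk RΩ (_∉ S) u v
    wk-Ω (stop p) = stop (proj₂ p)
    wk-Ω (go p r w) = go (proj₂ p) (r , proj₁ p , proj₁ (wk-start w)) (wk-Ω w)

    Ω-back : ∀ {P u v} → Wk RΩ P u v → Ω v → Ω u
    Ω-back (stop _) o = o
    Ω-back (go _ (_ , o , _) _) _ = o

  -- Followed from `σ`, each linkage set yields a spoke that ends at its first vertex on the cycle.
  -- These ends are the marks; `σ` and the interiors of the spokes form the hub.
  cycle-hub : ∀ t {L σ h e} → Cycle L → (∀ v → v ∈ L → Ω v × v ∉ σ) → Path R h σ e → (∀ v → v ∈ σ → Ω v) →
    Linkage RΩ (_∈ L) (_∈ σ) (suc t) →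
    Σ (Model G (wheelAdj (suc t))) λ M → ∀ v → InModel M v → Ω v
  cycle-hub t {L} {σ} {h} {e} cyc okL pσ okσ lk = proj₁ built , λ v m → [ (λ q → proj₁ (okL v q)) , hub-Ω v ]′ (proj₂ built v m)
    where
    open Linkage lk
    module C = Cycle cyc
    record Spoke (i : Fin (suc t)) : Set where
      field
        c : Fin n
        c∈L : c ∈ L
        c∈T : c ∈ T i
        I : List (Fin n)
        {a y} : Fin n
        pI : Path RΩ a I y
        a∈ : a ∈ σ
        yc : R y c
        I-sub : ∀ v → v ∈ I → v ∈ T i × v ∉ L
    spoke : ∀ i → Spoke i
    spoke i with meetA i | meetB i
    ... | x , x∈T , x∈L | a , a∈T , a∈σ with first-hit (_∈? L) (con i a x a∈T x∈T) x∈L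
    ... | c , c∈L , c∈T , inj₁ refl = ⊥-elim (proj₂ (okL _ c∈L) a∈σ)
    ... | c , c∈L , c∈T , inj₂ (y , w , r) with simple-path w
    ... | I , pI , _ , sat = record { c = c ; c∈L = c∈L ; c∈T = c∈T ; I = I ; pI = pI ; a∈ = a∈σ ; yc = proj₁ r ; I-sub = sat }
    open Spoke
    hub : List (Fin n)
    hub = σ ++ concatMap (λ i → I (spoke i)) (allFin (suc t))
    I⊂hub : ∀ i v → v ∈ I (spoke i) → v ∈ hub
    I⊂hub i v m = ∈-++⁺ʳ σ (∈-concatMap⁺ (λ i → I (spoke i)) (∈-allFin i) m)
    hub-case : ∀ {P : Fin n → Set} → (∀ v → v ∈ σ → P v) → (∀ i v → v ∈ I (spoke i) → P v) → ∀ v → v ∈ hub → P v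
    hub-case f g v m with ∈-++⁻ σ m
    ... | inj₁ q = f v q
    ... | inj₂ q with ∈-concatMap⁻ (λ i → I (spoke i)) {allFin (suc t)} q
    ... | i , _ , q' = g i v q'
    hub-Ω : ∀ v → v ∈ hub → Ω v
    hub-Ω = hub-case okσ λ i v m → Ω-back (con i v (c (spoke i)) (proj₁ (I-sub (spoke i) v m)) (c∈T (spoke i))) (proj₁ (okL _ (c∈L (spoke i))))
    to-h : ∀ v → v ∈ σ → Wk R (_∈ hub) v h
    to-h v m = wk-mono (λ _ → ∈-++⁺ˡ) (path-conn sR pσ v h m (path-head pσ))
    hub-conn : Conn R (_∈ hub)
    hub-conn = conn-root sR h (hub-case to-h λ i v m →
      wk-rev sR (wk-mono (I⊂hub i) (path-wk′ i v m)) ⊙ to-h _ (a∈ (spoke i)))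
      where
      path-wk′ : ∀ i v → v ∈ I (spoke i) → Wk R (_∈ I (spoke i)) (a (spoke i)) v
      path-wk′ i v m = path-conn sR (path-map proj₁ (pI (spoke i))) _ v (path-head (pI (spoke i))) m
    marks : List (Fin n)
    marks = map (λ i → c (spoke i)) (allFin (suc t))
    umarks : Unique marks
    umarks = unique-map
      (λ {i} {j} e → dis i j _ (c∈T (spoke i)) (subst (_∈ T j) (≡-sym e) (c∈T (spoke j)))) (allFin⁺ (suc t))
    built = wheel G t C.path C.uniq C.close hub hub-conn
      (hub-case (λ v m q → proj₂ (okL v q) m) (λ i v m → proj₂ (I-sub (spoke i) v m)))
      marks umarks (trans (length-map _ (allFin (suc t))) (length-allFin (suc t)))
      λ v m → case ∈-map⁻ (λ i → c (spoke i)) {xs = allFin (suc t)} m of λ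
        { (i , _ , refl) → c∈L (spoke i) , _ , I⊂hub i _ (path-last (pI (spoke i))) , yc (spoke i) }

  -- A depth-first path runs through segments σ₁, …, σ₄. As σ₁ and σ₃ are more strongly linked to the big
  -- component than σ₂ and σ₄ together can block, they are joined avoiding σ₂ and σ₄; this closes a cycle
  -- through σ₂, and σ₄ becomes the hub.
  haven-wheel : ∀ t → (∀ S → length S ≤ havenOrder (suc t) → DN (∃ λ v → Big S v)) →
    DN (Σ (Model G (wheelAdj (suc t))) λ M → ∀ v → InModel M v → Ω v)
  haven-wheel t′ maj = do
    v₀ , big₀ ← maj [] z≤n
    s₁ ← segment maj [] [] q [] (λ _ ()) (b₁ z≤n) (s≤s z≤n)
           (v₀ , [] , v₀ , (λ _ _ ()) , (λ _ ()) , big₀ , stop (proj₁ (big-start big₀) , λ ()))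
    let module s₁ = Segment s₁
    s₂ ← segment maj (s₁.σ ++ []) (s₁.S ++ []) t s₁.uniq (sep-++ s₁.sep (λ _ ())) (b₂ (len s₁.S s₁.S≤ z≤n)) (s≤s z≤n) s₁.nxt
    let module s₂ = Segment s₂
    s₃ ← segment maj (s₂.σ ++ s₁.σ ++ []) (s₂.S ++ s₁.S ++ []) q s₂.uniq (sep-++ s₂.sep (sep-++ s₁.sep (λ _ ())))
           (b₃ (len s₂.S s₂.S≤ (len s₁.S s₁.S≤ z≤n))) (s≤s z≤n) s₂.nxt
    let module s₃ = Segment s₃
    s₄ ← segment maj (s₃.σ ++ s₂.σ ++ s₁.σ ++ []) (s₃.S ++ s₂.S ++ s₁.S ++ []) t s₃.uniq
           (sep-++ s₃.sep (sep-++ s₂.sep (sep-++ s₁.sep (λ _ ()))))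
           (+-monoʳ-≤ t (len s₃.S s₃.S≤ (len s₂.S s₂.S≤ (len s₁.S s₁.S≤ z≤n)))) (s≤s z≤n) s₃.nxt
    let module s₄ = Segment s₄
    a , a∈ , biga ← linked-big {S = s₂.S ++ s₄.S} s₁.linked (s≤s (≤-trans (≤-reflexive (length-++ s₂.S)) (+-mono-≤ s₂.S≤ s₄.S≤)))
    c , c∈ , bigc ← linked-big {S = s₂.S ++ s₄.S} s₃.linked (s≤s (≤-trans (≤-reflexive (length-++ s₂.S)) (+-mono-≤ s₂.S≤ s₄.S≤)))
    let w = walk s₂.σ s₄.σ (sep-++ s₂.sep s₄.sep) biga bigc
        L , cyc , σ₂⊂ , okL = close-path s₁.path s₂.path s₃.path
          (head-att s₁.path s₂.att) (head-att s₂.path s₃.att)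
          (subst (λ z → Unique (s₃.σ ++ s₂.σ ++ z)) (++-identityʳ s₁.σ) s₃.uniq)
          (λ v m → all-Ω s₁.inΩ s₂.inΩ s₃.inΩ v m , λ m' →
            unique-++-disjoint s₄.σ s₄.uniq v m' (subst (λ z → v ∈ s₃.σ ++ s₂.σ ++ z) (≡-sym (++-identityʳ s₁.σ)) m))
          a∈ c∈ w
    RΩ? ← dn-Fin (λ u → dn-Fin λ v → em (RΩ u v))
    men ← menger {R = RΩ} (λ { (r , o , o') → sR r , o' , o }) RΩ? (_∈ L) (_∈ s₄.σ) (suc t′)
    case men of λ
      { (inj₂ lk) → return (cycle-hub t′ cyc okL s₄.path s₄.inΩ lk)
      -- Fewer than `t` vertices leave big vertices in both `σ₂`, which lies on the cycle, and `σ₄`.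
      -- As these are joined outside `S`, no such `S` separates.
      ; (inj₁ (S , S<t , sepS)) → do
          x , x∈ , bigx ← linked-big s₂.linked S<t
          y , y∈ , bigy ← linked-big s₄.linked S<t
          case big-meet {S} {x} {S} {y} bigx bigy of λ { (z , wz , wz') →
            ⊥-elim (sepS x y (σ₂⊂ x x∈) y∈ (wk-Ω (wz ⊙ wk-rev sR wz'))) } }
    where
    t = suc t′
    q = suc (t + t)
    len : ∀ S {x y} {S' : List (Fin n)} → length S ≤ x → length S' ≤ y → length (S ++ S') ≤ x + y
    len S p p' = ≤-trans (≤-reflexive (length-++ S)) (+-mono-≤ p p')
    b₃ : ∀ {x} → x ≤ t + (q + 0) → q + x ≤ havenOrder t
    b₃ p = ≤-trans (+-monoʳ-≤ q p) (m≤n+m _ t)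
    b₂ : ∀ {x} → x ≤ q + 0 → t + x ≤ havenOrder t
    b₂ p = ≤-trans (+-monoʳ-≤ t p) (≤-trans (m≤n+m _ q) (m≤n+m _ t))
    b₁ : ∀ {x} → x ≤ 0 → q + x ≤ havenOrder t
    b₁ p = ≤-trans (+-monoʳ-≤ q p) (≤-trans (m≤n+m _ t) (≤-trans (m≤n+m _ q) (m≤n+m _ t)))
    head-att : ∀ {h σ e u P} → Path R h σ e → Attached u (σ ++ P) → R h u
    head-att one att = att _ _ refl
    head-att (_ ∷ _) att = att _ _ refl
    all-Ω : ∀ {σ₁ σ₂ σ₃} → (∀ v → v ∈ σ₁ → Ω v) → (∀ v → v ∈ σ₂ → Ω v) → (∀ v → v ∈ σ₃ → Ω v) →
      ∀ v → v ∈ σ₃ ++ σ₂ ++ σ₁ → Ω v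
    all-Ω {σ₂ = σ₂} {σ₃} o₁ o₂ o₃ v m with ∈-++⁻ σ₃ m
    ... | inj₁ p = o₃ v p
    ... | inj₂ p with ∈-++⁻ σ₂ p
    ... | inj₁ p' = o₂ v p'
    ... | inj₂ p' = o₁ v p'
    walk : ∀ {S a c} (σ σ' : List (Fin n)) → Sep S (σ ++ σ') → Big S a → Big S c → Wk R (λ v → Ω v × v ∉ σ × v ∉ σ') a c
    walk {S} {a} {c} σ σ' sep ba bc with big-meet {S} {a} {S} {c} ba bc
    ... | x , wx , wx' = f (big-avoids sep ba wx) ⊙ wk-rev sR (f (big-avoids sep bc wx'))
      where
      f : ∀ {S u v} → Wk R (λ x → Minus Ω (σ ++ σ') x × Big S x) u v → Wk R (λ v → Ω v × v ∉ σ × v ∉ σ') u v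
      f = wk-mono λ { _ ((o , ∉) , _) → o , ∉ ∘ ∈-++⁺ˡ , ∉ ∘ ∈-++⁺ʳ σ }

-- Counting

tr? : (x : Bool) → Dec (x ≡ true)
tr? true = yes refl
tr? false = no λ ()

¬true : ∀ {x} → ¬ x ≡ true → x ≡ false
¬true {true} h = contradiction refl h
¬true {false} _ = refl

true≢false : ∀ {x} → x ≡ true → x ≡ false → ⊥
true≢false refl ()

does-true : ∀ {P : Set} (d : Dec P) → P → ⌊ d ⌋ ≡ true
does-true (yes _) _ = refl
does-true (no ¬p) p = contradiction p ¬p

true-does : ∀ {P : Set} (d : Dec P) → ⌊ d ⌋ ≡ true → P
true-does (yes p) _ = p

∑ : ∀ {n} → (Fin n → ℕ) → ℕ
∑ {zero} f = 0
∑ {suc n} f = f zero + ∑ (f ∘ suc)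

∑-mono : ∀ {n} {f g : Fin n → ℕ} → (∀ i → f i ≤ g i) → ∑ f ≤ ∑ g
∑-mono {zero} h = z≤n
∑-mono {suc n} h = +-mono-≤ (h zero) (∑-mono (h ∘ suc))

∑-cong : ∀ {n} {f g : Fin n → ℕ} → (∀ i → f i ≡ g i) → ∑ f ≡ ∑ g
∑-cong {zero} h = refl
∑-cong {suc n} h = cong₂ _+_ (h zero) (∑-cong (h ∘ suc))

+-interchange : ∀ a b c d → (a + b) + (c + d) ≡ (a + c) + (b + d)
+-interchange a b c d = trans (+-assoc a b (c + d)) (trans
  (cong (a +_) (trans (≡-sym (+-assoc b c d)) (trans (cong (_+ d) (+-comm b c)) (+-assoc c b d))))
  (≡-sym (+-assoc a c (b + d))))

∑-+ : ∀ {n} (f g : Fin n → ℕ) → ∑ (λ i → f i + g i) ≡ ∑ f + ∑ g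
∑-+ {zero} f g = refl
∑-+ {suc n} f g = trans (cong (f zero + g zero +_) (∑-+ (f ∘ suc) (g ∘ suc)))
  (+-interchange (f zero) (g zero) _ _)

∑-zero : ∀ {n} → ∑ {n} (λ _ → 0) ≡ 0
∑-zero {zero} = refl
∑-zero {suc n} = ∑-zero {n}

∑-swap : ∀ {m n} (f : Fin m → Fin n → ℕ) → ∑ (λ i → ∑ (f i)) ≡ ∑ (λ j → ∑ (λ i → f i j))
∑-swap {zero} {n} f = ≡-sym (∑-zero {n})
∑-swap {suc m} f = trans (cong (∑ (f zero) +_) (∑-swap (f ∘ suc))) (≡-sym (∑-+ (f zero) _))

∑-* : ∀ {n} c (f : Fin n → ℕ) → ∑ (λ i → c * f i) ≡ c * ∑ f
∑-* {zero} c f = ≡-sym (*-zeroʳ c)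
∑-* {suc n} c f = trans (cong (c * f zero +_) (∑-* c (f ∘ suc))) (≡-sym (*-distribˡ-+ c (f zero) _))

∑-bump : ∀ {n} {f g : Fin n → ℕ} j {x} → (∀ i → f i ≤ g i) → f j + x ≤ g j → ∑ f + x ≤ ∑ g
∑-bump {suc n} {f} {g} zero {x} h b = ≤-trans (≤-reflexive (trans (+-assoc (f zero) _ x)
    (trans (cong (f zero +_) (+-comm _ x)) (≡-sym (+-assoc (f zero) x _)))))
  (+-mono-≤ b (∑-mono (h ∘ suc)))
∑-bump {suc n} {f} {g} (suc j) {x} h b = ≤-trans (≤-reflexive (+-assoc (f zero) _ x))
  (+-mono-≤ (h zero) (∑-bump j (h ∘ suc) b))

∑-pick : ∀ {n} (f : Fin n → ℕ) j → f j ≤ ∑ f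
∑-pick {n} f j = ≤-trans (≤-reflexive (cong (_+ f j) (≡-sym (∑-zero {n}))))
  (∑-bump {n} {λ _ → 0} {f} j (λ _ → z≤n) ≤-refl)

∑-find : ∀ {n} {f g : Fin n → ℕ} → ∑ f < ∑ g → ∃ λ i → f i < g i
∑-find {f = f} {g} lt with any? (λ i → f i <? g i)
... | yes h = h
... | no ∄ = contradiction (∑-mono (λ i → ≮⇒≥ (λ l → ∄ (i , l)))) (<⇒≱ lt)

b2n : Bool → ℕ
b2n true = 1
b2n false = 0

b2n-mono : ∀ {x y} → (x ≡ true → y ≡ true) → b2n x ≤ b2n y
b2n-mono {false} _ = z≤n
b2n-mono {true} h rewrite h refl = ≤-refl

b2n-true : ∀ {x} → x ≡ true → b2n x ≡ 1
b2n-true refl = refl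

b2n-false : ∀ {x} → ¬ x ≡ true → b2n x ≡ 0
b2n-false h rewrite ¬true h = refl

∑-delta : ∀ {n} (j : Fin n) c → ∑ (λ i → b2n ⌊ i ≟ j ⌋ * c) ≡ c
∑-delta {suc n} zero c = trans (cong (c + 0 +_) (∑-zero {n})) (trans (+-identityʳ _) (+-identityʳ c))
∑-delta {suc n} (suc j) c = trans (∑-cong λ i → cong (λ z → b2n z * c) (same i)) (∑-delta j c)
  where
  same : ∀ i → ⌊ suc i ≟ suc j ⌋ ≡ ⌊ i ≟ j ⌋
  same i with i ≟ j
  ... | yes _ = refl
  ... | no _ = refl

card : ∀ {n} → (Fin n → Bool) → ℕ
card A = ∑ (b2n ∘ A)

card-mono : ∀ {n} (A B : Fin n → Bool) → (∀ v → A v ≡ true → B v ≡ true) → card A ≤ card B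
card-mono A B h = ∑-mono (λ v → b2n-mono (h v))

private
  cons-if : ∀ {n} → Bool → List (Fin (suc n)) → List (Fin (suc n))
  cons-if true L = zero ∷ L
  cons-if false L = L

listOf : ∀ {n} → (Fin n → Bool) → List (Fin n)
listOf {zero} A = []
listOf {suc n} A = cons-if (A zero) (map suc (listOf (A ∘ suc)))

length-listOf : ∀ {n} (A : Fin n → Bool) → length (listOf A) ≡ card A
length-listOf {zero} A = refl
length-listOf {suc n} A with A zero
... | true = cong suc (trans (length-map suc (listOf (A ∘ suc))) (length-listOf (A ∘ suc)))
... | false = trans (length-map suc (listOf (A ∘ suc))) (length-listOf (A ∘ suc))

∈-listOf : ∀ {n} (A : Fin n → Bool) v → A v ≡ true → v ∈ listOf A
∈-listOf A zero e rewrite e = here refl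
∈-listOf A (suc v) e with A zero
... | true = there (∈-map⁺ suc (∈-listOf (A ∘ suc) v e))
... | false = ∈-map⁺ suc (∈-listOf (A ∘ suc) v e)

listOf-∈ : ∀ {n} (A : Fin n → Bool) v → v ∈ listOf A → A v ≡ true
listOf-∈ {suc n} A v m with A zero in eq
listOf-∈ {suc n} A .zero (here refl) | true = eq
listOf-∈ {suc n} A v (there m) | true with ∈-map⁻ suc m
... | w , w∈ , refl = listOf-∈ (A ∘ suc) w w∈
listOf-∈ {suc n} A v m | false with ∈-map⁻ suc m
... | w , w∈ , refl = listOf-∈ (A ∘ suc) w w∈

unique-listOf : ∀ {n} (A : Fin n → Bool) → Unique (listOf A)
unique-listOf {zero} A = []
unique-listOf {suc n} A with A zero
... | true = All-∉ zero∉ ∷ unique-map suc-inj (unique-listOf (A ∘ suc))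
  where
  suc-inj : ∀ {i j : Fin n} → suc i ≡ suc j → i ≡ j
  suc-inj refl = refl
  zero∉ : zero ∉ map suc (listOf (A ∘ suc))
  zero∉ m with ∈-map⁻ suc m
  ... | _ , _ , ()
... | false = unique-map suc-inj (unique-listOf (A ∘ suc))
  where
  suc-inj : ∀ {i j : Fin n} → suc i ≡ suc j → i ≡ j
  suc-inj refl = refl

card-cover : ∀ {n} (A : Fin n → Bool) L → (∀ v → A v ≡ true → v ∈ L) → card A ≤ length L
card-cover A L h = ≤-trans (≤-reflexive (≡-sym (length-listOf A)))
  (unique-⊆ (unique-listOf A) (λ v m → h v (listOf-∈ A v m)))

card-list : ∀ {n} (A : Fin n → Bool) L → Unique L → (∀ v → v ∈ L → A v ≡ true) → length L ≤ card A
card-list A L u h = ≤-trans (unique-⊆ u (λ v m → ∈-listOf A v (h v m))) (≤-reflexive (length-listOf A))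

shorten : ∀ {n} (L : List (Fin n)) k → Unique L → k ≤ length L →
  ∃ λ L' → Unique L' × length L' ≡ k × (∀ v → v ∈ L' → v ∈ L)
shorten L zero u _ = [] , [] , refl , λ _ ()
shorten (x ∷ L) (suc k) (x∉ ∷ u) (s≤s le) with shorten L k u le
... | L' , u' , l' , sub = x ∷ L' , All-∉ (∉-All x∉ ∘ sub x) ∷ u' , cong suc l' ,
  λ { _ (here refl) → here refl ; v (there m) → there (sub v m) }

-- Degrees and densities

module _ {n : ℕ} where

  BRel : Set
  BRel = Fin n → Fin n → Bool

  Tr : BRel → Rel {n}
  Tr R u v = R u v ≡ true

  deg : BRel → (Fin n → Bool) → Fin n → ℕ
  deg R A v = ∑ λ u → b2n (A u ∧ R v u)

  -- Ordered pairs are counted, that is, twice the number of edges.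
  pairs : BRel → (Fin n → Bool) → ℕ
  pairs R A = ∑ λ v → ∑ λ u → b2n (A v ∧ (A u ∧ R v u))

  nonempty-pairs : ∀ R A {d} → d < pairs R A → ∃ λ v → A v ≡ true
  nonempty-pairs R A {d} lt with any? (λ v → tr? (A v))
  ... | yes h = h
  ... | no ∄ = contradiction lt (≤⇒≯ (≤-trans (≤-reflexive zero-pairs) z≤n))
    where
    zero-pairs : pairs R A ≡ 0
    zero-pairs = trans (∑-cong λ v → trans (∑-cong λ u → cong (λ z → b2n (z ∧ (A u ∧ R v u))) (¬true (λ e → ∄ (v , e)))) (∑-zero {n})) (∑-zero {n})

  without : (Fin n → Bool) → Fin n → Fin n → Bool
  without A v u = A u ∧ not ⌊ u ≟ v ⌋

  without-sub : ∀ A v u → without A v u ≡ true → A u ≡ true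
  without-sub A v u e = proj₁ (∧-true e)

  card-without : ∀ A v → A v ≡ true → suc (card (without A v)) ≤ card A
  card-without A v e = ≤-trans (≤-reflexive (+-comm 1 _))
    (∑-bump v (λ u → b2n-mono (without-sub A v u)) at)
    where
    at : b2n (without A v v) + 1 ≤ b2n (A v)
    at with v ≟ v
    ... | yes _ rewrite e = ≤-refl
    ... | no ¬p = contradiction refl ¬p

  pairs-without : ∀ R A v → (∀ u w → R u w ≡ R w u) → pairs R A ≤ pairs R (without A v) + (deg R A v + deg R A v)
  pairs-without R A v sym = ≤-trans (∑-mono λ u → ∑-mono λ w → point u w) (≤-reflexive total)
    where
    A' = without A v
    F : Fin n → Fin n → ℕ
    F u w = b2n (A' u ∧ (A' w ∧ R u w))
    D₁ D₂ : Fin n → Fin n → ℕ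
    D₁ u w = b2n ⌊ u ≟ v ⌋ * b2n (A w ∧ R v w)
    D₂ u w = b2n ⌊ w ≟ v ⌋ * b2n (A u ∧ R v u)
    point : ∀ u w → b2n (A u ∧ (A w ∧ R u w)) ≤ F u w + (D₁ u w + D₂ u w)
    point u w with A u | A w | R u w in e
    ... | false | _ | _ = z≤n
    ... | true | false | _ = z≤n
    ... | true | true | false = z≤n
    ... | true | true | true with u ≟ v
    ... | yes refl rewrite e = s≤s z≤n
    ... | no _ with w ≟ v
    ... | yes refl rewrite trans (sym v u) e = s≤s z≤n
    ... | no _ = s≤s z≤n
    d = deg R A v
    total : ∑ (λ u → ∑ λ w → F u w + (D₁ u w + D₂ u w)) ≡ pairs R A' + (d + d)
    total = trans (∑-cong λ u → trans (∑-+ (F u) _) (cong (∑ (F u) +_) (∑-+ (D₁ u) (D₂ u))))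
      (trans (∑-+ (λ u → ∑ (F u)) _) (cong (pairs R A' +_) (trans (∑-+ (λ u → ∑ (D₁ u)) (λ u → ∑ (D₂ u))) (cong₂ _+_ t₁ t₂))))
      where
      t₁ : ∑ (λ u → ∑ (D₁ u)) ≡ d
      t₁ = trans (∑-cong {n} {λ u → ∑ (D₁ u)} {λ u → b2n ⌊ u ≟ v ⌋ * d} λ u → ∑-* {n} (b2n ⌊ u ≟ v ⌋) (λ w → b2n (A w ∧ R v w))) (∑-delta v d)
      t₂ : ∑ (λ u → ∑ (D₂ u)) ≡ d
      t₂ = ∑-cong {n} {λ u → ∑ (D₂ u)} {λ u → b2n (A u ∧ R v u)} λ u → ∑-delta v _

  -- Deleting a vertex of degree at most `d`/2 removes at most `d` ordered pairs and lowers
  -- `d * card A` by at least `d`, so the strict inequality persists. It also keeps the set from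
  -- becoming empty.
  peel : ∀ R → (∀ u w → R u w ≡ R w u) → ∀ m A d → card A ≤ m → d * card A < pairs R A →
    ∃ λ A' → (∀ v → A' v ≡ true → A v ≡ true) × (∃ λ v → A' v ≡ true) ×
      (∀ v → A' v ≡ true → d < deg R A' v + deg R A' v)
  peel R sym m A d le lt with any? (λ v → tr? (A v) ×-dec (deg R A v + deg R A v ≤? d))
  ... | no ∄ = A , (λ _ → id) , nonempty-pairs R A lt , λ v e → ≰⇒> (λ l → ∄ (v , e , l))
  peel R sym zero A d le lt | yes (v , e , small) = contradiction (≤-trans (card-without A v e) le) λ ()
  peel R sym (suc m) A d le lt | yes (v , e , small)
    with peel R sym m (without A v) d (≤-pred (≤-trans (card-without A v e) le)) still
    where
    open ≤-Reasoning
    still : d * card (without A v) < pairs R (without A v)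
    still = +-cancelʳ-< d _ _ (begin-strict
      d * card (without A v) + d   ≡⟨ trans (+-comm _ d) (≡-sym (*-suc d _)) ⟩
      d * suc (card (without A v)) ≤⟨ *-monoʳ-≤ d (card-without A v e) ⟩
      d * card A                   <⟨ lt ⟩
      pairs R A                    ≤⟨ pairs-without R A v sym ⟩
      pairs R (without A v) + (deg R A v + deg R A v) ≤⟨ +-monoʳ-≤ (pairs R (without A v)) small ⟩
      pairs R (without A v) + d ∎)
  ... | A' , sub , ne , min = A' , (λ w → without-sub A v w ∘ sub w) , ne , min

-- Small wheels in dense graphs

half-< : ∀ {a b} → a + a < b + b → a < b
half-< {a} {b} lt with a <? b
... | yes p = p
... | no ¬p = contradiction (+-mono-≤ (≮⇒≥ ¬p) (≮⇒≥ ¬p)) (<⇒≱ lt)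

module _ {n : ℕ} where

  -- A dense pair of consecutive layers with union `A₁` and upper layer `L`. `tree` leads from each
  -- vertex of `L` to the root outside `A₁`, by at most `Λ` vertices; its first alternative covers
  -- the case that `L` is the root itself.
  record Layer (R : BRel {n}) (A : Fin n → Bool) (ε Λ : ℕ) : Set where
    field
      L A₁ : Fin n → Bool
      H : BRel {n}
      H-sym : ∀ u w → H u w ≡ H w u
      H⇒R : ∀ {u w} → H u w ≡ true → R u w ≡ true
      H-touch : ∀ {u w} → H u w ≡ true → L u ≡ true ⊎ L w ≡ true
      A₁⊂A : ∀ v → A₁ v ≡ true → A v ≡ true
      dense : ε * card A₁ < pairs H A₁
      tree : (∀ x y → L x ≡ true → L y ≡ true → x ≡ y) ⊎
        (∃ λ r → ∀ x → L x ≡ true → ∃ λ p → length p ≤ Λ × r ∈ p × (∃ λ y → y ∈ p × R x y ≡ true) ×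
          (∀ z → z ∈ p → (A z ≡ true × ¬ A₁ z ≡ true) × Wk (Tr R) (_∈ p) z r))

  module BFS (R : BRel {n}) (sym : ∀ u w → R u w ≡ R w u) (A : Fin n → Bool) (r : Fin n) (Ar : A r ≡ true) where

    near : (Fin n → Bool) → Fin n → Bool
    near B u = ⌊ any? (λ w → tr? (B w ∧ R w u)) ⌋

    ball : ℕ → Fin n → Bool
    ball zero u = ⌊ u ≟ r ⌋
    ball (suc i) u = ball i u ∨ (A u ∧ near (ball i) u)

    ball-step : ∀ i {w u} → ball i w ≡ true → R w u ≡ true → A u ≡ true → ball (suc i) u ≡ true
    ball-step i {w} {u} bw rw au = ∨-trueʳ {ball i u} (∧-intro au
      (does-true (any? (λ w → tr? (ball i w ∧ R w u))) (w , ∧-intro bw rw)))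

    ball-inv : ∀ i {u} → ball (suc i) u ≡ true → ball i u ≡ true ⊎ (A u ≡ true × ∃ λ w → ball i w ≡ true × R w u ≡ true)
    ball-inv i {u} e with ∨-true {ball i u} e
    ... | inj₁ p = inj₁ p
    ... | inj₂ q with ∧-true q
    ... | au , nr with true-does (any? (λ w → tr? (ball i w ∧ R w u))) nr
    ... | w , h = inj₂ (au , w , ∧-true h)

    ball-A : ∀ i {u} → ball i u ≡ true → A u ≡ true
    ball-A zero {u} e with true-does (u ≟ r) e
    ... | refl = Ar
    ball-A (suc i) e with ball-inv i e
    ... | inj₁ p = ball-A i p
    ... | inj₂ (au , _) = au

    ball-walk : ∀ i {u} → ball i u ≡ true → ∃ λ p → length p ≤ suc i × r ∈ p × u ∈ p ×
      (∀ z → z ∈ p → ball i z ≡ true × Wk (Tr R) (_∈ p) z r)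
    ball-walk zero {u} e with true-does (u ≟ r) e
    ... | refl = u ∷ [] , ≤-refl , here refl , here refl , λ { _ (here refl) → e , stop (here refl) }
    ball-walk (suc i) {u} e with ball-inv i e
    ... | inj₁ b with ball-walk i b
    ... | p , le , r∈ , u∈ , h = p , m≤n⇒m≤1+n le , r∈ , u∈ , λ z m → ∨-trueˡ (proj₁ (h z m)) , proj₂ (h z m)
    ball-walk (suc i) {u} e | inj₂ (au , w , bw , rw) with ball-walk i bw
    ... | p , le , r∈ , w∈ , h = u ∷ p , s≤s le , there r∈ , here refl ,
      λ { _ (here refl) → e , go (here refl) (trans (sym u w) rw) (wk-mono (λ _ → there) (proj₂ (h w w∈)))
        ; z (there m) → ∨-trueˡ (proj₁ (h z m)) , wk-mono (λ _ → there) (proj₂ (h z m)) }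

    lay : ℕ → Fin n → Bool
    lay zero = ball zero
    lay (suc i) u = ball (suc i) u ∧ not (ball i u)

    lay-ball : ∀ i {u} → lay i u ≡ true → ball i u ≡ true
    lay-ball zero e = e
    lay-ball (suc i) e = proj₁ (∧-true e)

    lay-suc : ∀ i {u} → ball (suc i) u ≡ true → ball i u ≡ false → lay (suc i) u ≡ true
    lay-suc i p q = ∧-intro p (cong not q)

    lay-not : ∀ i {u} → lay (suc i) u ≡ true → ¬ ball i u ≡ true
    lay-not i {u} e b with proj₂ (∧-true {ball (suc i) u} e)
    ... | q rewrite b with () ← q

    -- Edges inside the lower layer are left to the next index. Thus every edge has an end in layer
    -- `i`, and such ends are attached to the tree above unless `i` is zero.
    H : ℕ → BRel {n}
    H i u w = R u w ∧ ((lay i u ∧ (lay i w ∨ lay (suc i) w)) ∨ (lay (suc i) u ∧ lay i w))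

    H-up : ∀ i {u w} → R u w ≡ true → lay i u ≡ true → (lay i w ≡ true ⊎ lay (suc i) w ≡ true) → H i u w ≡ true
    H-up i {u} {w} r p (inj₁ q) = ∧-intro r (∨-trueˡ (∧-intro p (∨-trueˡ q)))
    H-up i {u} {w} r p (inj₂ q) = ∧-intro r (∨-trueˡ (∧-intro p (∨-trueʳ {lay i w} q)))

    H-down : ∀ i {u w} → R u w ≡ true → lay (suc i) u ≡ true → lay i w ≡ true → H i u w ≡ true
    H-down i {u} {w} r p q = ∧-intro r (∨-trueʳ {lay i u ∧ (lay i w ∨ lay (suc i) w)} (∧-intro p q))

    H-inv : ∀ i {u w} → H i u w ≡ true → R u w ≡ true ×
      ((lay i u ≡ true × (lay i w ≡ true ⊎ lay (suc i) w ≡ true)) ⊎ (lay (suc i) u ≡ true × lay i w ≡ true))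
    H-inv i {u} {w} e with ∧-true {R u w} e
    ... | r , q with ∨-true {lay i u ∧ (lay i w ∨ lay (suc i) w)} q
    ... | inj₁ q' = r , inj₁ (proj₁ (∧-true {lay i u} q') , ∨-true {lay i w} (proj₂ (∧-true {lay i u} q')))
    ... | inj₂ q' = r , inj₂ (∧-true {lay (suc i) u} q')

    H-flip : ∀ i {u w} → H i u w ≡ true → H i w u ≡ true
    H-flip i {u} {w} e with H-inv i e
    ... | r , inj₁ (p , inj₁ q) = H-up i (trans (sym w u) r) q (inj₁ p)
    ... | r , inj₁ (p , inj₂ q) = H-down i (trans (sym w u) r) q p
    ... | r , inj₂ (p , q) = H-up i (trans (sym w u) r) q (inj₂ p)

    H-symm : ∀ i u w → H i u w ≡ H i w u
    H-symm i u w with H i u w in e | H i w u in e'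
    ... | true | true = refl
    ... | false | false = refl
    ... | true | false = ⊥-elim (true≢false (H-flip i e) e')
    ... | false | true = ⊥-elim (true≢false (H-flip i e') e)

    l e : ℕ → ℕ
    l i = card (lay i)
    e i = ∑ λ u → ∑ λ w → b2n (H i u w)

    module _ (ε : ℕ) (min : ∀ v → A v ≡ true → 5 * ε ≤ deg R A v) where

      private
        δ = 5 * ε

      edge-next : ∀ i {u w} → lay (suc i) u ≡ true → A w ≡ true → R u w ≡ true → H i u w ≡ true ⊎ H (suc i) u w ≡ true
      edge-next i {u} {w} lu aw r with tr? (ball (suc i) w)
      ... | no e₁ = inj₂ (H-up (suc i) r lu (inj₂ (lay-suc (suc i) (ball-step (suc i) (lay-ball (suc i) lu) r aw) (¬true e₁))))
      ... | yes e₁ with tr? (ball i w)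
      ... | no e₀ = inj₂ (H-up (suc i) r lu (inj₁ (lay-suc i e₁ (¬true e₀))))
      edge-next zero {u} {w} lu aw r | yes e₁ | yes e₀ = inj₁ (H-down zero r lu e₀)
      edge-next (suc i) {u} {w} lu aw r | yes e₁ | yes e₀ with tr? (ball i w)
      ... | no e₋ = inj₁ (H-down (suc i) r lu (lay-suc i e₀ (¬true e₋)))
      ... | yes e₋ = contradiction (ball-step i e₋ (trans (sym w u) r) (ball-A (suc (suc i)) (lay-ball (suc (suc i)) lu))) (lay-not (suc i) lu)

      -- All neighbours of a vertex in layer `suc i` lie in layers `i` to `suc (suc i)`, so its
      -- edges are counted by two consecutive `H`.
      count-next : ∀ i → δ * l (suc i) ≤ e i + e (suc i)
      count-next i = ≤-trans (≤-reflexive (≡-sym (∑-* δ (λ u → b2n (lay (suc i) u)))))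
        (≤-trans (∑-mono row) (≤-reflexive (∑-+ (λ u → ∑ λ w → b2n (H i u w)) (λ u → ∑ λ w → b2n (H (suc i) u w)))))
        where
        row : ∀ u → δ * b2n (lay (suc i) u) ≤ ∑ (λ w → b2n (H i u w)) + ∑ (λ w → b2n (H (suc i) u w))
        row u with tr? (lay (suc i) u)
        ... | no eq = ≤-trans (≤-reflexive (trans (cong (δ *_) (b2n-false eq)) (*-zeroʳ δ))) z≤n
        ... | yes eq = ≤-trans (≤-reflexive (trans (cong (δ *_) (b2n-true eq)) (*-identityʳ δ))) (≤-trans (min u (ball-A (suc i) (lay-ball (suc i) eq)))
              (≤-trans (∑-mono cell) (≤-reflexive (∑-+ (λ w → b2n (H i u w)) (λ w → b2n (H (suc i) u w))))))
          where
          cell : ∀ w → b2n (A w ∧ R u w) ≤ b2n (H i u w) + b2n (H (suc i) u w)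
          cell w with tr? (A w ∧ R u w)
          ... | no q = ≤-trans (≤-reflexive (b2n-false q)) z≤n
          ... | yes q with edge-next i eq (proj₁ (∧-true q)) (proj₂ (∧-true {A w} q))
          ... | inj₁ h = ≤-trans (≤-reflexive (trans (b2n-true q) (≡-sym (b2n-true h)))) (m≤m+n _ _)
          ... | inj₂ h = ≤-trans (≤-reflexive (trans (b2n-true q) (≡-sym (b2n-true h)))) (m≤n+m _ (b2n (H i u w)))

      count-first : δ * l 0 ≤ e 0
      count-first = ≤-trans (≤-reflexive (≡-sym (∑-* δ (λ u → b2n (lay 0 u))))) (∑-mono row)
        where
        row : ∀ u → δ * b2n (lay 0 u) ≤ ∑ (λ w → b2n (H 0 u w))
        row u with tr? (lay 0 u)
        ... | no eq = ≤-trans (≤-reflexive (trans (cong (δ *_) (b2n-false eq)) (*-zeroʳ δ))) z≤n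
        ... | yes eq = ≤-trans (≤-reflexive (trans (cong (δ *_) (b2n-true eq)) (*-identityʳ δ))) (≤-trans (min u (ball-A 0 eq)) (∑-mono cell))
          where
          cell : ∀ w → b2n (A w ∧ R u w) ≤ b2n (H 0 u w)
          cell w = b2n-mono λ q → H-up 0 (proj₂ (∧-true {A w} q)) eq (side (proj₁ (∧-true {A w} q)) (proj₂ (∧-true {A w} q)))
            where
            side : A w ≡ true → R u w ≡ true → lay 0 w ≡ true ⊎ lay 1 w ≡ true
            side aw rw with tr? (ball 0 w)
            ... | yes e₀ = inj₁ e₀
            ... | no e₀ = inj₂ (lay-suc 0 (ball-step 0 eq rw aw) (¬true e₀))

    module _ (ε' : ℕ) (min : ∀ v → A v ≡ true → 5 * suc ε' ≤ deg R A v) where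

      private
        ε = suc ε'

      -- The factor 5 in the minimum degree is made for this: if x, y, z are the sizes of
      -- consecutive layers, sparseness gives 5y ≤ (x + y) + (y + z), and x ≤ y by induction, so 2y
      -- ≤ z.
      Sparse : ℕ → Set
      Sparse i = e i ≤ ε * (l i + l (suc i))

      cancel : ∀ {x y} → 5 * ε * x ≤ ε * y → 5 * x ≤ y
      cancel {x} le = *-cancelˡ-≤ (suc ε') (≤-trans (≤-reflexive
        (solve 2 (λ e x → e :* (num 5 :* x) := num 5 :* e :* x) refl ε x)) le)

      -- If no pair of consecutive layers is dense, the layers grow exponentially.
      doubles : ∀ i → (∀ j → j ≤ i → Sparse j) → l i + l i ≤ l (suc i)
      doubles zero sp = ≤-trans (m≤n+m (x + x) (x + x)) (+-cancelˡ-≤ x _ _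
        (≤-trans (≤-reflexive (solve 1 (λ x → x :+ (x :+ x :+ (x :+ x)) := num 5 :* x) refl x))
          (cancel (≤-trans (count-first ε min) (sp 0 z≤n)))))
        where
        x = l 0
      doubles (suc i) sp = +-cancelˡ-≤ (x + x + x) _ _ (≤-trans
          (≤-reflexive (solve 1 (λ x → x :+ x :+ x :+ (x :+ x) := num 5 :* x) refl x))
          (≤-trans (cancel (≤-trans (count-next ε min i) (≤-trans (+-mono-≤ (sp i (n≤1+n i)) (sp (suc i) ≤-refl))
              (≤-reflexive (≡-sym (*-distribˡ-+ ε (l i + x) (x + y)))))))
            (≤-trans (+-monoˡ-≤ (x + y) (+-monoˡ-≤ x le)) (≤-reflexive (≡-sym (+-assoc (x + x) x y))))))
        where
        x = l (suc i)
        y = l (suc (suc i))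
        le : l i ≤ x
        le = ≤-trans (m≤m+n (l i) (l i)) (doubles i (λ j j≤ → sp j (m≤n⇒m≤1+n j≤)))

      l₀ : 1 ≤ l 0
      l₀ = ≤-trans (≤-reflexive (≡-sym (b2n-true (does-true (r ≟ r) refl)))) (∑-pick (λ u → b2n (lay 0 u)) r)

      powers : ∀ i → (∀ j → j < i → Sparse j) → 2 ^ i ≤ l i
      powers zero _ = l₀
      powers (suc i) sp = ≤-trans (≤-reflexive (cong (2 ^ i +_) (+-identityʳ (2 ^ i))))
        (≤-trans (+-mono-≤ p p) (doubles i (λ j j≤ → sp j (s≤s j≤))))
        where
        p = powers i (λ j j< → sp j (m<n⇒m<1+n j<))

      dense-index : ∀ Λ → card A < 2 ^ Λ → ∃ λ i → i < Λ × ε * (l i + l (suc i)) < e i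
      dense-index Λ small with anyUpTo? (λ i → ε * (l i + l (suc i)) <? e i) Λ
      ... | yes h = h
      ... | no ∄ = contradiction (≤-trans (powers Λ (λ j j< → ≮⇒≥ (λ p → ∄ (j , j< , p))))
              (card-mono (lay Λ) A (λ v q → ball-A Λ (lay-ball Λ q)))) (<⇒≱ small)

      layer : ∀ Λ → card A < 2 ^ Λ → Layer R A ε Λ
      layer Λ small with dense-index Λ small
      ... | i , i<Λ , dn = record
        { L = lay i ; A₁ = A₁ ; H = H i ; H-sym = H-symm i
        ; H⇒R = λ h → proj₁ (H-inv i h)
        ; H-touch = touch
        ; A₁⊂A = λ v q → [ (λ p → ball-A i (lay-ball i p)) , (λ p → ball-A (suc i) (lay-ball (suc i) p)) ]′ (∨-true {lay i v} q)
        ; dense = ≤-<-trans (*-monoʳ-≤ ε cardA₁) (<-≤-trans dn (∑-mono λ u → ∑-mono λ w → b2n-mono (both u w)))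
        ; tree = top i i<Λ }
        where
        A₁ : Fin n → Bool
        A₁ v = lay i v ∨ lay (suc i) v
        touch : ∀ {u w} → H i u w ≡ true → lay i u ≡ true ⊎ lay i w ≡ true
        touch h with H-inv i h
        ... | _ , inj₁ (p , _) = inj₁ p
        ... | _ , inj₂ (_ , q) = inj₂ q
        both : ∀ u w → H i u w ≡ true → A₁ u ∧ (A₁ w ∧ H i u w) ≡ true
        both u w h with H-inv i h
        ... | _ , inj₁ (p , inj₁ q) = ∧-intro (∨-trueˡ p) (∧-intro (∨-trueˡ q) h)
        ... | _ , inj₁ (p , inj₂ q) = ∧-intro (∨-trueˡ p) (∧-intro (∨-trueʳ {lay i w} q) h)
        ... | _ , inj₂ (p , q) = ∧-intro (∨-trueʳ {lay i u} p) (∧-intro (∨-trueˡ q) h)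
        cardA₁ : card A₁ ≤ l i + l (suc i)
        cardA₁ = ≤-trans (∑-mono pt) (≤-reflexive (∑-+ (λ v → b2n (lay i v)) (λ v → b2n (lay (suc i) v))))
          where
          pt : ∀ v → b2n (A₁ v) ≤ b2n (lay i v) + b2n (lay (suc i) v)
          pt v with lay i v
          ... | true = s≤s z≤n
          ... | false = ≤-refl
        top : ∀ i → i < Λ → (∀ x y → lay i x ≡ true → lay i y ≡ true → x ≡ y) ⊎
          (∃ λ r → ∀ x → lay i x ≡ true → ∃ λ p → length p ≤ Λ × r ∈ p × (∃ λ y → y ∈ p × R x y ≡ true) ×
            (∀ z → z ∈ p → (A z ≡ true × ¬ (lay i z ∨ lay (suc i) z) ≡ true) × Wk (Tr R) (_∈ p) z r))
        top zero _ = inj₁ λ x y p q → trans (true-does (x ≟ r) p) (≡-sym (true-does (y ≟ r) q))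
        top (suc j) lt = inj₂ (r , λ x lx → up x lx (ball-inv j (lay-ball (suc j) lx)))
          where
          up : ∀ x → lay (suc j) x ≡ true → ball j x ≡ true ⊎ (A x ≡ true × ∃ λ w → ball j w ≡ true × R w x ≡ true) → _
          up x lx (inj₁ b) = ⊥-elim (lay-not j lx b)
          up x lx (inj₂ (_ , w , bw , rw)) with ball-walk j bw
          ... | p , le , r∈ , w∈ , h = p , ≤-trans le (<⇒≤ lt) , r∈ , (w , w∈ , trans (sym x w) rw) ,
            λ z m → (ball-A j (proj₁ (h z m)) , λ q → [ (λ a → lay-not j a (proj₁ (h z m))) ,
              (λ a → lay-not (suc j) a (∨-trueˡ (proj₁ (h z m)))) ]′ (∨-true {lay (suc j) z} q)) , proj₂ (h z m)

  -- The growing end has more than `m` neighbours while the path has at most `m` vertices, so one of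
  -- them is new. The other end stays fixed.
  extend-path : ∀ {R : BRel {n}} {A : Fin n → Bool} {m} → (∀ v → A v ≡ true → m < deg R A v) → (∀ u w → R u w ≡ R w u) →
    ∀ v → A v ≡ true → ∀ k → k ≤ m → ∃ λ u → ∃ λ L → Path (Tr R) u L v × Unique L × length L ≡ suc k × (∀ x → x ∈ L → A x ≡ true)
  extend-path min sym v av zero _ = v , v ∷ [] , one , [] ∷ [] , refl , λ { _ (here refl) → av }
  extend-path {R} {A} min sym v av (suc k) k≤ with extend-path min sym v av k (<⇒≤ k≤)
  ... | u , L , p , uL , len , inA with any? (λ x → tr? (A x ∧ R u x) ×-dec ¬? (x ∈? L))
  ... | yes (x , q , x∉) = x , x ∷ L , trans (sym x u) (proj₂ (∧-true {A x} q)) ∷ p , All-∉ x∉ ∷ uL , cong suc len ,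
        λ { _ (here refl) → proj₁ (∧-true q) ; y (there m) → inA y m }
  ... | no ∄ = contradiction (card-cover (λ x → A x ∧ R u x) L cov) (<⇒≱ (≤-<-trans (≤-reflexive len) (≤-<-trans k≤ (min u (inA u (path-head p))))))
    where
    cov : ∀ x → A x ∧ R u x ≡ true → x ∈ L
    cov x q with x ∈? L
    ... | yes m = m
    ... | no ∉ = contradiction (x , q , ∉) ∄

  -- No two consecutive vertices of the path lie outside `Q`.
  count-touch : ∀ {R : Rel {n}} {Q : Fin n → Set} (Q? : ∀ x → Dec (Q x)) → (∀ {u w} → R u w → Q u ⊎ Q w) →
    ∀ {u L v} → Path R u L v → length L ≤ suc (length (filter Q? L) + length (filter Q? L))
  count-touch Q? touch one = s≤s z≤n
  count-touch Q? touch {u} (r ∷ p) with Q? u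
  count-touch Q? touch {u} {_ ∷ L} (r ∷ p) | yes _ = s≤s (≤-trans (count-touch Q? touch p) (s≤s (+-monoʳ-≤ c (n≤1+n c))))
    where c = length (filter Q? L)
  count-touch Q? touch {u} (r ∷ p) | no ¬q with touch r
  ... | inj₁ q = contradiction q ¬q
  count-touch Q? touch {u} (_∷_ {v = v} r one) | no ¬q | inj₂ q with Q? v
  ... | yes _ = s≤s (s≤s z≤n)
  ... | no ¬q' = contradiction q ¬q'
  count-touch Q? touch {u} (_∷_ {v = v} r (_∷_ {L = L} r' p)) | no ¬q | inj₂ q with Q? v
  ... | yes _ = s≤s (s≤s (≤-trans (count-touch Q? touch p) (≤-reflexive (≡-sym (+-suc c c)))))
    where c = length (filter Q? L)
  ... | no ¬q' = contradiction q ¬q'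

-- Read from `m₃` upwards: 2t+1 path vertices are wanted for t marks. Each peeling halves the
-- density, so `m₃` is doubled to `ε₂`; a breadth-first search needs degree 5ε for a pair of layers
-- of density ε, so 5 times `ε₂` is doubled to `ε₁`, and once more for `denseD`.
module DenseConst (t : ℕ) where
  m₃ ε₂ ε₁ : ℕ
  m₃ = suc (t + t)
  ε₂ = m₃ + m₃
  ε₁ = 5 * ε₂ + 5 * ε₂

abstract
  denseD : ℕ → ℕ
  denseD t = 5 * DenseConst.ε₁ t + 5 * DenseConst.ε₁ t

  denseD-def : ∀ t → denseD t ≡ 5 * DenseConst.ε₁ t + 5 * DenseConst.ε₁ t
  denseD-def t = refl

  1≤denseD : ∀ t → 1 ≤ denseD t
  1≤denseD t = s≤s z≤n

  denseSize : ℕ → ℕ → ℕ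
  denseSize t Λ = (suc (DenseConst.m₃ t) + (Λ + Λ)) + t * Λ

  denseSize-def : ∀ t Λ → denseSize t Λ ≡ (suc (DenseConst.m₃ t) + (Λ + Λ)) + t * Λ
  denseSize-def t Λ = refl

module _ {n : ℕ} where

  -- Breadth-first search twice, each time descending to a dense pair of consecutive layers: a path in the
  -- second pair is closed to a cycle through the second tree, and the first tree provides the hub.
  dense-wheel : (I : Graph n) (t : ℕ) → 1 ≤ t → (A : Fin n → Bool) (Λ : ℕ) → card A < 2 ^ Λ →
    denseD (suc t) * card A < pairs (adj I) A →
    Σ (Model I (wheelAdj (suc t))) λ M → ∃ λ T → length T ≤ denseSize (suc t) Λ ×
      (∀ v → v ∈ T → A v ≡ true) × (∀ v → InModel M v → v ∈ T)
  dense-wheel I t′ 1≤t′ A Λ small dn =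
    case peel R (Graph.sym I) n A (5 * ε₁ + 5 * ε₁) (card≤n A) (subst (λ z → z * card A < pairs R A) (denseD-def t) dn) of λ { (A₁ , A₁⊂ , (r₁ , r₁∈) , min₁) →
    stage₁ A₁ A₁⊂ r₁ r₁∈ (BFS.layer R (Graph.sym I) A₁ r₁ r₁∈ _ (λ v e → <⇒≤ (half-< (min₁ v e))) Λ (≤-<-trans (card-mono A₁ A A₁⊂) small)) }
    where
    t = suc t′
    open DenseConst t using (m₃; ε₂; ε₁)
    R : BRel {n}
    R = adj I
    card≤n : ∀ (B : Fin n → Bool) → card B ≤ n
    card≤n B = ≤-trans (card-cover B (allFin n) (λ v _ → ∈-allFin v)) (≤-reflexive (length-allFin n))
    Goal : Set
    Goal = Σ (Model I (wheelAdj (suc t′))) λ M → ∃ λ T → length T ≤ denseSize t Λ ×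
      (∀ v → v ∈ T → A v ≡ true) × (∀ v → InModel M v → v ∈ T)

    stage₁ : ∀ A₁ → (∀ v → A₁ v ≡ true → A v ≡ true) → ∀ r₁ → A₁ r₁ ≡ true → Layer R A₁ ε₁ Λ → Goal
    stage₁ A₁ A₁⊂ r₁ r₁∈ lay₁ = case peel L₁.H L₁.H-sym n L₁.A₁ ε₁ (card≤n L₁.A₁) L₁.dense of λ { (A₂ , A₂⊂ , (r₂ , r₂∈) , min₂) →
        stage₂ A₂ A₂⊂ (BFS.layer L₁.H L₁.H-sym A₂ r₂ r₂∈ _ (λ v e → <⇒≤ (half-< (min₂ v e))) Λ
          (≤-<-trans (card-mono A₂ A (λ v e → A₁⊂ v (L₁.A₁⊂A v (A₂⊂ v e)))) small)) }
      where
      module L₁ = Layer lay₁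

      stage₂ : ∀ A₂ → (∀ v → A₂ v ≡ true → L₁.A₁ v ≡ true) → Layer L₁.H A₂ ε₂ Λ → Goal
      stage₂ A₂ A₂⊂ lay₂ = case peel L₂.H L₂.H-sym n L₂.A₁ ε₂ (card≤n L₂.A₁) L₂.dense of λ { (A₃ , A₃⊂ , (r₃ , r₃∈) , min₃) →
          case start A₃ r₃ r₃∈ (half-< (min₃ r₃ r₃∈)) of λ { (x′ , x′∈ , x′∈L) →
          case extend-path (λ v e → half-< {m₃} (min₃ v e)) L₂.H-sym x′ x′∈ m₃ ≤-refl of λ { (u , P , p , uP , len , inA) →
          case trim p uP len of λ { (x , P' , p' , uP' , len≤ , len≥ , sub , x∈L) →
          stage₃ A₃ A₃⊂ p' uP' len≤ len≥ (λ v m → inA v (sub v m)) x∈L x′∈L } } } }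
        where
        module L₂ = Layer lay₂

        start : ∀ A₃ r → A₃ r ≡ true → m₃ < deg L₂.H A₃ r → ∃ λ x → A₃ x ≡ true × L₂.L x ≡ true
        start A₃ r r∈ lt with any? (λ w → tr? (A₃ w ∧ L₂.H r w))
        ... | yes (w , e) with L₂.H-touch (proj₂ (∧-true {A₃ w} e))
        ... | inj₁ q = r , r∈ , q
        ... | inj₂ q = w , proj₁ (∧-true e) , q
        start A₃ r r∈ lt | no ∄ = contradiction
          (≤-trans (card-cover (λ w → A₃ w ∧ L₂.H r w) [] (λ w e → ⊥-elim (∄ (w , e)))) z≤n) (<⇒≱ lt)

        -- Both ends of the path must lie in the upper layer of the second search in order to be
        -- attached to its tree. Since the first edge touches that layer, dropping at most one
        -- vertex suffices.
        trim : ∀ {u P v} → Path (Tr L₂.H) u P v → Unique P → length P ≡ suc m₃ →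
          ∃ λ x → ∃ λ P' → Path (Tr L₂.H) x P' v × Unique P' × length P' ≤ suc m₃ × m₃ ≤ length P' ×
            (∀ z → z ∈ P' → z ∈ P) × L₂.L x ≡ true
        trim one _ ()
        trim {u} {_ ∷ P} (r ∷ p) (u∉ ∷ uP) len with L₂.H-touch r
        ... | inj₁ q = u , u ∷ P , r ∷ p , u∉ ∷ uP , ≤-reflexive len , ≤-trans (n≤1+n m₃) (≤-reflexive (≡-sym len)) , (λ _ → id) , q
        ... | inj₂ q = _ , P , p , uP , ≤-trans (n≤1+n _) (≤-reflexive len) , ≤-reflexive (suc-injective (≡-sym len)) , (λ _ → there) , q

        stage₃ : ∀ A₃ → (∀ v → A₃ v ≡ true → L₂.A₁ v ≡ true) → ∀ {x P x'} → Path (Tr L₂.H) x P x' → Unique P →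
          length P ≤ suc m₃ → m₃ ≤ length P → (∀ v → v ∈ P → A₃ v ≡ true) → L₂.L x ≡ true → L₂.L x' ≡ true → Goal
        stage₃ A₃ A₃⊂ {x} {P} {x'} p uP len≤ len≥ inA xL x'L = two L₂.tree L₁.tree
          where
          x≢x' : x ≢ x'
          x≢x' = ends p uP len≥
            where
            ends : ∀ {x P x'} → Path (Tr L₂.H) x P x' → Unique P → m₃ ≤ length P → x ≢ x'
            ends one _ (s≤s ())
            ends (_ ∷ p) (x∉ ∷ _) _ refl = ∉-All x∉ (path-last p)
          path₁ : Path (Tr L₁.H) x P x'
          path₁ = path-map L₂.H⇒R p
          inL₁ : ∀ v → v ∈ P → L₁.A₁ v ≡ true
          inL₁ v m = A₂⊂ v (L₂.A₁⊂A v (A₃⊂ v (inA v m)))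
          Q? : ∀ v → Dec (L₁.L v ≡ true)
          Q? v = tr? (L₁.L v)
          -- Every edge of `P` belongs to the first layer graph too and so touches the first upper
          -- layer; of 2t+1 path vertices at least t lie in it.
          enough : t ≤ length (filter Q? P)
          enough = half≤ (≤-pred (≤-trans len≥ (count-touch Q? (L₁.H-touch) path₁)))
            where
            half≤ : ∀ {a b} → a + a ≤ b + b → a ≤ b
            half≤ {a} {b} le with a ≤? b
            ... | yes q = q
            ... | no ¬q = contradiction le (<⇒≱ (+-mono-< (≰⇒> ¬q) (≰⇒> ¬q)))
          cut-marks = shorten (filter Q? P) t (unique-filter Q? uP) enough
          marks = proj₁ cut-marks
          umarks = proj₁ (proj₂ cut-marks)
          lmarks : length marks ≡ t
          lmarks = proj₁ (proj₂ (proj₂ cut-marks))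
          mark : ∀ v → v ∈ marks → v ∈ P × L₁.L v ≡ true
          mark v m = ∈-filter⁻ Q? {xs = P} (proj₂ (proj₂ (proj₂ cut-marks)) v m)
          two-marks : ∃ λ a → ∃ λ b → a ∈ marks × b ∈ marks × a ≢ b
          two-marks = pickTwo marks umarks (≤-trans (s≤s 1≤t′) (≤-reflexive (≡-sym lmarks)))
            where
            pickTwo : ∀ (L : List (Fin n)) → Unique L → 2 ≤ length L → ∃ λ a → ∃ λ b → a ∈ L × b ∈ L × a ≢ b
            pickTwo (a ∷ b ∷ L) ((a≢b ∷ _) ∷ _) _ = a , b , here refl , there (here refl) , a≢b
            pickTwo (a ∷ []) _ (s≤s ())
          Tree : (R : BRel {n}) (B B₁ L : Fin n → Bool) → Fin n → Set
          Tree R B B₁ L r = ∀ x → L x ≡ true → ∃ λ p → length p ≤ Λ × r ∈ p × (∃ λ y → y ∈ p × R x y ≡ true) ×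
            (∀ z → z ∈ p → (B z ≡ true × ¬ B₁ z ≡ true) × Wk (Tr R) (_∈ p) z r)
          finish : ∀ {r₂ r₁} → Tree L₁.H A₂ L₂.A₁ L₂.L r₂ → Tree R A₁ L₁.A₁ L₁.L r₁ → Goal
          finish {r₂} {r₁} tr₂ tr₁ with tr₂ x xL | tr₂ x' x'L
          ... | p₁ , l₁ , r∈₁ , (y , y∈ , xy) , h₁ | p₂ , l₂ , r∈₂ , (y' , y'∈ , xy') , h₂
            with simple-path (wk-mono (λ _ → ∈-++⁺ʳ p₁) (proj₂ (h₂ y' y'∈)) ⊙
                   wk-rev (λ {a} {b} q → trans (L₁.H-sym b a) q) (wk-mono (λ _ → ∈-++⁺ˡ) (proj₂ (h₁ y y∈))))
          ... | J , pJ , uJ , satJ = proj₁ built , T , lenT , T⊂A , λ v m → [ ∈-++⁺ˡ , ∈-++⁺ʳ C ]′ (proj₂ built v m)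
            where
            J-in : ∀ v → v ∈ J → A₂ v ≡ true × ¬ L₂.A₁ v ≡ true
            J-in v m with ∈-++⁻ p₁ (satJ v m)
            ... | inj₁ q = proj₁ (h₁ v q)
            ... | inj₂ q = proj₁ (h₂ v q)
            C = P ++ J
            C₁ : ∀ v → v ∈ C → L₁.A₁ v ≡ true
            C₁ v m with ∈-++⁻ P m
            ... | inj₁ q = inL₁ v q
            ... | inj₂ q = A₂⊂ v (proj₁ (J-in v q))
            uC : Unique C
            uC = unique-++ uP uJ (λ v m q → proj₂ (J-in v q) (A₃⊂ v (inA v m)))
            pC : Path (Adj I) x C y
            pC = path-map L₁.H⇒R (path-++ path₁ xy' pJ)
            spine : Fin n → List (Fin n)
            spine v with tr? (L₁.L v)
            ... | yes q = proj₁ (tr₁ v q)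
            ... | no _ = []
            spine-ok : ∀ v → L₁.L v ≡ true → length (spine v) ≤ Λ × r₁ ∈ spine v × (∃ λ y → y ∈ spine v × R v y ≡ true) ×
              (∀ z → z ∈ spine v → (A₁ z ≡ true × ¬ L₁.A₁ z ≡ true) × Wk (Tr R) (_∈ spine v) z r₁)
            spine-ok v q with tr? (L₁.L v)
            ... | yes q' = proj₂ (tr₁ v q')
            ... | no ¬q = contradiction q ¬q
            hub = concatMap spine marks
            into : ∀ {v} → v ∈ marks → ∀ z → z ∈ spine v → z ∈ hub
            into m z q = ∈-concatMap⁺ spine m q
            hub-inv : ∀ z → z ∈ hub → ∃ λ v → v ∈ marks × z ∈ spine v
            hub-inv z = ∈-concatMap⁻ spine {marks}
            hub-ok : ∀ z → z ∈ hub → (A₁ z ≡ true × ¬ L₁.A₁ z ≡ true) × Wk (Tr R) (_∈ hub) z r₁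
            hub-ok z m with hub-inv z m
            ... | v , v∈ , z∈ with proj₂ (proj₂ (proj₂ (spine-ok v (proj₂ (mark v v∈))))) z z∈
            ... | ok , w = ok , wk-mono (into v∈) w
            built = wheel I t′ pC uC (L₁.H⇒R (trans (L₁.H-sym y x) xy)) hub
              (conn-root (adj-sym I) r₁ (λ z m → proj₂ (hub-ok z m)))
              (λ v m q → proj₂ (proj₁ (hub-ok v m)) (C₁ v q)) marks umarks lmarks
              λ v m → ∈-++⁺ˡ (proj₁ (mark v m)) , (case proj₁ (proj₂ (proj₂ (spine-ok v (proj₂ (mark v m))))) of λ
                { (h , h∈ , e) → h , into m h h∈ , adj-sym I e })
            T = C ++ hub
            T⊂A : ∀ v → v ∈ T → A v ≡ true
            T⊂A v m with ∈-++⁻ C m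
            ... | inj₁ q = A₁⊂ v (L₁.A₁⊂A v (C₁ v q))
            ... | inj₂ q = A₁⊂ v (proj₁ (proj₁ (hub-ok v q)))
            lenJ : length J ≤ Λ + Λ
            lenJ = ≤-trans (unique-⊆ uJ satJ) (≤-trans (≤-reflexive (length-++ p₁)) (+-mono-≤ l₁ l₂))
            lenT : length T ≤ denseSize t Λ
            lenT = ≤-trans (≤-trans (≤-reflexive (length-++ C)) (+-mono-≤
              (≤-trans (≤-reflexive (length-++ P)) (+-mono-≤ len≤ lenJ))
              (≤-trans (length-concatMap spine marks (λ v m → proj₁ (spine-ok v (proj₂ (mark v m))))) (≤-reflexive (cong (_* Λ) lmarks))))) (≤-reflexive (≡-sym (denseSize-def t Λ)))
          two : (∀ x y → L₂.L x ≡ true → L₂.L y ≡ true → x ≡ y) ⊎ ∃ (Tree L₁.H A₂ L₂.A₁ L₂.L) →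
                (∀ x y → L₁.L x ≡ true → L₁.L y ≡ true → x ≡ y) ⊎ ∃ (Tree R A₁ L₁.A₁ L₁.L) → Goal
          two (inj₁ same) _ = contradiction (same x x' xL x'L) x≢x'
          two (inj₂ _) (inj₁ same) with two-marks
          ... | a , b , a∈ , b∈ , a≢b = contradiction (same a b (proj₂ (mark a a∈)) (proj₂ (mark b b∈))) a≢b
          two (inj₂ (_ , tr₂)) (inj₂ (_ , tr₁)) = finish tr₂ tr₁

-- Fragmentation of graphs without small wheels

update : ∀ {n} {X : Set} → (Fin n → X) → Fin n → X → Fin n → X
update f a x b = if ⌊ b ≟ a ⌋ then x else f b

update-at : ∀ {n} {X : Set} (f : Fin n → X) a x → update f a x a ≡ x
update-at f a x with a ≟ a
... | yes _ = refl
... | no ¬p = contradiction refl ¬p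

update-other : ∀ {n} {X : Set} (f : Fin n → X) a x {b} → b ≢ a → update f a x b ≡ f b
update-other f a x {b} b≢a with b ≟ a
... | yes p = contradiction p b≢a
... | no _ = refl

module _ {n : ℕ} where

  nd : Fin n → Fin n → ℕ
  nd a b = b2n (not ⌊ a ≟ b ⌋)

  nd-refl : ∀ a → nd a a ≡ 0
  nd-refl a with a ≟ a
  ... | yes _ = refl
  ... | no ¬p = contradiction refl ¬p

  nd-≢ : ∀ {a b} → a ≢ b → nd a b ≡ 1
  nd-≢ {a} {b} h with a ≟ b
  ... | yes p = contradiction p h
  ... | no _ = refl

  low-degree : ∀ (R : BRel {n}) S d → (∃ λ a → S a ≡ true) →
    (∃ λ a → S a ≡ true × deg R S a ≤ d) ⊎ d * card S < pairs R S
  low-degree R S d (a₀ , e₀) with any? (λ a → tr? (S a) ×-dec (deg R S a ≤? d))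
  ... | yes h = inj₁ h
  ... | no ∄ = inj₂ (≤-trans (≤-reflexive (+-comm 1 _)) (≤-trans (+-monoʳ-≤ (d * card S) 1≤card)
        (≤-trans (≤-reflexive (+-comm (d * card S) (card S))) (≤-trans (≤-reflexive (≡-sym (∑-* (suc d) (λ a → b2n (S a))))) (∑-mono row)))))
    where
    1≤card : 1 ≤ card S
    1≤card = ≤-trans (≤-reflexive (≡-sym (b2n-true e₀))) (∑-pick (λ v → b2n (S v)) a₀)
    row : ∀ a → suc d * b2n (S a) ≤ ∑ (λ u → b2n (S a ∧ (S u ∧ R a u)))
    row a with S a in eq
    ... | false = ≤-trans (≤-reflexive (*-zeroʳ (suc d))) z≤n
    ... | true = ≤-trans (≤-reflexive (*-identityʳ (suc d))) (≰⇒> (λ l → ∄ (a , eq , l)))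

-- Star forests of large weight

module StarPacking {n : ℕ} (wt : Fin n → Fin n → ℕ) (wt-sym : ∀ a b → wt a b ≡ wt b a)
  (A : Fin n → Bool) (wt-A : ∀ a b → 0 < wt a b → A a ≡ true) (d : ℕ) where

  q : BRel {n}
  q a b = not ⌊ a ≟ b ⌋ ∧ ⌊ 0 <? wt a b ⌋

  q-true : ∀ {a b} → a ≢ b → 0 < wt a b → q a b ≡ true
  q-true {a} {b} ne pos with a ≟ b
  ... | yes p = contradiction p ne
  ... | no _ = does-true (0 <? wt a b) pos

  true-q : ∀ {a b} → q a b ≡ true → a ≢ b × 0 < wt a b
  true-q {a} {b} e with a ≟ b
  ... | no p = p , true-does (0 <? wt a b) e

  W : (Fin n → Bool) → ℕ
  W S = ∑ λ a → ∑ λ b → b2n (S a ∧ S b) * (nd a b * wt a b)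

  total : ℕ
  total = ∑ λ a → ∑ λ b → nd a b * wt a b

  gain : (Fin n → Fin n) → ℕ
  gain p = ∑ λ a → nd a (p a) * wt a (p a)

  Dense : Set
  Dense = ∃ λ S → (∀ a → S a ≡ true → A a ≡ true) × d * card S < pairs q S

  -- `p` is the parent function, with roots as fixed points, and `col` is a proper 2-colouring of
  -- the forest that will later split it into stars.
  record Forest (S : Fin n → Bool) : Set where
    field
      p : Fin n → Fin n
      col : Fin n → Bool
      ok : ∀ a → p a ≡ a ⊎ (S a ≡ true × S (p a) ≡ true × p a ≢ a × 0 < wt a (p a) × col (p a) ≡ not (col a))
      heavy : W S ≤ (d + d) * gain p

  private
    row : (Fin n → Bool) → Fin n → ℕ
    row S a = ∑ λ b → b2n (S b) * wt a b

    W-without : ∀ S v → W S ≤ W (without S v) + (row (without S v) v + row (without S v) v)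
    W-without S v = ≤-trans (∑-mono λ a → ∑-mono λ b → point a b) (≤-reflexive tot)
      where
      S' = without S v
      F D₁ D₂ : Fin n → Fin n → ℕ
      F a b = b2n (S' a ∧ S' b) * (nd a b * wt a b)
      D₁ a b = b2n ⌊ a ≟ v ⌋ * (b2n (S' b) * wt v b)
      D₂ a b = b2n ⌊ b ≟ v ⌋ * (b2n (S' a) * wt v a)
      point : ∀ a b → b2n (S a ∧ S b) * (nd a b * wt a b) ≤ F a b + (D₁ a b + D₂ a b)
      point a b with S a | S b | a ≟ b
      ... | x | y | yes refl = ≤-trans (≤-reflexive (*-zeroʳ (b2n (x ∧ y)))) z≤n
      ... | false | _ | no _ = z≤n
      ... | true | false | no _ = z≤n
      ... | true | true | no a≢b with a ≟ v | b ≟ v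
      ... | yes refl | yes refl = contradiction refl a≢b
      ... | yes refl | no _ = m≤m+n (wt a b + 0 + 0) _
      ... | no _ | yes refl = ≤-reflexive (cong (λ z → z + 0 + 0) (wt-sym a b))
      ... | no _ | no _ = m≤m+n (wt a b + 0 + 0) _
      r = row S' v
      tot : ∑ (λ a → ∑ λ b → F a b + (D₁ a b + D₂ a b)) ≡ W S' + (r + r)
      tot = trans (∑-cong λ a → trans (∑-+ (F a) _) (cong (∑ (F a) +_) (∑-+ (D₁ a) (D₂ a))))
        (trans (∑-+ (λ a → ∑ (F a)) _) (cong (W S' +_) (trans (∑-+ (λ a → ∑ (D₁ a)) (λ a → ∑ (D₂ a))) (cong₂ _+_ t₁ t₂))))
        where
        t₁ : ∑ (λ a → ∑ (D₁ a)) ≡ r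
        t₁ = trans (∑-cong {n} {λ a → ∑ (D₁ a)} {λ a → b2n ⌊ a ≟ v ⌋ * r} λ a → ∑-* {n} (b2n ⌊ a ≟ v ⌋) (λ b → b2n (S' b) * wt v b)) (∑-delta v r)
        t₂ : ∑ (λ a → ∑ (D₂ a)) ≡ r
        t₂ = ∑-cong {n} {λ a → ∑ (D₂ a)} {λ a → b2n (S' a) * wt v a} λ a → ∑-delta v _

    -- Averaging over the at most d neighbours of v in S.
    heaviest : ∀ S v → S v ≡ true → deg q S v ≤ d → 0 < row (without S v) v →
      ∃ λ b → without S v b ≡ true × 0 < wt v b × row (without S v) v ≤ d * wt v b
    heaviest S v Sv dg pos with any? (λ b → (tr? (without S v b) ×-dec (0 <? wt v b)) ×-dec (r ≤? d * wt v b))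
      where r = row (without S v) v
    ... | yes (b , (e , pos') , le) = b , e , pos' , le
    ... | no ∄ = ⊥-elim (<⇒≱ pos r≤0)
      where
      S' = without S v
      r = row S' v
      N : Fin n → Bool
      N b = S' b ∧ ⌊ 0 <? wt v b ⌋
      k = card N
      k≤d : k ≤ d
      k≤d = ≤-trans (card-mono N (λ b → S b ∧ q v b) sub) dg
        where
        sub : ∀ b → N b ≡ true → S b ∧ q v b ≡ true
        sub b e with ∧-true {S' b} e
        ... | s , w with ∧-true {S b} s
        ... | s' , ne with b ≟ v
        ... | no b≢v = ∧-intro s' (q-true (λ h → b≢v (≡-sym h)) (true-does (0 <? wt v b) w))
      pos? : ∀ b → 0 < wt v b ⊎ ¬ 0 < wt v b
      pos? b = case 0 <? wt v b of λ { (yes w) → inj₁ w ; (no w) → inj₂ w }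
      bound : ∀ b → d * (b2n (S' b) * wt v b) + b2n (N b) ≤ r * b2n (N b)
      bound b with tr? (S' b) | pos? b
      ... | no s | _ = ≤-trans (≤-reflexive (cong₂ _+_ (trans (cong (λ z → d * (z * wt v b)) (b2n-false s)) (*-zeroʳ d)) (b2n-false (s ∘ proj₁ ∘ ∧-true)))) z≤n
      ... | yes s | inj₂ w = ≤-trans (≤-reflexive (cong₂ _+_ (trans (cong (λ z → d * (b2n (S' b) * z)) (n≤0⇒n≡0 (≮⇒≥ w))) (trans (cong (d *_) (*-zeroʳ (b2n (S' b)))) (*-zeroʳ d)))
              (b2n-false (λ e → w (true-does (0 <? wt v b) (proj₂ (∧-true {S' b} e))))))) z≤n
      ... | yes s | inj₁ w = ≤-trans (≤-reflexive (cong₂ _+_ (cong (d *_) (trans (cong (_* wt v b) (b2n-true s)) (+-identityʳ _))) n1))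
              (≤-trans (≤-reflexive (+-comm _ 1)) (≤-trans (≰⇒> (λ l → ∄ (b , (s , w) , l))) (≤-reflexive (≡-sym (trans (cong (r *_) n1) (*-identityʳ r))))))
        where
        n1 : b2n (N b) ≡ 1
        n1 = b2n-true (∧-intro s (does-true (0 <? wt v b) w))
      sum-bound : d * r + k ≤ r * k
      sum-bound = ≤-trans (≤-reflexive (cong (_+ k) (≡-sym (∑-* d (λ b → b2n (S' b) * wt v b)))))
        (≤-trans (≤-reflexive (≡-sym (∑-+ (λ b → d * (b2n (S' b) * wt v b)) (λ b → b2n (N b)))))
        (≤-trans (∑-mono bound) (≤-reflexive (∑-* r (λ b → b2n (N b))))))
      k≤0 : k ≤ 0
      k≤0 = +-cancelˡ-≤ (d * r) _ _ (≤-trans sum-bound (≤-trans (≤-reflexive (*-comm r k)) (≤-trans (*-monoˡ-≤ r k≤d) (≤-reflexive (≡-sym (+-identityʳ _))))))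
      r≤0 : r ≤ 0
      r≤0 = ≤-trans (∑-mono zr) (≤-reflexive (∑-zero {n}))
        where
        zr : ∀ b → b2n (S' b) * wt v b ≤ 0
        zr b with tr? (S' b) | pos? b
        ... | no s | _ = ≤-reflexive (cong (_* wt v b) (b2n-false s))
        ... | yes s | inj₂ w = ≤-trans (*-monoʳ-≤ (b2n (S' b)) (≮⇒≥ w)) (≤-reflexive (*-zeroʳ (b2n (S' b))))
        ... | yes s | inj₁ w = ⊥-elim (<⇒≱ (≤-trans (≤-reflexive (≡-sym (b2n-true (∧-intro s (does-true (0 <? wt v b) w))))) (∑-pick (λ b → b2n (N b)) b)) k≤0)

  -- Remove a vertex `v` with at most `d` neighbours and hang it on its heaviest one. Removing `v`
  -- loses its weight to `S` twice, once for each order of a pair, and that weight is at most `d`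
  -- times the edge gained; hence the factor 2d.
  forest : ∀ m S → card S ≤ m → (∀ a → S a ≡ true → A a ≡ true) → Dense ⊎ Forest S
  forest m S le S⊂A with any? (λ a → tr? (S a))
  ... | no ∄ = inj₂ (record { p = id ; col = λ _ → true ; ok = λ _ → inj₁ refl
        ; heavy = ≤-trans (≤-trans (∑-mono λ a → ∑-mono λ b → ≤-reflexive (cong (_* (nd a b * wt a b)) (b2n-false (λ e → ∄ (a , proj₁ (∧-true e))))))
            (≤-reflexive (trans (∑-cong {n} {λ a → ∑ {n} λ b → 0} {λ _ → 0} λ a → ∑-zero {n}) (∑-zero {n})))) z≤n })
  ... | yes ne with low-degree q S d ne
  ... | inj₂ dn = inj₁ (S , S⊂A , dn)
  forest zero S le S⊂A | yes ne | inj₁ (v , Sv , dg) = contradiction (≤-trans (card-without S v Sv) le) λ ()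
  forest (suc m) S le S⊂A | yes ne | inj₁ (v , Sv , dg)
    with forest m (without S v) (≤-pred (≤-trans (card-without S v Sv) le)) (λ a e → S⊂A a (without-sub S v a e))
  ... | inj₁ dn = inj₁ dn
  ... | inj₂ F with 0 <? row (without S v) v
  ... | no ¬pos = inj₂ (record { p = F.p ; col = F.col
        ; ok = λ a → case F.ok a of λ { (inj₁ e) → inj₁ e ; (inj₂ (s , s' , rest)) → inj₂ (without-sub S v a s , without-sub S v (F.p a) s' , rest) }
        ; heavy = ≤-trans (W-without S v) (≤-trans (+-monoʳ-≤ (W (without S v)) (+-mono-≤ (≮⇒≥ ¬pos) (≮⇒≥ ¬pos))) (≤-trans (≤-reflexive (+-identityʳ _)) F.heavy)) })
    where module F = Forest F
  ... | yes pos with heaviest S v Sv dg pos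
  ... | b , S'b , wb , le' = inj₂ (record { p = p' ; col = col' ; ok = ok' ; heavy = heavy' })
    where
    module F = Forest F
    S' = without S v
    r = row S' v
    not-v : ∀ {a} → S' a ≡ true → a ≢ v
    not-v {a} e with ∧-true {S a} e
    ... | _ , h with a ≟ v
    ... | no ne = ne
    b≢v : b ≢ v
    b≢v = not-v S'b
    p' = update F.p v b
    col' = update F.col v (not (F.col b))
    old-v : F.p v ≡ v
    old-v with F.ok v
    ... | inj₁ e = e
    ... | inj₂ (s , _) = contradiction refl (not-v s)
    not-not : ∀ x → x ≡ not (not x)
    not-not true = refl
    not-not false = refl
    ok' : ∀ a → p' a ≡ a ⊎ (S a ≡ true × S (p' a) ≡ true × p' a ≢ a × 0 < wt a (p' a) × col' (p' a) ≡ not (col' a))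
    ok' a with a ≟ v
    ... | yes refl = inj₂ (Sv , without-sub S v b S'b , b≢v , wb , trans (update-other F.col v _ b≢v) (not-not (F.col b)))
    ... | no a≢v with F.ok a
    ... | inj₁ e = inj₁ e
    ... | inj₂ (s , s' , ne , pos' , c) = inj₂ (without-sub S v a s , without-sub S v _ s' , ne , pos' , trans (update-other F.col v _ (not-v s')) c)
    open ≤-Reasoning
    gain' : gain F.p + wt v b ≤ gain p'
    gain' = ∑-bump v mono at
      where
      mono : ∀ a → nd a (F.p a) * wt a (F.p a) ≤ nd a (p' a) * wt a (p' a)
      mono a with a ≟ v
      ... | yes refl = ≤-trans (≤-reflexive (cong (_* wt a (F.p a)) (trans (cong (nd a) old-v) (nd-refl a)))) z≤n
      ... | no _ = ≤-refl
      at : nd v (F.p v) * wt v (F.p v) + wt v b ≤ nd v (p' v) * wt v (p' v)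
      at = begin
        nd v (F.p v) * wt v (F.p v) + wt v b ≡⟨ cong (λ z → z * wt v (F.p v) + wt v b) (trans (cong (nd v) old-v) (nd-refl v)) ⟩
        wt v b                              ≡⟨ ≡-sym (+-identityʳ _) ⟩
        1 * wt v b                          ≡⟨ cong (_* wt v b) (≡-sym (nd-≢ (λ h → b≢v (≡-sym h)))) ⟩
        nd v b * wt v b                     ≡⟨ cong (λ z → nd v z * wt v z) (≡-sym (update-at F.p v b)) ⟩
        nd v (p' v) * wt v (p' v) ∎
    heavy' : W S ≤ (d + d) * gain p'
    heavy' = begin
      W S                                       ≤⟨ W-without S v ⟩
      W S' + (r + r)                            ≤⟨ +-mono-≤ F.heavy (+-mono-≤ le' le') ⟩
      (d + d) * gain F.p + (d * wt v b + d * wt v b) ≡⟨ cong ((d + d) * gain F.p +_) (≡-sym (*-distribʳ-+ (wt v b) d d)) ⟩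
      (d + d) * gain F.p + (d + d) * wt v b     ≡⟨ ≡-sym (*-distribˡ-+ (d + d) (gain F.p) (wt v b)) ⟩
      (d + d) * (gain F.p + wt v b)             ≤⟨ *-monoʳ-≤ (d + d) gain' ⟩
      (d + d) * gain p' ∎

  -- The factor 4d combines the 2d of `heavy` with the loss of half the gain when one colour class
  -- is kept.
  record Stars : Set where
    field
      f : Fin n → Fin n
      idem : ∀ a → f (f a) ≡ f a
      near : ∀ a → f a ≡ a ⊎ 0 < wt a (f a)
      shrink : ((d + d) + (d + d)) * (∑ λ a → ∑ λ b → nd (f a) (f b) * wt a b) + total ≤ ((d + d) + (d + d)) * total

  private
    -- Vertices of one colour move to their parents, which have the other colour and stay put. So
    -- the map is idempotent and its fibres are stars.
    module Choose (F : Forest A) where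
      open Forest F
      pickp : Bool → Bool → Fin n → Fin n
      pickp true true a = p a
      pickp false false a = p a
      pickp true false a = a
      pickp false true a = a
      same : Bool → Bool → ℕ
      same true true = 1
      same false false = 1
      same _ _ = 0
      g : Bool → ℕ
      g c = ∑ λ a → same c (col a) * (nd a (p a) * wt a (p a))
      split : gain p ≡ g true + g false
      split = trans (∑-cong λ a → pt (col a) (nd a (p a) * wt a (p a))) (∑-+ (λ a → same true (col a) * (nd a (p a) * wt a (p a))) (λ a → same false (col a) * (nd a (p a) * wt a (p a))))
        where
        pt : ∀ c x → x ≡ same true c * x + same false c * x
        pt true x = ≡-sym (trans (+-identityʳ _) (+-identityʳ x))
        pt false x = ≡-sym (+-identityʳ x)
      F₀ : Bool → Fin n → Fin n
      F₀ c a = pickp c (col a) a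
      fixp : ∀ c x a → p a ≡ a → pickp c x a ≡ a
      fixp true true a e = e
      fixp false false a e = e
      fixp true false a e = refl
      fixp false true a e = refl
      pick-other : ∀ c a → pickp c (not c) a ≡ a
      pick-other true a = refl
      pick-other false a = refl
      pick-same : ∀ c a → pickp c c a ≡ p a
      pick-same true a = refl
      pick-same false a = refl
      same-or : ∀ c x → c ≡ x ⊎ x ≡ not c
      same-or true true = inj₁ refl
      same-or false false = inj₁ refl
      same-or true false = inj₂ refl
      same-or false true = inj₂ refl
      at-other : ∀ c {a} → col a ≡ not c → F₀ c a ≡ a
      at-other c {a} e = trans (cong (λ x → pickp c x a) e) (pick-other c a)
      at-same : ∀ c {a} → c ≡ col a → F₀ c a ≡ p a
      at-same c {a} e = trans (cong (λ x → pickp c x a) (≡-sym e)) (pick-same c a)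
      idem₀ : ∀ c a → F₀ c (F₀ c a) ≡ F₀ c a
      idem₀ c a with same-or c (col a) | ok a
      ... | inj₂ e | _ = cong (F₀ c) (at-other c e)
      ... | inj₁ e | inj₁ e' = cong (F₀ c) (fixp c (col a) a e')
      ... | inj₁ e | inj₂ (_ , _ , _ , _ , e') = trans (cong (F₀ c) (at-same c e))
              (trans (at-other c (trans e' (cong not (≡-sym e)))) (≡-sym (at-same c e)))
      near₀ : ∀ c a → F₀ c a ≡ a ⊎ 0 < wt a (F₀ c a)
      near₀ c a with same-or c (col a) | ok a
      ... | inj₂ e | _ = inj₁ (at-other c e)
      ... | inj₁ e | inj₁ e' = inj₁ (fixp c (col a) a e')
      ... | inj₁ e | inj₂ (_ , _ , _ , w , _) = inj₂ (subst (λ z → 0 < wt a z) (≡-sym (at-same c e)) w)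
      same-eq : ∀ c x → same c x ≡ 1 → c ≡ x
      same-eq true true _ = refl
      same-eq false false _ = refl
      merged₀ : ∀ c a → same c (col a) ≡ 1 → p a ≢ a → F₀ c a ≡ p a × F₀ c (p a) ≡ p a
      merged₀ c a s ne with ok a
      ... | inj₁ e = contradiction e ne
      ... | inj₂ (_ , _ , _ , _ , e) = at-same c (same-eq c _ s) , at-other c (trans e (cong not (≡-sym (same-eq c _ s))))
      module _ (c : Bool) where
        f : Fin n → Fin n
        f = F₀ c
        merged = merged₀ c
        less : ∑ (λ a → ∑ λ b → nd (f a) (f b) * wt a b) + g c ≤ total
        less = ≤-trans (≤-reflexive (≡-sym (∑-+ (λ a → ∑ λ b → nd (f a) (f b) * wt a b) (λ a → same c (col a) * (nd a (p a) * wt a (p a))))))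
          (∑-mono rows)
          where
          nd-le : ∀ a b → nd (f a) (f b) ≤ nd a b
          nd-le a b with a ≟ b
          ... | yes refl = ≤-reflexive (nd-refl (f a))
          ... | no _ with f a ≟ f b
          ... | yes _ = z≤n
          ... | no _ = ≤-refl
          rows : ∀ a → ∑ (λ b → nd (f a) (f b) * wt a b) + same c (col a) * (nd a (p a) * wt a (p a)) ≤ ∑ (λ b → nd a b * wt a b)
          rows a with same01 c (col a) | p a ≟ a
            where
            same01 : ∀ x y → same x y ≡ 0 ⊎ same x y ≡ 1
            same01 true true = inj₂ refl
            same01 false false = inj₂ refl
            same01 true false = inj₁ refl
            same01 false true = inj₁ refl
          ... | inj₁ z | _ = ≤-trans (≤-reflexive (trans (cong (λ s → ∑ (λ b → nd (f a) (f b) * wt a b) + s * (nd a (p a) * wt a (p a))) z) (+-identityʳ _)))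
                (∑-mono λ b → *-monoˡ-≤ (wt a b) (nd-le a b))
          ... | inj₂ _ | yes e = ≤-trans (≤-reflexive (trans (cong (∑ (λ b → nd (f a) (f b) * wt a b) +_) (trans (cong (λ z → same c (col a) * (z * wt a (p a))) (trans (cong (nd a) e) (nd-refl a))) (*-zeroʳ (same c (col a))))) (+-identityʳ _)))
                (∑-mono λ b → *-monoˡ-≤ (wt a b) (nd-le a b))
          ... | inj₂ s | no ne = ∑-bump (p a) (λ b → *-monoˡ-≤ (wt a b) (nd-le a b))
                (≤-reflexive (trans (cong₂ _+_ (cong (_* wt a (p a)) (trans (cong₂ nd (proj₁ (merged a s ne)) (proj₂ (merged a s ne))) (nd-refl (p a))))
                  (cong (_* (nd a (p a) * wt a (p a))) s)) (+-identityʳ _)))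
        stars : gain p ≤ g c + g c → Stars
        stars le = record { f = f ; idem = idem₀ c ; near = near₀ c ; shrink = final }
          where
          open ≤-Reasoning
          D = (d + d) + (d + d)
          X = ∑ λ a → ∑ λ b → nd (f a) (f b) * wt a b
          all-A : total ≤ W A
          all-A = ∑-mono λ a → ∑-mono λ b → pt a b
            where
            pt : ∀ a b → nd a b * wt a b ≤ b2n (A a ∧ A b) * (nd a b * wt a b)
            pt a b with 0 <? wt a b
            ... | no w = ≤-trans (≤-reflexive (trans (cong (nd a b *_) (n≤0⇒n≡0 (≮⇒≥ w))) (*-zeroʳ (nd a b)))) z≤n
            ... | yes w = ≤-reflexive (≡-sym (trans (cong (_* (nd a b * wt a b)) (b2n-true (∧-intro (wt-A a b w) (wt-A b a (≤-trans w (≤-reflexive (wt-sym a b))))))) (+-identityʳ _)))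
          final : D * X + total ≤ D * total
          final = begin
            D * X + total               ≤⟨ +-monoʳ-≤ (D * X) (≤-trans all-A heavy) ⟩
            D * X + (d + d) * gain p    ≤⟨ +-monoʳ-≤ (D * X) (*-monoʳ-≤ (d + d) le) ⟩
            D * X + (d + d) * (g c + g c) ≡⟨ cong (D * X +_) (trans (*-distribˡ-+ (d + d) (g c) (g c)) (≡-sym (*-distribʳ-+ (g c) (d + d) (d + d)))) ⟩
            D * X + D * g c             ≡⟨ ≡-sym (*-distribˡ-+ D X (g c)) ⟩
            D * (X + g c)               ≤⟨ *-monoʳ-≤ D less ⟩
            D * total ∎

  star-packing : Dense ⊎ Stars
  star-packing with forest (card A) A ≤-refl (λ _ e → e)
  ... | inj₁ dn = inj₁ dn
  ... | inj₂ F with ≤-total (Choose.g F true) (Choose.g F false)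
  ... | inj₁ le = inj₂ (Choose.stars F false (≤-trans (≤-reflexive (Choose.split F)) (+-monoˡ-≤ _ le)))
  ... | inj₂ le = inj₂ (Choose.stars F true (≤-trans (≤-reflexive (Choose.split F)) (+-monoʳ-≤ _ le)))

*-swap : ∀ a b c → a * (b * c) ≡ b * (a * c)
*-swap = solve 3 (λ a b c → a :* (b :* c) := b :* (a :* c)) refl

*-swap′ : ∀ a b c → a * b * c ≡ b * (a * c)
*-swap′ = solve 3 (λ a b c → a :* b :* c := b :* (a :* c)) refl

∑-pos : ∀ {n} (f : Fin n → ℕ) → 0 < ∑ f → ∃ λ i → 0 < f i
∑-pos {n} f lt = ∑-find {n} {λ _ → 0} {f} (≤-<-trans (≤-reflexive (∑-zero {n})) lt)

∑-at : ∀ {n} (x : Fin n) (h : Fin n → ℕ) → ∑ (λ a → b2n ⌊ x ≟ a ⌋ * h a) ≡ h x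
∑-at {n} x h = trans (∑-cong {n} {λ a → b2n ⌊ x ≟ a ⌋ * h a} {λ a → b2n ⌊ a ≟ x ⌋ * h x} pt) (∑-delta x (h x))
  where
  pt : ∀ a → b2n ⌊ x ≟ a ⌋ * h a ≡ b2n ⌊ a ≟ x ⌋ * h x
  pt a with x ≟ a | a ≟ x
  ... | yes refl | yes _ = refl
  ... | no _ | no _ = refl
  ... | yes p | no q = contradiction (≡-sym p) q
  ... | no p | yes q = contradiction (≡-sym q) p

module Group {n : ℕ} (ℓ : Fin n → Fin n) where
  open ≡-Reasoning

  at : Fin n → Fin n → ℕ
  at u a = b2n ⌊ ℓ u ≟ a ⌋

  group₁ : ∀ (ψ g : Fin n → ℕ) → ∑ (λ u → ψ (ℓ u) * g u) ≡ ∑ (λ a → ψ a * ∑ (λ u → at u a * g u))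
  group₁ ψ g = begin
    ∑ (λ u → ψ (ℓ u) * g u) ≡⟨ ∑-cong {n} {_} {λ u → ∑ λ a → at u a * (ψ a * g u)} (λ u → ≡-sym (∑-at (ℓ u) (λ a → ψ a * g u))) ⟩
    ∑ (λ u → ∑ λ a → at u a * (ψ a * g u)) ≡⟨ ∑-swap (λ u a → at u a * (ψ a * g u)) ⟩
    ∑ (λ a → ∑ λ u → at u a * (ψ a * g u)) ≡⟨ ∑-cong {n} {λ a → ∑ λ u → at u a * (ψ a * g u)} {λ a → ψ a * ∑ (λ u → at u a * g u)} row ⟩
    ∑ (λ a → ψ a * ∑ (λ u → at u a * g u)) ∎
    where
    row : ∀ a → ∑ (λ u → at u a * (ψ a * g u)) ≡ ψ a * ∑ (λ u → at u a * g u)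
    row a = trans (∑-cong {n} {λ u → at u a * (ψ a * g u)} {λ u → ψ a * (at u a * g u)}
        (λ u → *-swap (at u a) (ψ a) (g u)))
      (∑-* (ψ a) (λ u → at u a * g u))

  weight : (Fin n → Fin n → ℕ) → Fin n → Fin n → ℕ
  weight F a b = ∑ λ u → ∑ λ v → at u a * (at v b * F u v)

  group₂ : ∀ (φ F : Fin n → Fin n → ℕ) →
    ∑ (λ u → ∑ λ v → φ (ℓ u) (ℓ v) * F u v) ≡ ∑ (λ a → ∑ λ b → φ a b * weight F a b)
  group₂ φ F = begin
    ∑ (λ u → ∑ λ v → φ (ℓ u) (ℓ v) * F u v) ≡⟨ ∑-cong {n} {λ u → ∑ λ v → φ (ℓ u) (ℓ v) * F u v} {λ u → ∑ λ b → φ (ℓ u) b * r u b} (λ u → group₁ (φ (ℓ u)) (F u)) ⟩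
    ∑ (λ u → ∑ λ b → φ (ℓ u) b * r u b) ≡⟨ ∑-swap (λ u b → φ (ℓ u) b * r u b) ⟩
    ∑ (λ b → ∑ λ u → φ (ℓ u) b * r u b) ≡⟨ ∑-cong {n} {λ b → ∑ λ u → φ (ℓ u) b * r u b} {λ b → ∑ λ a → φ a b * weight F a b} (λ b → trans (group₁ (λ a → φ a b) (λ u → r u b))
        (∑-cong {n} {λ a → φ a b * ∑ (λ u → at u a * r u b)} {λ a → φ a b * weight F a b} λ a → cong (φ a b *_) (inner a b))) ⟩
    ∑ (λ b → ∑ λ a → φ a b * weight F a b) ≡⟨ ∑-swap (λ b a → φ a b * weight F a b) ⟩
    ∑ (λ a → ∑ λ b → φ a b * weight F a b) ∎
    where
    r : Fin n → Fin n → ℕ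
    r u b = ∑ λ v → at v b * F u v
    inner : ∀ a b → ∑ (λ u → at u a * r u b) ≡ weight F a b
    inner a b = ∑-cong {n} {λ u → at u a * r u b} {λ u → ∑ λ v → at u a * (at v b * F u v)} λ u → ≡-sym (∑-* (at u a) (λ v → at v b * F u v))

  weight-sym : ∀ F → (∀ u v → F u v ≡ F v u) → ∀ a b → weight F a b ≡ weight F b a
  weight-sym F sym a b = trans (∑-swap (λ u v → at u a * (at v b * F u v)))
    (∑-cong {n} {λ v → ∑ λ u → at u a * (at v b * F u v)} {λ v → ∑ λ u → at v b * (at u a * F v u)} λ v →
      ∑-cong {n} {λ u → at u a * (at v b * F u v)} {λ u → at v b * (at u a * F v u)} λ u →
        trans (cong (λ z → at u a * (at v b * z)) (sym u v)) (*-swap (at u a) (at v b) (F v u)))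

  weight-pos : ∀ F a b → 0 < weight F a b → ∃ λ u → ∃ λ v → ℓ u ≡ a × ℓ v ≡ b × 0 < F u v
  weight-pos F a b pos with ∑-pos _ pos
  ... | u , pu with ∑-pos _ pu
  ... | v , pv with ℓ u ≟ a | ℓ v ≟ b
  ... | yes p | yes q = u , v , p , q , subst (0 <_) (trans (+-identityʳ _) (+-identityʳ _)) pv
  ... | no _ | _ = ⊥-elim (<⇒≱ pv z≤n)
  ... | yes _ | no _ = ⊥-elim (<⇒≱ pv z≤n)

SmallModel : ∀ {n} → Graph n → ℕ → ℕ → Set
SmallModel I t k = Σ (Model I (wheelAdj t)) λ M → ∃ λ T → length T ≤ k × (∀ v → InModel M v → v ∈ T)

-- A merged cluster consists of a centre cluster and clusters that contain a neighbour of one of its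
-- vertices; each vertex has at most `Δ` neighbours, and each cluster at most the previous size.
clusterSize : ℕ → ℕ → ℕ
clusterSize Δ zero = 1
clusterSize Δ (suc j) = clusterSize Δ j + clusterSize Δ j * (Δ * clusterSize Δ j)

-- One round multiplies the number of crossing pairs by at most x/(x+1); powers of numerator and
-- denominator are kept on opposite sides to avoid fractions.
decay : ∀ D x p q c' c c₀ → D ≡ suc x → D * c' + c ≤ D * c → p * c ≤ q * c₀ → D * p * c' ≤ x * q * c₀
decay D x p q c' c c₀ D≡ le le' = begin
  D * p * c'   ≡⟨ *-swap′ D p c' ⟩
  p * (D * c') ≤⟨ *-monoʳ-≤ p (+-cancelʳ-≤ c _ _ (≤-trans le (≤-reflexive (trans (cong (_* c) D≡) (+-comm c (x * c)))))) ⟩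
  p * (x * c)  ≡⟨ *-swap p x c ⟩
  x * (p * c)  ≤⟨ *-monoʳ-≤ x le' ⟩
  x * (q * c₀) ≡⟨ ≡-sym (*-assoc x q c₀) ⟩
  x * q * c₀ ∎
  where open ≤-Reasoning

bool-ext : ∀ {x y} → (x ≡ true → y ≡ true) → (y ≡ true → x ≡ true) → x ≡ y
bool-ext {true} f g = ≡-sym (f refl)
bool-ext {false} {true} f g = g refl
bool-ext {false} {false} f g = refl

-- Repeated contraction of star forests

module Rounds {n : ℕ} (I : Graph n) (t′ : ℕ) (1≤t′ : 1 ≤ t′) (A : Fin n → Bool)
  (A-edge : ∀ u v → adj I u v ≡ true → A u ≡ true) (Λ : ℕ) (small : card A < 2 ^ Λ)
  (d : ℕ) (d≡ : d ≡ denseD (suc t′)) (Δ : ℕ) where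

  t D : ℕ
  t = suc t′
  D = (d + d) + (d + d)

  -- Only vertices of degree at most `Δ` are clustered, which keeps clusters bounded through
  -- boundedly many rounds. In a sparse graph the others are few and can be deleted.
  low : Fin n → Bool
  low u = A u ∧ ⌊ deg (adj I) A u ≤? Δ ⌋

  E : BRel {n}
  E u v = adj I u v ∧ (low u ∧ low v)

  E-sym : ∀ u v → E u v ≡ E v u
  E-sym u v = cong₂ _∧_ (Graph.sym I u v) (∧-comm (low u) (low v))

  E-adj : ∀ {u v} → E u v ≡ true → Adj I u v
  E-adj e = proj₁ (∧-true e)

  E-low : ∀ {u v} → E u v ≡ true → low u ≡ true × low v ≡ true
  E-low {u} {v} e = ∧-true {low u} (proj₂ (∧-true {adj I u v} e))

  F : Fin n → Fin n → ℕ
  F u v = b2n (E u v)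

  cross : (Fin n → Fin n) → ℕ
  cross ℓ = ∑ λ u → ∑ λ v → nd (ℓ u) (ℓ v) * F u v

  Class : (Fin n → Fin n) → Fin n → Fin n → Set
  Class ℓ a u = low u ≡ true × ℓ u ≡ a

  record Clusters (ℓ : Fin n → Fin n) (s : ℕ) : Set where
    field
      lab-A : ∀ u → low u ≡ true → A (ℓ u) ≡ true
      con   : ∀ a → Conn (Tr E) (Class ℓ a)
      lst   : Fin n → List (Fin n)
      lst≤  : ∀ a → length (lst a) ≤ s
      cover : ∀ a u → Class ℓ a u → u ∈ lst a

  initial : Clusters id 1
  initial = record
    { lab-A = λ u e → proj₁ (∧-true e)
    ; con = λ { a _ _ (l , refl) (_ , refl) → stop (l , refl) }
    ; lst = λ a → a ∷ [] ; lst≤ = λ _ → ≤-refl ; cover = λ { a _ (_ , refl) → here refl } }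

  grown : ℕ → ℕ
  grown s = s + s * (Δ * s)

  Joined : (Fin n → Fin n) → Fin n → Fin n → Set
  Joined ℓ a b = ∃ λ u → ∃ λ v → ℓ u ≡ a × ℓ v ≡ b × E u v ≡ true

  lift-clusters : ∀ {ℓ s} → Clusters ℓ s → (Q : Graph n) → (∀ i j → Adj Q i j → Joined ℓ i j) →
    (Σ (Model Q (wheelAdj t)) λ M → ∃ λ T → length T ≤ denseSize t Λ × (∀ v → InModel M v → v ∈ T)) →
    SmallModel I t (denseSize t Λ * s)
  lift-clusters {ℓ} {s} C Q real (M , T , lenT , inT) = proj₁ lifted , concatMap C.lst T ,
      ≤-trans (length-concatMap C.lst T (λ a _ → C.lst≤ a)) (*-monoˡ-≤ s lenT) ,
      λ v m → case proj₂ lifted v m of λ { (i , ci , mi) → ∈-concatMap⁺ C.lst (inT i mi) (C.cover i v (c-inv ci)) }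
    where
    module C = Clusters C
    c : Fin n → Maybe (Fin n)
    c u = if low u then just (ℓ u) else nothing
    c-inv : ∀ {u i} → c u ≡ just i → Class ℓ i u
    c-inv {u} e = inv (low u) refl e
      where
      inv : ∀ b {i} → low u ≡ b → (if b then just (ℓ u) else nothing) ≡ just i → Class ℓ i u
      inv true l e = l , just-injective e
    c-to : ∀ {u i} → Class ℓ i u → c u ≡ just i
    c-to {u} (l , e) = trans (cong (λ b → if b then just (ℓ u) else nothing) l) (cong just e)
    lifted = lift (wheel-nbr {n} t (s≤s z≤n)) I Q c
      (λ i u v p q → wk-map E-adj (λ _ → c-to) (C.con i u v (c-inv p) (c-inv q))) M
      λ i j _ _ e → case real i j e of λ
        { (u , v , p , q , r) → u , v , c-to (proj₁ (E-low r) , p) , c-to (proj₂ (E-low r) , q) , E-adj r }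

  merge-clusters : ∀ {ℓ s} → Clusters ℓ s → (f : Fin n → Fin n) → (∀ a → f (f a) ≡ f a) →
    (∀ a → f a ≡ a ⊎ Joined ℓ a (f a)) → Clusters (λ u → f (ℓ u)) (grown s)
  merge-clusters {ℓ} {s} C f idem near = record { lab-A = lab' ; con = con' ; lst = lst' ; lst≤ = lst≤' ; cover = cover' }
    where
    module C = Clusters C
    ℓ' : Fin n → Fin n
    ℓ' u = f (ℓ u)
    lab' : ∀ u → low u ≡ true → A (ℓ' u) ≡ true
    lab' u l with near (ℓ u)
    ... | inj₁ e = trans (cong A e) (C.lab-A u l)
    ... | inj₂ (x , y , _ , py , r) = subst (λ z → A z ≡ true) py (C.lab-A y (proj₂ (E-low r)))
    fix : ∀ {a u} → Class ℓ' a u → f a ≡ a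
    fix (_ , e) = trans (cong f (≡-sym e)) (trans (idem _) e)
    reach : ∀ {a u} → Class ℓ' a u → ∃ λ u₀ → Class ℓ a u₀ × Wk (Tr E) (Class ℓ' a) u u₀
    reach {a} {u} (l , e) with near (ℓ u)
    ... | inj₁ e' = u , (l , trans (≡-sym e') e) , stop (l , e)
    ... | inj₂ (x , y , px , py , r) = y , (proj₂ (E-low r) , trans py e) ,
          wk-snoc (wk-mono (λ z q → proj₁ q , trans (cong f (proj₂ q)) e) (C.con (ℓ u) u x (l , refl) (proj₁ (E-low r) , px))) r
            (proj₂ (E-low r) , trans (cong f (trans py e)) (fix {a} {u} (l , e)))
    con' : ∀ a → Conn (Tr E) (Class ℓ' a)
    con' a u v pu pv with reach pu | reach pv
    ... | u₀ , cu , wu | v₀ , cv , wv = wu ⊙ wk-mono (λ z q → proj₁ q , trans (cong f (proj₂ q)) (fix pu)) (C.con a u₀ v₀ cu cv)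
          ⊙ wk-rev (λ {x} {y} q → trans (E-sym y x) q) wv
    nb-set : Fin n → Fin n → Bool
    nb-set y x = low y ∧ (A x ∧ adj I y x)
    nb : Fin n → List (Fin n)
    nb y = listOf (nb-set y)
    nb≤ : ∀ y → length (nb y) ≤ Δ
    nb≤ y = ≤-trans (≤-reflexive (length-listOf (nb-set y))) (bound (tr? (low y)))
      where
      bound : Dec (low y ≡ true) → card (nb-set y) ≤ Δ
      bound (yes l) = ≤-trans (card-mono (nb-set y) (λ x → A x ∧ adj I y x) (λ x e → proj₂ (∧-true {low y} e)))
              (true-does (deg (adj I) A y ≤? Δ) (proj₂ (∧-true {A y} l)))
      bound (no ¬l) = ≤-trans (card-cover (nb-set y) [] (λ x e → ⊥-elim (¬l (proj₁ (∧-true e))))) z≤n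
    around : Fin n → List (Fin n)
    around y = concatMap (λ x → C.lst (ℓ x)) (nb y)
    lst' : Fin n → List (Fin n)
    lst' a = C.lst a ++ concatMap around (C.lst a)
    lst≤' : ∀ a → length (lst' a) ≤ grown s
    lst≤' a = ≤-trans (≤-reflexive (length-++ (C.lst a))) (+-mono-≤ (C.lst≤ a)
      (≤-trans (length-concatMap around (C.lst a) (λ y _ → ≤-trans (length-concatMap (λ x → C.lst (ℓ x)) (nb y) (λ x _ → C.lst≤ (ℓ x))) (*-monoˡ-≤ s (nb≤ y))))
        (*-monoˡ-≤ (Δ * s) (C.lst≤ a))))
    cover' : ∀ a u → Class ℓ' a u → u ∈ lst' a
    cover' a u (l , e) with near (ℓ u)
    ... | inj₁ e' = ∈-++⁺ˡ (C.cover a u (l , trans (≡-sym e') e))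
    ... | inj₂ (x , y , px , py , r) = ∈-++⁺ʳ (C.lst a) (∈-concatMap⁺ around (C.cover a y (proj₂ (E-low r) , trans py e))
          (∈-concatMap⁺ (λ x → C.lst (ℓ x)) {x = x} (∈-listOf (nb-set y) x (∧-intro (proj₂ (E-low r)) (∧-intro (proj₁ (∧-true (proj₁ (E-low r)))) (adj-sym I (E-adj r)))))
            (C.cover (ℓ x) u (l , ≡-sym px))))

  edge-of : ∀ ℓ a b → 0 < Group.weight ℓ F a b → Joined ℓ a b
  edge-of ℓ a b pos with Group.weight-pos ℓ F a b pos
  ... | u , v , p , q , h = u , v , p , q , positive (E u v) h
    where
    positive : ∀ x → 0 < b2n x → x ≡ true
    positive true _ = refl

  -- Clusters are weighted by the number of crossing edges between them. A dense set of clusters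
  -- gives a small wheel in the quotient, and its clusters bound the size of the lifted model;
  -- otherwise contracting the stars turns a fixed fraction of the weight into edges inside
  -- clusters.
  step-round : ∀ {ℓ s} → Clusters ℓ s →
    SmallModel I t (denseSize t Λ * s) ⊎ ∃ λ ℓ' → Clusters ℓ' (grown s) × D * cross ℓ' + cross ℓ ≤ D * cross ℓ
  step-round {ℓ} {s} C = [ (λ h → inj₁ (from-dense h)) , (λ S → inj₂ (from-stars S)) ]′ SP.star-packing
    where
    wt = Group.weight ℓ F
    wt-A : ∀ a b → 0 < wt a b → A a ≡ true
    wt-A a b pos = case edge-of ℓ a b pos of λ { (u , v , p , _ , e) → subst (λ z → A z ≡ true) p (Clusters.lab-A C u (proj₁ (E-low e))) }
    wt-sym : ∀ a b → wt a b ≡ wt b a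
    wt-sym = Group.weight-sym ℓ F (λ u v → cong b2n (E-sym u v))
    module SP = StarPacking wt wt-sym A wt-A d
    from-dense : SP.Dense → SmallModel I t (denseSize t Λ * s)
    from-dense (S , S⊂A , dn) = lift-clusters C Q (λ i j e → edge-of ℓ i j (proj₂ (SP.true-q e)))
        (case dense-wheel Q t′ 1≤t′ S Λ (≤-<-trans (card-mono S A S⊂A) small) (subst (λ z → z * card S < pairs SP.q S) d≡ dn) of λ
          { (M , T , lenT , _ , inT) → M , T , lenT , inT })
      where
      flip : ∀ a b → SP.q a b ≡ true → SP.q b a ≡ true
      flip a b p = SP.q-true (λ h → proj₁ (SP.true-q p) (≡-sym h)) (subst (0 <_) (wt-sym a b) (proj₂ (SP.true-q p)))
      Q : Graph n
      Q = record { adj = SP.q ; sym = λ a b → bool-ext (flip a b) (flip b a) ; irrefl = λ v → ¬true (λ e → proj₁ (SP.true-q e) refl) }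
    from-stars : SP.Stars → ∃ λ ℓ' → Clusters ℓ' (grown s) × D * cross ℓ' + cross ℓ ≤ D * cross ℓ
    from-stars S = (λ u → f (ℓ u)) , merge-clusters C f idem (λ a → [ inj₁ , inj₂ ∘ edge-of ℓ a (f a) ]′ (near a)) ,
      subst₂ (λ x y → D * x + y ≤ D * y) (≡-sym (Group.group₂ ℓ (λ a b → nd (f a) (f b)) F)) (≡-sym (Group.group₂ ℓ nd F)) shrink
      where open SP.Stars S

  size : ℕ → ℕ
  size = clusterSize Δ

  rounds : ∀ x → D ≡ suc x → ∀ j →
    SmallModel I t (denseSize t Λ * size j) ⊎ ∃ λ ℓ → Clusters ℓ (size j) × D ^ j * cross ℓ ≤ x ^ j * cross id
  rounds x D≡ zero = inj₂ (id , initial , ≤-refl)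
  rounds x D≡ (suc j) = [ (λ m → inj₁ (widen m)) , next ]′ (rounds x D≡ j)
    where
    widen : SmallModel I t (denseSize t Λ * size j) → SmallModel I t (denseSize t Λ * size (suc j))
    widen (M , T , le , h) = M , T , ≤-trans le (*-monoʳ-≤ (denseSize t Λ) (m≤m+n (size j) (size j * (Δ * size j)))) , h
    after : ∀ {ℓ} → D ^ j * cross ℓ ≤ x ^ j * cross id →
      SmallModel I t (denseSize t Λ * size j) ⊎ (∃ λ ℓ' → Clusters ℓ' (size (suc j)) × D * cross ℓ' + cross ℓ ≤ D * cross ℓ) →
      SmallModel I t (denseSize t Λ * size (suc j)) ⊎ ∃ λ ℓ → Clusters ℓ (size (suc j)) × D ^ suc j * cross ℓ ≤ x ^ suc j * cross id
    after le (inj₁ m) = inj₁ (widen m)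
    after {ℓ} le (inj₂ (ℓ' , C' , le')) = inj₂ (ℓ' , C' , decay D x (D ^ j) (x ^ j) (cross ℓ') (cross ℓ) (cross id) D≡ le' le)
    next : (∃ λ ℓ → Clusters ℓ (size j) × D ^ j * cross ℓ ≤ x ^ j * cross id) →
      SmallModel I t (denseSize t Λ * size (suc j)) ⊎ ∃ λ ℓ → Clusters ℓ (size (suc j)) × D ^ suc j * cross ℓ ≤ x ^ suc j * cross id
    next (ℓ , C , le) = after {ℓ} le (step-round C)

  cross₀ : cross id ≤ pairs (adj I) A
  cross₀ = ∑-mono λ u → ∑-mono λ v → pt u v
    where
    pt : ∀ u v → nd u v * F u v ≤ b2n (A u ∧ (A v ∧ adj I u v))
    pt u v with tr? (E u v)
    ... | no e = ≤-trans (≤-reflexive (trans (cong (nd u v *_) (b2n-false e)) (*-zeroʳ (nd u v)))) z≤n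
    ... | yes e = ≤-trans (*-mono-≤ {nd u v} {1} (nd≤ u v) (≤-reflexive (b2n-true e)))
            (≤-reflexive (≡-sym (b2n-true (∧-intro {A u} (proj₁ (∧-true {A u} (proj₁ (E-low e)))) (∧-intro {A v} (proj₁ (∧-true {A v} (proj₂ (E-low e)))) (E-adj e))))))
      where
      nd≤ : ∀ (u v : Fin n) → nd u v ≤ 1
      nd≤ u v with u ≟ v
      ... | yes _ = z≤n
      ... | no _ = ≤-refl

-- Bernoulli's inequality (1 + 1/x)^j ≥ 1 + j/x, cleared of denominators.
bernoulli : ∀ x j → x ^ j * (x + j) ≤ x * suc x ^ j
bernoulli x zero = ≤-reflexive (trans (+-identityʳ _) (trans (+-identityʳ x) (≡-sym (*-identityʳ x))))
bernoulli x (suc j) = begin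
  x * x ^ j * (x + suc j)              ≡⟨ solve 3 (λ x p j → x :* p :* (x :+ (num 1 :+ j)) := x :* (p :* (x :+ j)) :+ p :* x) refl x (x ^ j) j ⟩
  x * (x ^ j * (x + j)) + x ^ j * x    ≤⟨ +-monoʳ-≤ (x * (x ^ j * (x + j))) (*-monoʳ-≤ (x ^ j) (m≤m+n x j)) ⟩
  x * (x ^ j * (x + j)) + x ^ j * (x + j) ≡⟨ solve 2 (λ x y → x :* y :+ y := (num 1 :+ x) :* y) refl x (x ^ j * (x + j)) ⟩
  suc x * (x ^ j * (x + j))            ≤⟨ *-monoʳ-≤ (suc x) (bernoulli x j) ⟩
  suc x * (x * suc x ^ j)              ≡⟨ *-swap (suc x) x (suc x ^ j) ⟩
  x * (suc x * suc x ^ j) ∎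
  where open ≤-Reasoning

private
  regroup : ∀ a b c f → a * (b * (c * f)) ≡ b * (a * c) * f
  regroup = solve 4 (λ a b c f → a :* (b :* (c :* f)) := b :* (a :* c) :* f) refl

  rotate : ∀ a b c → a * (b * c) ≡ b * (c * a)
  rotate = solve 3 (λ a b c → a :* (b :* c) := b :* (c :* a)) refl

  spread : ∀ e y z → 2 * (e * (y + z)) ≡ (e + e) * y + (e + e) * z
  spread = solve 3 (λ e y z → num 2 :* (e :* (y :+ z)) := (e :+ e) :* y :+ (e :+ e) :* z) refl

-- Here `suc x` = 4d is the contraction factor. With `Δ` = 2ed at most `card A`/(2e) vertices have
-- larger degree. By Bernoulli, `J` = `Δ * x` rounds divide the number of crossing pairs by `Δ`,
-- which leaves at most `card A`/(2e) of them.
module FragmentConst (d e : ℕ) where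
  x Δ J K : ℕ
  x = (d + d + (d + d)) ∸ 1
  Δ = (e + e) * d
  J = Δ * x
  K = clusterSize Δ J

fragK : ℕ → ℕ → ℕ
fragK d e = FragmentConst.K d e

Fragmented : ∀ {n} → Graph n → (Fin n → Bool) → ℕ → ℕ → Set
Fragmented {n} I A e K = ∃ λ (ℓ : Fin n → Fin n) → ∃ λ W → e * length W ≤ card A ×
    (∀ a → ∃ λ L → length L ≤ K × (∀ u → A u ≡ true → u ∉ W → ℓ u ≡ a → u ∈ L)) ×
    (∀ u v → Adj I u v → u ∉ W → v ∉ W → ℓ u ≡ ℓ v)

fragment : ∀ t d e → 1 ≤ t → d ≡ denseD (suc t) → 1 ≤ d →
  ∀ {n} (I : Graph n) (A : Fin n → Bool) → (∀ u v → adj I u v ≡ true → A u ≡ true) →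
  ∀ Λ → card A < 2 ^ Λ →
  SmallModel I (suc t) (denseSize (suc t) Λ * fragK d e) ⊎ Fragmented I A e (fragK d e)
fragment t′ d e 1≤t′ d≡ 1≤d {n} I A A-edge Λ small = decide (d * card A <? pairs (adj I) A)
  where
  open FragmentConst d e hiding (K)
  module Rd = Rounds I t′ 1≤t′ A A-edge Λ small d d≡ Δ
  1≤K : ∀ j → 1 ≤ Rd.size j
  1≤K zero = ≤-refl
  1≤K (suc j) = ≤-trans (1≤K j) (m≤m+n _ _)
  D≡ : Rd.D ≡ suc x
  D≡ = ≡-sym (m+[n∸m]≡n (≤-trans 1≤d (≤-trans (m≤m+n d d) (m≤m+n (d + d) (d + d)))))
  1≤x : 1 ≤ x
  1≤x = ≤-pred (≤-trans (+-mono-≤ 1≤d 1≤d) (≤-trans (m≤m+n (d + d) (d + d)) (≤-reflexive D≡)))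
  sparse : ¬ d * card A < pairs (adj I) A → (∃ λ ℓ → Rd.Clusters ℓ (Rd.size J) × Rd.D ^ J * Rd.cross ℓ ≤ x ^ J * Rd.cross id) → Fragmented I A e (Rd.size J)
  decide : Dec (d * card A < pairs (adj I) A) → SmallModel I (suc t′) (denseSize (suc t′) Λ * fragK d e) ⊎ Fragmented I A e (fragK d e)
  decide (yes dn) = inj₁ (case dense-wheel I t′ 1≤t′ A Λ small (subst (λ z → z * card A < pairs (adj I) A) d≡ dn) of λ
    { (M , T , le , _ , h) → M , T , ≤-trans le (≤-trans (≤-reflexive (≡-sym (*-identityʳ _))) (*-monoʳ-≤ (denseSize (suc t′) Λ) (1≤K J))) , h })
  decide (no ¬dn) = [ inj₁ , inj₂ ∘ sparse ¬dn ]′ (Rd.rounds x D≡ J)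
  sparse ¬dn (ℓ , C , le) = ℓ , W , bound , (λ a → C.lst a , C.lst≤ a , λ u Au u∉ e' → C.cover a u (is-low u Au u∉ , e')) , edge
    where
    module C = Rd.Clusters C
    Y X : Fin n → Bool
    Y u = A u ∧ not (Rd.low u)
    X u = ⌊ any? (λ v → tr? (Rd.E u v) ×-dec ¬? (ℓ u ≟ ℓ v)) ⌋
    -- `Y` holds the vertices of large degree, `X` the ends of crossing edges; each gets half of the
    -- budget.
    W = listOf Y ++ listOf X
    is-low : ∀ u → A u ≡ true → u ∉ W → Rd.low u ≡ true
    is-low u Au u∉ with tr? (Rd.low u)
    ... | yes l = l
    ... | no ¬l = ⊥-elim (u∉ (∈-++⁺ˡ (∈-listOf Y u (∧-intro Au (cong not (¬true ¬l))))))
    edge : ∀ u v → Adj I u v → u ∉ W → v ∉ W → ℓ u ≡ ℓ v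
    edge u v r u∉ v∉ with ℓ u ≟ ℓ v
    ... | yes p = p
    ... | no ne = ⊥-elim (u∉ (∈-++⁺ʳ (listOf Y) (∈-listOf X u (does-true (any? _)
          (v , ∧-intro r (∧-intro (is-low u (A-edge u v r) u∉) (is-low v (A-edge v u (adj-sym I r)) v∉)) , ne)))))
    P≤ : pairs (adj I) A ≤ d * card A
    P≤ = ≮⇒≥ ¬dn
    Y≤ : (e + e) * card Y ≤ card A
    Y≤ = *-cancelˡ-≤ d {{>-nonZero 1≤d}} (≤-trans (≤-reflexive (≡-sym (*-swap′ (e + e) d (card Y))))
      (≤-trans (≤-reflexive (≡-sym (∑-* Δ (λ u → b2n (Y u))))) (≤-trans (∑-mono row) P≤)))
      where
      row : ∀ u → Δ * b2n (Y u) ≤ ∑ (λ v → b2n (A u ∧ (A v ∧ adj I u v)))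
      row u with tr? (Y u)
      ... | no h = ≤-trans (≤-reflexive (trans (cong (Δ *_) (b2n-false h)) (*-zeroʳ Δ))) z≤n
      ... | yes h = ≤-trans (≤-reflexive (trans (cong (Δ *_) (b2n-true h)) (*-identityʳ Δ))) (≤-trans big
              (∑-mono {n} {λ v → b2n (A v ∧ adj I u v)} {λ v → b2n (A u ∧ (A v ∧ adj I u v))} λ v → b2n-mono λ q → ∧-intro (proj₁ (∧-true {A u} h)) q))
        where
        big : Δ ≤ deg (adj I) A u
        big = large (deg (adj I) A u ≤? Δ)
          where
          not-true : ∀ {b} → not b ≡ true → b ≡ false
          not-true {false} _ = refl
          large : Dec (deg (adj I) A u ≤ Δ) → Δ ≤ deg (adj I) A u
          large (no q) = <⇒≤ (≰⇒> q)
          large (yes q) = ⊥-elim (true≢false (∧-intro (proj₁ (∧-true {A u} h)) (does-true (deg (adj I) A u ≤? Δ) q)) (not-true (proj₂ (∧-true {A u} h))))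
    X≤ : card X ≤ Rd.cross ℓ
    X≤ = ∑-mono row
      where
      row : ∀ u → b2n (X u) ≤ ∑ (λ v → nd (ℓ u) (ℓ v) * Rd.F u v)
      row u with any? (λ v → tr? (Rd.E u v) ×-dec ¬? (ℓ u ≟ ℓ v))
      ... | no _ = z≤n
      ... | yes (v , r , ne) = ≤-trans (≤-reflexive (≡-sym (trans (cong₂ _*_ (nd-≢ ne) (b2n-true r)) refl))) (∑-pick (λ v → nd (ℓ u) (ℓ v) * Rd.F u v) v)
    open ≤-Reasoning
    cross≤ : (e + e) * Rd.cross ℓ ≤ card A
    cross≤ = *-cancelˡ-≤ (suc x ^ J) {{m^n≢0 (suc x) J}} (begin
      suc x ^ J * ((e + e) * Rd.cross ℓ)   ≡⟨ *-swap (suc x ^ J) (e + e) (Rd.cross ℓ) ⟩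
      (e + e) * (suc x ^ J * Rd.cross ℓ)   ≤⟨ *-monoʳ-≤ (e + e) (subst (λ z → z ^ J * Rd.cross ℓ ≤ x ^ J * Rd.cross id) D≡ le) ⟩
      (e + e) * (x ^ J * Rd.cross id)      ≤⟨ *-monoʳ-≤ (e + e) (*-monoʳ-≤ (x ^ J) (≤-trans Rd.cross₀ P≤)) ⟩
      (e + e) * (x ^ J * (d * card A))     ≡⟨ regroup (e + e) (x ^ J) d (card A) ⟩
      x ^ J * Δ * card A                   ≤⟨ *-monoˡ-≤ (card A) pow ⟩
      suc x ^ J * card A ∎)
      where
      pow : x ^ J * Δ ≤ suc x ^ J
      pow = *-cancelˡ-≤ x {{>-nonZero 1≤x}} (begin
        x * (x ^ J * Δ)   ≡⟨ rotate x (x ^ J) Δ ⟩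
        x ^ J * (Δ * x)   ≤⟨ *-monoʳ-≤ (x ^ J) (m≤n+m J x) ⟩
        x ^ J * (x + J)   ≤⟨ bernoulli x J ⟩
        x * suc x ^ J ∎)
    bound : e * length W ≤ card A
    bound = *-cancelˡ-≤ 2 (begin
      2 * (e * length W)                 ≡⟨ cong (λ z → 2 * (e * z)) (trans (length-++ (listOf Y)) (cong₂ _+_ (length-listOf Y) (length-listOf X))) ⟩
      2 * (e * (card Y + card X))        ≡⟨ spread e (card Y) (card X) ⟩
      (e + e) * card Y + (e + e) * card X ≤⟨ +-mono-≤ Y≤ (≤-trans (*-monoʳ-≤ (e + e) X≤) cross≤) ⟩
      card A + card A                    ≡⟨ cong (card A +_) (≡-sym (+-identityʳ _)) ⟩
      2 * card A ∎)

-- Cheap models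

module _ {n : ℕ} where

  wk-stay : ∀ {R : Rel {n}} {P C : Fin n → Set} {u v} → Wk R P u v → C u →
    (∀ x y → C x → R x y → P y → DN (C y)) → DN (C v)
  wk-stay (stop _) c _ = return c
  wk-stay (go _ r w) c h = h _ _ c r (wk-start w) >>= λ c' → wk-stay w c' h

  avoid-or-hit : ∀ {R : Rel {n}} {P Q : Fin n → Set} {u w} → (∀ x → Dec (Q x)) → Wk R P u w →
    Wk R (Without P Q) u w ⊎ ∃ λ a → Q a × Wk R P a w × (u ≡ a ⊎ ∃ λ y → Wk R (Without P Q) u y × R y a)
  avoid-or-hit {u = u} Q? (stop p) with Q? u
  ... | yes q = inj₂ (u , q , stop p , inj₁ refl)
  ... | no ¬q = inj₁ (stop (p , ¬q))
  avoid-or-hit {u = u} Q? (go p r w) with Q? u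
  ... | yes q = inj₂ (u , q , go p r w , inj₁ refl)
  ... | no ¬q with avoid-or-hit Q? w
  ... | inj₁ w' = inj₁ (go (p , ¬q) r w')
  ... | inj₂ (a , q , wa , inj₁ refl) = inj₂ (a , q , wa , inj₂ (u , stop (p , ¬q) , r))
  ... | inj₂ (a , q , wa , inj₂ (y , wy , ry)) = inj₂ (a , q , wa , inj₂ (y , go (p , ¬q) r wy , ry))

module Wheels {n : ℕ} (G : Graph n) (t′ : ℕ) where

  private
    t = suc t′
    R = Adj G
    sR = adj-sym G

  WM : Set
  WM = Model G (wheelAdj t)

  Avoids : WM → List (Fin n) → Set
  Avoids M X = ∀ v → InModel M v → v ∉ X

  Hits : List (Fin n) → Set
  Hits X = ∀ M → ¬ Avoids M X

  -- Cheap k P: at most k vertices separate P from every model that P could meet.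
  Cheap : ℕ → (Fin n → Set) → Set
  Cheap k P = ∃ λ H → length H ≤ k × (∀ M → Avoids M H → ∀ v → InModel M v → ¬ P v)

  CheapModel : ℕ → Set
  CheapModel k = Σ WM λ M → Cheap k (InModel M)

  model-conn : ∀ (M : WM) → Conn R (InModel M)
  model-conn M = conn-root sR r λ v m → to-root v (assign M v) refl m
    where
    r : Fin n
    r = proj₁ (nonempty M zero)
    inM : ∀ {v x} → assign M v ≡ just x → InModel M v
    inM p q with () ← trans (≡-sym p) q
    branch : ∀ {x u v} → assign M u ≡ just x → assign M v ≡ just x → Wk R (InModel M) u v
    branch p q = wk-mono (λ _ → inM) (from-walk (connected M _ _ _ p q))
    to-root : ∀ v (x : Maybe (Fin (suc t))) → assign M v ≡ x → InModel M v → Wk R (InModel M) v r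
    to-root v nothing e m = contradiction e m
    to-root v (just zero) e m = branch e (proj₂ (nonempty M zero))
    to-root v (just (suc i)) e m with edges M (suc i) zero refl
    ... | a , b , pa , pb , ab = branch e pa ⊙ go (inM pa) ab (branch pb (proj₂ (nonempty M zero)))

  model-some : ∀ (M : WM) → ∃ λ v → InModel M v
  model-some M with nonempty M zero
  ... | v , p = v , λ q → case trans (≡-sym p) q of λ ()

  cheap-⊆ : ∀ {k P Q} → (∀ v → Q v → P v) → Cheap k P → Cheap k Q
  cheap-⊆ sub (H , le , h) = H , le , λ M av v m q → h M av v m (sub v q)

  cheap-≤ : ∀ {k l P} → k ≤ l → Cheap k P → Cheap l P
  cheap-≤ k≤l (H , le , h) = H , ≤-trans le k≤l , h

  cheap-one : ∀ v → Cheap 1 (_≡ v)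
  cheap-one v = v ∷ [] , ≤-refl , λ { M av .v m refl → av v m (here refl) }

  cheap-∪ : ∀ {k l P Q} → Cheap k P → Cheap l Q → Cheap (k + l) (λ v → P v ⊎ Q v)
  cheap-∪ (H , le , h) (H' , le' , h') = H ++ H' , ≤-trans (≤-reflexive (length-++ H)) (+-mono-≤ le le') ,
    λ { M av v m (inj₁ p) → h M (λ u mu → av u mu ∘ ∈-++⁺ˡ) v m p
      ; M av v m (inj₂ q) → h' M (λ u mu → av u mu ∘ ∈-++⁺ʳ H) v m q }

  cheap-family : ∀ {k} (P : Fin n → Fin n → Set) (L : List (Fin n)) → (∀ x → x ∈ L → Cheap k (P x)) →
    Cheap (length L * k) (λ v → ∃ λ x → x ∈ L × P x v)
  cheap-family P [] c = [] , z≤n , λ { _ _ _ _ (_ , () , _) }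
  cheap-family P (x ∷ L) c = cheap-⊆ (λ { v (_ , here refl , p) → inj₁ p ; v (y , there m , p) → inj₂ (y , m , p) })
    (cheap-∪ (c x (here refl)) (cheap-family P L (λ y → c y ∘ there)))

  -- A model is connected, so one that meets `C` and avoids the boundary `H` stays inside `C`. Then
  -- it misses the hitting set `X`, a contradiction.
  cheap-closed : ∀ {X H k} {C : Fin n → Set} → Hits X → length H ≤ k → (∀ x → C x → x ∉ X) →
    (∀ x y → C x → R x y → ¬ C y → y ∈ H) → Cheap k C
  cheap-closed {X} {H} {k} {C} hits le dis clo = H , le , λ M av v m c → hits M λ u mu u∈X →
    wk-stay (model-conn M v u m mu) c (λ x y cx r my ¬cy → av y my (clo x y cx r ¬cy)) (λ cu → dis u cu u∈X)

  -- Cut the walk at its last visit to the first vertex of L that it meets, and recurse.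
  path-cell : ∀ {κ} (Ψ : Fin n → Set) → (∀ v → Ψ v → Cheap κ (Comp R Ψ v)) →
    ∀ m L → length L ≤ m → ∀ {u w} → Wk R (λ x → Ψ x ⊎ x ∈ L) u w →
    DN (∃ λ Q → u ∈ Q × w ∈ Q × Conn R (_∈ Q) × (∀ x → x ∈ Q → Ψ x ⊎ x ∈ L) × Cheap (suc m * suc κ) (_∈ Q))
  path-cell {κ} Ψ ch m L le {u} {w} wk = step₁ (avoid-or-hit (_∈? L) wk)
    where
    Res : List (Fin n) → ℕ → Fin n → Fin n → Set
    Res L m u w = ∃ λ Q → u ∈ Q × w ∈ Q × Conn R (_∈ Q) × (∀ x → x ∈ Q → Ψ x ⊎ x ∈ L) × Cheap (suc m * suc κ) (_∈ Q)
    inΨ : ∀ {x} → Without (λ x → Ψ x ⊎ x ∈ L) (_∈ L) x → Ψ x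
    inΨ (inj₁ p , _) = p
    inΨ (inj₂ q , ∉) = contradiction q ∉
    component : ∀ v → Ψ v → DN (∃ λ Q → v ∈ Q × (∀ x → Wk R Ψ v x → x ∈ Q) × Conn R (_∈ Q) × (∀ x → x ∈ Q → Ψ x) × Cheap κ (_∈ Q))
    component v p = enum (Comp R Ψ v) >>= λ { (Q , _ , to , from) → return (Q , to v (stop p) , to ,
      (λ a b pa pb → wk-mono to (comp-conn sR a b (from a pa) (from b pb))) ,
      (λ x m → wk-end (from x m)) , cheap-⊆ from (ch v p)) }
    single : ∀ {a} (P : Fin n → Set) → P a → ∀ x → x ∈ (a ∷ []) → P x
    single P p _ (here refl) = p
    κ≤ : κ ≤ suc m * suc κ
    κ≤ = ≤-trans (n≤1+n κ) (m≤m+n (suc κ) (m * suc κ))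
    front : ∀ {a} → a ∈ L → (u ≡ a ⊎ ∃ λ y → Wk R (Without (λ x → Ψ x ⊎ x ∈ L) (_∈ L)) u y × R y a) →
      DN (∃ λ Q → u ∈ Q × a ∈ Q × Conn R (_∈ Q) × (∀ x → x ∈ Q → Ψ x ⊎ x ∈ L) × Cheap (suc κ) (_∈ Q))
    front {a} a∈ (inj₁ refl) = return (a ∷ [] , here refl , here refl ,
      (λ x y x∈ y∈ → single (λ z → Wk R (_∈ (a ∷ [])) z y) (single (λ z → Wk R (_∈ (a ∷ [])) a z) (stop (here refl)) y y∈) x x∈) ,
      single _ (inj₂ a∈) , cheap-≤ (s≤s z≤n) (cheap-⊆ (single (_≡ a) refl) (cheap-one a)))
    front {a} a∈ (inj₂ (y , wy , r)) = component u (inΨ (wk-start wy)) >>= λ { (Q , u∈ , to , con , sub , c) →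
      return (a ∷ Q , there u∈ , here refl ,
        conn-root sR a (λ { _ (here refl) → stop (here refl)
                          ; x (there x∈) → wk-snoc (wk-mono (λ _ → there) (con x y x∈ (to y (wk-mono (λ _ → inΨ) wy)))) r (here refl) }) ,
        (λ { _ (here refl) → inj₂ a∈ ; x (there x∈) → inj₁ (sub x x∈) }) ,
        cheap-⊆ (λ { _ (here e) → inj₁ e ; x (there x∈) → inj₂ x∈ }) (cheap-∪ (cheap-one a) c)) }
    rest : ∀ m → length L ≤ m → ∀ {a} → a ∈ L → Wk R (λ x → Ψ x ⊎ x ∈ L) a w →
      (∃ λ Q → u ∈ Q × a ∈ Q × Conn R (_∈ Q) × (∀ x → x ∈ Q → Ψ x ⊎ x ∈ L) × Cheap (suc κ) (_∈ Q)) → Dec (w ≡ a) → DN (Res L m u w)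
    rest m le a∈ wa (Q , u∈ , a∈Q , con , sub , c) (yes refl) = return (Q , u∈ , a∈Q , con , sub , cheap-≤ (m≤m+n (suc κ) _) c)
    rest zero le a∈ _ _ (no _) = contradiction (≤-trans (length-remove a∈) le) λ ()
    rest (suc m) le {a} a∈ wa (Q , u∈ , a∈Q , con , sub , c) (no w≢a) = case last-exit wa w≢a of λ { (a' , r , wk') →
      path-cell Ψ ch m (remove a L) (≤-pred (≤-trans (length-remove a∈) le)) (wk-mono less wk') >>= λ
        { (Q' , a'∈ , w∈ , con' , sub' , c') → return (Q ++ Q' , ∈-++⁺ˡ u∈ , ∈-++⁺ʳ Q w∈ ,
            conn-root sR a (λ x x∈ → case ∈-++⁻ Q x∈ of λ
              { (inj₁ q) → wk-mono (λ _ → ∈-++⁺ˡ) (con x a q a∈Q)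
              ; (inj₂ q) → wk-snoc (wk-mono (λ _ → ∈-++⁺ʳ Q) (con' x a' q a'∈)) (sR r) (∈-++⁺ˡ a∈Q) }) ,
            (λ x x∈ → case ∈-++⁻ Q x∈ of λ
              { (inj₁ q) → sub x q ; (inj₂ q) → case sub' x q of λ { (inj₁ p) → inj₁ p ; (inj₂ p) → inj₂ (proj₁ (∈-remove⁻ {L = L} p)) } }) ,
            cheap-⊆ (λ x → ∈-++⁻ Q) (cheap-∪ c c')) } }
      where
      less : ∀ x → Without (λ x → Ψ x ⊎ x ∈ L) (_≡ a) x → Ψ x ⊎ x ∈ remove a L
      less x (inj₁ p , _) = inj₁ p
      less x (inj₂ q , ne) = inj₂ (∈-remove⁺ q ne)
    step₁ : Wk R (Without (λ x → Ψ x ⊎ x ∈ L) (_∈ L)) u w ⊎ (∃ λ a → a ∈ L × Wk R (λ x → Ψ x ⊎ x ∈ L) a w ×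
      (u ≡ a ⊎ ∃ λ y → Wk R (Without (λ x → Ψ x ⊎ x ∈ L) (_∈ L)) u y × R y a)) → DN (Res L m u w)
    step₁ (inj₁ w') = component u (inΨ (wk-start w')) >>= λ { (Q , u∈ , to , con , sub , c) →
      return (Q , u∈ , to w (wk-mono (λ _ → inΨ) w') , con , (λ x → inj₁ ∘ sub x) , cheap-≤ κ≤ c) }
    step₁ (inj₂ (a , a∈ , wa , pre)) = front a∈ pre >>= λ f → rest m le a∈ wa f (w ≟ a)

  lift-cheap : (Q : Graph n) (c : Fin n → Maybe (Fin n)) → (∀ i → Conn R (λ v → c v ≡ just i)) →
    ∀ {κ} → (M : Model Q (wheelAdj t)) (T : List (Fin n)) → (∀ v → InModel M v → v ∈ T) →
    (∀ i → i ∈ T → Cheap κ (λ v → c v ≡ just i)) →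
    (∀ i j → InModel M i → InModel M j → Adj Q i j → ∃ λ u → ∃ λ v → c u ≡ just i × c v ≡ just j × R u v) →
    CheapModel (length T * κ)
  lift-cheap Q c con M T inT ch real = proj₁ l , cheap-⊆ (λ v m → case proj₂ l v m of λ { (i , ci , mi) → i , inT i mi , ci })
      (cheap-family (λ i v → c v ≡ just i) T ch)
    where
    l = lift (wheel-nbr {n} t (s≤s z≤n)) G Q c con M real

-- Splitting G − X into parts with few neighbours

half-bound : ∀ b → b < suc ⌊ b /2⌋ + suc ⌊ b /2⌋
half-bound zero = s≤s z≤n
half-bound (suc zero) = s≤s (s≤s z≤n)
half-bound (suc (suc b)) = s≤s (≤-trans (s≤s (half-bound b)) (≤-reflexive (≡-sym (+-suc (suc ⌊ b /2⌋) (suc ⌊ b /2⌋)))))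

half-double : ∀ m → ⌊ m + m /2⌋ ≡ m
half-double zero = refl
half-double (suc m) = trans (cong (λ z → ⌊ suc z /2⌋) (+-suc m m)) (cong suc (half-double m))

module Peeling {n : ℕ} (G : Graph n) (t′ : ℕ) (X₀ : List (Fin n)) (hits : Wheels.Hits G t′ X₀)
  (s : ℕ) (s≡ : s ≡ havenOrder (suc t′)) (D₁ : ℕ) where

  open Wheels G t′

  private
    R = Adj G
    sR = adj-sym G

  -- `D'` solves the recursion of the cutting step: a part inherits at most half of an old boundary
  -- of size `D'`, which is `h`, and gains `suc s` + `s` = `h` cut vertices. `κ` pays for one vertex
  -- and `D₁` walks as built by `path-cell`.
  h D' D₂ κ : ℕ
  h = suc (s + s)
  D' = h + h
  D₂ = D' + D₁
  κ = suc (D₁ * (suc (suc s) * suc D₂))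

  Bounded : ℕ → (Fin n → Set) → Set
  Bounded k C = ∃ λ H → length H ≤ k × (∀ x y → C x → R x y → ¬ C y → y ∈ H)

  -- What is contracted later: a connected set of bounded cost with `D₁` distinct neighbours in
  -- `Xs`.
  record Cell (Xs : List (Fin n)) (U : List (Fin n)) : Set where
    field
      Q Y : List (Fin n)
      rep : Fin n
      rep∈ : rep ∈ Q
      conQ : Conn R (_∈ Q)
      Q⊂U : ∀ v → v ∈ Q → v ∈ U
      cheap : Cheap κ (_∈ Q)
      uY : Unique Y
      lenY : length Y ≡ D₁
      nbY : ∀ y → y ∈ Y → y ∈ Xs × ∃ λ x → x ∈ Q × R x y

  -- After `j` extractions, `U` is the union of the extracted pieces. Their boundaries have joined
  -- `Xs`, which therefore shields `U` from the rest, and `S` collects the vertices that cut the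
  -- pieces into parts with bounded boundary.
  record State (j : ℕ) : Set where
    field
      Xs U S : List (Fin n)
      X₀⊂ : ∀ v → v ∈ X₀ → v ∈ Xs
      Xs≤ : length Xs ≤ length X₀ + j * D'
      S≤ : length S ≤ j * suc s
      S⊂U : ∀ v → v ∈ S → v ∈ U
      apart : ∀ v → v ∈ U → v ∉ Xs
      closed : ∀ x y → x ∈ U → R x y → y ∈ U ⊎ y ∈ Xs
      parts : ∀ v → v ∈ U → v ∉ S → Bounded D₂ (Comp R (λ x → x ∈ U × x ∉ S) v)
      cells : Fin j → Cell Xs U
      disj : ∀ i k v → v ∈ Cell.Q (cells i) → v ∈ Cell.Q (cells k) → i ≡ k

  start : State 0
  start = record
    { Xs = X₀ ; U = [] ; S = [] ; X₀⊂ = λ _ → id ; Xs≤ = ≤-reflexive (≡-sym (+-identityʳ _)) ; S≤ = z≤n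
    ; S⊂U = λ _ () ; apart = λ _ () ; closed = λ _ _ () ; parts = λ _ () ; cells = λ () ; disj = λ () }

  Rich : List (Fin n) → (Fin n → Set) → Set
  Rich Xs C = ∃ λ Y → Unique Y × length Y ≡ D₁ × (∀ y → y ∈ Y → y ∈ Xs × ∃ λ x → C x × R x y)

  poor : ∀ Xs C → ¬ Rich Xs C → DN (∃ λ H → length H ≤ D₁ × (∀ y → y ∈ Xs → (∃ λ x → C x × R x y) → y ∈ H))
  poor Xs C ¬rich = pick (λ y → y ∈ Xs × ∃ λ x → C x × R x y) D₁ >>= λ
    { (inj₁ (Y , u , l , sat)) → ⊥-elim (¬rich (Y , u , l , sat))
    ; (inj₂ (H , lt , cov)) → return (H , <⇒≤ lt , λ y y∈ e → cov y (y∈ , e)) }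

  module Step {j : ℕ} (st : State j) where
    open State st

    Fresh : Fin n → Set
    Fresh v = v ∉ Xs × v ∉ U

    -- The boundary is split: at most `D'` fresh neighbours `∂`, and any number in `Xs`, but at
    -- least `D₁` of these. A part of `F` that keeps few fresh neighbours can thus fail to be a
    -- candidate only by having fewer than `D₁` neighbours in `Xs`.
    record Cand (F : List (Fin n)) : Set where
      field
        v₀ : Fin n
        v₀∈ : v₀ ∈ F
        conF : Conn R (_∈ F)
        fresh : ∀ v → v ∈ F → Fresh v
        ∂ : List (Fin n)
        ∂≤ : length ∂ ≤ D'
        ∂-out : ∀ v → v ∈ ∂ → Fresh v × v ∉ F
        bd : ∀ x y → x ∈ F → R x y → y ∉ F → y ∈ ∂ ⊎ y ∈ Xs
        rich : Rich Xs (_∈ F)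

    Minimal : List (Fin n) → Set
    Minimal F = ∀ K → length K < length F → ¬ Cand K

    minimal : ∀ m F → length F ≤ m → Cand F → DN (∃ λ F → Cand F × Minimal F)
    minimal m F le c = em (∃ λ K → length K < length F × Cand K) >>= λ
      { (no ∄) → return (F , c , λ K lt cK → ∄ (K , lt , cK))
      ; (yes (K , lt , cK)) → descend m le K lt cK }
      where
      descend : ∀ m → length F ≤ m → ∀ K → length K < length F → Cand K → DN (∃ λ F → Cand F × Minimal F)
      descend zero le K lt cK = contradiction (≤-trans lt le) λ ()
      descend (suc m) le K lt cK = minimal m K (≤-pred (≤-trans lt le)) cK

    module Take (F : List (Fin n)) (cand : Cand F) (min : Minimal F) where
      open Cand cand
      b = length ∂
      open Haven G (_∈ (F ++ ∂)) {b} (lookup ∂)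

      fresh-X₀ : ∀ v → Fresh v → v ∉ X₀
      fresh-X₀ v (∉Xs , _) v∈ = ∉Xs (X₀⊂ v v∈)

      -- Otherwise the majority of ∂ would define a haven in F ∪ ∂, which is disjoint from X₀.
      breaker : DN (∃ λ S₁ → length S₁ ≤ s × ¬ ∃ λ v → Big S₁ v)
      breaker = em (∃ λ S₁ → length S₁ ≤ s × ¬ ∃ λ v → Big S₁ v) >>= λ
        { (yes p) → return p
        ; (no ∄) → haven-wheel t′ (λ S₁ le k → ∄ (S₁ , subst (length S₁ ≤_) (≡-sym s≡) le , k)) >>= λ
            { (M , inside) → ⊥-elim (hits M λ v m v∈ → case ∈-++⁻ F (inside v m) of λ
                { (inj₁ q) → fresh-X₀ v (fresh v q) v∈ ; (inj₂ q) → fresh-X₀ v (proj₁ (∂-out v q)) v∈ }) } }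

      module Cut (S₁ : List (Fin n)) (S₁≤ : length S₁ ≤ s) (small : ¬ ∃ λ v → Big S₁ v) where
        -- Adding `v₀` makes every remaining part strictly smaller than `F`, even if the breaker
        -- misses `F`, so that minimality applies. It is also the common meeting point of the walks
        -- in `new-cell`.
        S' : List (Fin n)
        S' = v₀ ∷ filter (_∈? F) S₁

        S'≤ : length S' ≤ suc s
        S'≤ = s≤s (≤-trans (length-filter (_∈? F) S₁) S₁≤)

        S'⊂F : ∀ v → v ∈ S' → v ∈ F
        S'⊂F _ (here refl) = v₀∈
        S'⊂F v (there m) = proj₂ (∈-filter⁻ (_∈? F) {xs = S₁} m)

        Ψ : Fin n → Set
        Ψ v = v ∈ F × v ∉ S'

        not-S₁ : ∀ {v} → Ψ v → v ∉ S₁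
        not-S₁ (v∈F , ∉) v∈ = ∉ (there (∈-filter⁺ (_∈? F) v∈ v∈F))

        -- No part contacts a majority of `∂` outside `S₁`, so its fresh boundary again has size at
        -- most `D'`. By minimality of `F` the part is not a candidate, hence it has at most `D₁`
        -- neighbours in `Xs`.
        component : ∀ v → Ψ v → DN (Bounded D₂ (Comp R Ψ v))
        component v pv = do
          K , uK , to , from ← enum (Comp R Ψ v)
          p ← pick (λ i → lookup ∂ i ∉ S₁ × ∃ λ x → Comp R Ψ v x × R x (lookup ∂ i)) (suc ⌊ b /2⌋)
          case p of λ
            { (inj₁ (J , uJ , lJ , sat)) → ⊥-elim (small (v , J , uJ , subst (λ z → b < z + z) (≡-sym lJ) (half-bound b) ,
                λ i i∈ → case sat i i∈ of λ { (∉S , x , wx , r) →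
                  wk-snoc (wk-mono (λ z pz → ∈-++⁺ˡ (proj₁ pz) , not-S₁ pz) wx) r (∈-++⁺ʳ F (∈-lookup i) , ∉S) }))
            ; (inj₂ (J , J< , cov)) → finish K uK to from J (≤-pred J<) cov }
          where
          finish : ∀ K → Unique K → (∀ x → Comp R Ψ v x → x ∈ K) → (∀ x → x ∈ K → Comp R Ψ v x) →
            ∀ J → length J ≤ ⌊ b /2⌋ → (∀ i → (lookup ∂ i ∉ S₁ × ∃ λ x → Comp R Ψ v x × R x (lookup ∂ i)) → i ∈ J) →
            DN (Bounded D₂ (Comp R Ψ v))
          finish K uK to from J J≤ cov = poor Xs (_∈ K) ¬rich >>= λ { (H , H≤ , covH) →
            return (∂K ++ H , ≤-trans (≤-reflexive (length-++ ∂K)) (+-mono-≤ ∂K≤ H≤) ,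
              λ x y cx r ¬cy → case nbr x y cx r ¬cy of λ
                { (inj₁ q) → ∈-++⁺ˡ q ; (inj₂ q) → ∈-++⁺ʳ ∂K (covH y q (x , to x cx , r)) }) }
            where
            ∂S = filter (_∈? ∂) S₁
            ∂J = map (lookup ∂) J
            ∂K = S' ++ ∂S ++ ∂J
            ∂K≤ : length ∂K ≤ D'
            ∂K≤ = ≤-trans (≤-reflexive (trans (length-++ S') (cong (length S' +_) (length-++ ∂S))))
              (≤-trans (≤-reflexive (≡-sym (+-assoc (length S') (length ∂S) (length ∂J))))
                (+-mono-≤ (+-mono-≤ S'≤ (≤-trans (length-filter (_∈? ∂) S₁) S₁≤))
                  (≤-trans (≤-reflexive (length-map (lookup ∂) J)) (≤-trans J≤ (≤-trans (⌊n/2⌋-mono ∂≤) (≤-reflexive (half-double h)))))))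
            K⊂F : ∀ x → x ∈ K → x ∈ F
            K⊂F x x∈ = proj₁ (wk-end (from x x∈))
            nbr : ∀ x y → Comp R Ψ v x → R x y → ¬ Comp R Ψ v y → y ∈ ∂K ⊎ y ∈ Xs
            nbr x y cx r ¬cy with y ∈? F
            ... | yes y∈F with y ∈? S'
            ... | yes y∈S' = inj₁ (∈-++⁺ˡ y∈S')
            ... | no y∉S' = ⊥-elim (¬cy (wk-snoc cx r (y∈F , y∉S')))
            nbr x y cx r ¬cy | no y∉F with bd x y (proj₁ (wk-end cx)) r y∉F
            ... | inj₂ q = inj₂ q
            ... | inj₁ y∈∂ with y ∈? S₁
            ... | yes y∈S = inj₁ (∈-++⁺ʳ S' (∈-++⁺ˡ (∈-filter⁺ (_∈? ∂) y∈S y∈∂)))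
            ... | no y∉S = inj₁ (∈-++⁺ʳ S' (∈-++⁺ʳ ∂S (subst (_∈ ∂J) (≡-sym (lookup-index y∈∂))
                  (∈-map⁺ (lookup ∂) (cov (index y∈∂) (subst (_∉ S₁) (lookup-index y∈∂) y∉S , x , cx , subst (R x) (lookup-index y∈∂) r))))))
            ¬rich : ¬ Rich Xs (_∈ K)
            ¬rich rich = min K shorter (record
              { v₀ = v ; v₀∈ = to v (stop pv)
              ; conF = λ x y px py → wk-mono to (comp-conn sR x y (from x px) (from y py))
              ; fresh = λ x x∈ → fresh x (K⊂F x x∈)
              ; ∂ = ∂K ; ∂≤ = ∂K≤
              ; ∂-out = λ y y∈ → out y (∈-++⁻ S' y∈)
              ; bd = λ x y x∈ r y∉ → nbr x y (from x x∈) r (λ cy → y∉ (to y cy))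
              ; rich = rich })
              where
              shorter : length K < length F
              shorter = ≤-<-trans (unique-⊆ uK (λ x x∈ → ∈-remove⁺ {v = v₀} (K⊂F x x∈) (λ { refl → proj₂ (wk-end (from x x∈)) (here refl) })))
                (length-remove v₀∈)
              out : ∀ y → y ∈ S' ⊎ y ∈ ∂S ++ ∂J → Fresh y × y ∉ K
              out y (inj₁ q) = fresh y (S'⊂F y q) , λ y∈ → proj₂ (wk-end (from y y∈)) q
              out y (inj₂ q) with ∈-++⁻ ∂S q
              ... | inj₁ q' = proj₁ (∂-out y y∈∂) , λ y∈ → proj₂ (∂-out y y∈∂) (K⊂F y y∈)
                where y∈∂ = proj₂ (∈-filter⁻ (_∈? ∂) {xs = S₁} q')
              ... | inj₂ q' with ∈-map⁻ (lookup ∂) q'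
              ... | i , _ , refl = proj₁ (∂-out _ (∈-lookup i)) , λ y∈ → proj₂ (∂-out _ (∈-lookup i)) (K⊂F _ y∈)

        cheap-comp : ∀ v → Ψ v → DN (Cheap D₂ (Comp R Ψ v))
        cheap-comp v pv = component v pv >>= λ { (H , le , cov) →
          return (cheap-closed {X = X₀} hits le (λ x cx → fresh-X₀ x (fresh x (proj₁ (wk-end cx)))) cov) }

        -- `F` may consist of unboundedly many parts and need not be cheap. A cell uses only those
        -- parts that join `v₀` to one neighbour of each of `D₁` vertices of `Xs`, boundedly many
        -- for each walk.
        new-cell : (∀ v → Ψ v → Cheap D₂ (Comp R Ψ v)) →
          DN (Σ (Cell (∂ ++ Xs) (F ++ U)) λ c → ∀ v → v ∈ Cell.Q c → v ∈ F)
        new-cell ch = case rich of λ { (Y , uY , lY , nb) →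
          dn-list Y (λ y y∈ → case nb y y∈ of λ { (_ , f , f∈ , r) →
            path-cell {D₂} Ψ ch (suc s) S' S'≤ (wk-mono split (conF f v₀ f∈ v₀∈)) >>= λ p → return (f , r , p) }) >>= λ pc →
          return (build Y uY lY (λ y y∈ → proj₁ (nb y y∈)) pc) }
          where
          split : ∀ x → x ∈ F → Ψ x ⊎ x ∈ S'
          split x x∈ with x ∈? S'
          ... | yes q = inj₂ q
          ... | no q = inj₁ (x∈ , q)
          PC : Fin n → Set
          PC y = ∃ λ f → R f y × ∃ λ Q → f ∈ Q × v₀ ∈ Q × Conn R (_∈ Q) × (∀ x → x ∈ Q → Ψ x ⊎ x ∈ S') × Cheap (suc (suc s) * suc D₂) (_∈ Q)
          build : ∀ Y → Unique Y → length Y ≡ D₁ → (∀ y → y ∈ Y → y ∈ Xs) → (∀ y → y ∈ Y → PC y) →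
            Σ (Cell (∂ ++ Xs) (F ++ U)) λ c → ∀ v → v ∈ Cell.Q c → v ∈ F
          build Y uY lY inX pc = (record
            { Q = Q ; Y = Y ; rep = v₀ ; rep∈ = here refl
            ; conQ = conn-root sR v₀ λ
                { _ (here refl) → stop (here refl)
                ; x (there m) → case ∈-concatMap⁻ qs {Y} m of λ { (y , y∈ , x∈) →
                    wk-mono (λ z z∈ → there (∈-concatMap⁺ qs y∈ z∈)) (qs-con y y∈ x x∈) } }
            ; Q⊂U = λ x m → ∈-++⁺ˡ (Q⊂F x m)
            ; cheap = cheap-≤ (s≤s (*-monoˡ-≤ _ (≤-reflexive lY))) (cheap-⊆ (λ { _ (here e) → inj₁ e
                ; x (there m) → case ∈-concatMap⁻ qs {Y} m of λ { (y , y∈ , x∈) → inj₂ (y , y∈ , x∈) } })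
                (cheap-∪ (cheap-one v₀) (cheap-family (λ y x → x ∈ qs y) Y qs-cheap)))
            ; uY = uY ; lenY = lY
            ; nbY = λ y y∈ → ∈-++⁺ʳ ∂ (inX y y∈) , qs-nb y y∈ }) , Q⊂F
            where
            at : ∀ y → Dec (y ∈ Y) → List (Fin n)
            at y (yes y∈) = proj₁ (proj₂ (proj₂ (pc y y∈)))
            at y (no _) = []
            qs : Fin n → List (Fin n)
            qs y = at y (y ∈? Y)
            Q = v₀ ∷ concatMap qs Y
            spec : ∀ y → y ∈ Y → ∃ λ f → R f y × f ∈ qs y × v₀ ∈ qs y × Conn R (_∈ qs y) × (∀ x → x ∈ qs y → Ψ x ⊎ x ∈ S') × Cheap (suc (suc s) * suc D₂) (_∈ qs y)
            spec y y∈ with y ∈? Y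
            ... | yes q = proj₁ (pc y q) , proj₁ (proj₂ (pc y q)) , proj₂ (proj₂ (proj₂ (pc y q)))
            ... | no q = contradiction y∈ q
            qs-con : ∀ y → y ∈ Y → ∀ x → x ∈ qs y → Wk R (_∈ qs y) x v₀
            qs-con y y∈ x x∈ with spec y y∈
            ... | _ , _ , _ , v₀∈ , con , _ = con x v₀ x∈ v₀∈
            qs-F : ∀ y → y ∈ Y → ∀ x → x ∈ qs y → x ∈ F
            qs-F y y∈ x x∈ with spec y y∈
            ... | _ , _ , _ , _ , _ , sub , _ with sub x x∈
            ... | inj₁ q = proj₁ q
            ... | inj₂ q = S'⊂F x q
            Q⊂F : ∀ x → x ∈ Q → x ∈ F
            Q⊂F _ (here refl) = v₀∈
            Q⊂F x (there m) with ∈-concatMap⁻ qs {Y} m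
            ... | y , y∈ , x∈ = qs-F y y∈ x x∈
            qs-cheap : ∀ y → y ∈ Y → Cheap (suc (suc s) * suc D₂) (_∈ qs y)
            qs-cheap y y∈ = proj₂ (proj₂ (proj₂ (proj₂ (proj₂ (proj₂ (spec y y∈))))))
            qs-nb : ∀ y → y ∈ Y → ∃ λ x → x ∈ Q × R x y
            qs-nb y y∈ with spec y y∈
            ... | f , r , f∈ , _ = f , there (∈-concatMap⁺ qs y∈ f∈) , r

        module Next (bounded : ∀ v → Ψ v → Bounded D₂ (Comp R Ψ v)) (cell : Cell (∂ ++ Xs) (F ++ U))
                    (cellF : ∀ v → v ∈ Cell.Q cell → v ∈ F) where

          F-U : ∀ {x y} → x ∈ F → R x y → y ∉ U
          F-U {x} x∈ r y∈ with closed _ x y∈ (sR r)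
          ... | inj₁ q = proj₂ (fresh x x∈) q
          ... | inj₂ q = proj₁ (fresh x x∈) q

          U⁺ S⁺ : Fin n → Set
          U⁺ x = x ∈ F ++ U × x ∉ S' ++ S
          S⁺ x = x ∈ U × x ∉ S

          toF : ∀ {v x} → Ψ v → Wk R U⁺ v x → Wk R Ψ v x
          toF pv (stop _) = stop pv
          toF pv (go {v = y} _ r w) with ∈-++⁻ F (proj₁ (wk-start w))
          ... | inj₁ y∈F = go pv r (toF (y∈F , proj₂ (wk-start w) ∘ ∈-++⁺ˡ) w)
          ... | inj₂ y∈U = ⊥-elim (F-U (proj₁ pv) r y∈U)

          toU : ∀ {v x} → S⁺ v → Wk R U⁺ v x → Wk R S⁺ v x
          toU pv (stop _) = stop pv
          toU pv (go {v = y} _ r w) with ∈-++⁻ F (proj₁ (wk-start w))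
          ... | inj₁ y∈F = ⊥-elim (F-U y∈F (sR r) (proj₁ pv))
          ... | inj₂ y∈U = go pv r (toU (y∈U , proj₂ (wk-start w) ∘ ∈-++⁺ʳ S') w)

          fromF : ∀ x → Ψ x → U⁺ x
          fromF x (x∈ , ∉) = ∈-++⁺ˡ x∈ , λ m → case ∈-++⁻ S' m of λ { (inj₁ q) → ∉ q ; (inj₂ q) → proj₂ (fresh x x∈) (S⊂U x q) }

          fromU : ∀ x → S⁺ x → U⁺ x
          fromU x (x∈ , ∉) = ∈-++⁺ʳ F x∈ , λ m → case ∈-++⁻ S' m of λ { (inj₁ q) → proj₂ (fresh x (S'⊂F x q)) x∈ ; (inj₂ q) → ∉ q }

          widen : Cell Xs U → Cell (∂ ++ Xs) (F ++ U)
          widen c = record { Q = Q ; Y = Y ; rep = rep ; rep∈ = rep∈ ; conQ = conQ ; Q⊂U = λ v → ∈-++⁺ʳ F ∘ Q⊂U v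
                           ; cheap = cheap ; uY = uY ; lenY = lenY
                           ; nbY = λ y y∈ → ∈-++⁺ʳ ∂ (proj₁ (nbY y y∈)) , proj₂ (nbY y y∈) }
            where open Cell c

          next : State (suc j)
          next = record
            { Xs = ∂ ++ Xs ; U = F ++ U ; S = S' ++ S
            ; X₀⊂ = λ v → ∈-++⁺ʳ ∂ ∘ X₀⊂ v
            ; Xs≤ = ≤-trans (≤-reflexive (length-++ ∂)) (≤-trans (+-mono-≤ ∂≤ Xs≤) (≤-reflexive (shuffle D' (length X₀) (j * D'))))
            ; S≤ = ≤-trans (≤-reflexive (length-++ S')) (+-mono-≤ S'≤ S≤)
            ; S⊂U = λ v m → [ ∈-++⁺ˡ ∘ S'⊂F v , ∈-++⁺ʳ F ∘ S⊂U v ]′ (∈-++⁻ S' m)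
            ; apart = λ v m m' → case ∈-++⁻ F m of λ
                { (inj₁ q) → case ∈-++⁻ ∂ m' of λ { (inj₁ q') → proj₂ (∂-out v q') q ; (inj₂ q') → proj₁ (fresh v q) q' }
                ; (inj₂ q) → case ∈-++⁻ ∂ m' of λ { (inj₁ q') → proj₂ (proj₁ (∂-out v q')) q ; (inj₂ q') → apart v q q' } }
            ; closed = λ x y m r → case ∈-++⁻ F m of λ
                { (inj₁ q) → case y ∈? F of λ { (yes p) → inj₁ (∈-++⁺ˡ p)
                    ; (no p) → inj₂ ([ ∈-++⁺ˡ , ∈-++⁺ʳ ∂ ]′ (bd x y q r p)) }
                ; (inj₂ q) → [ inj₁ ∘ ∈-++⁺ʳ F , inj₂ ∘ ∈-++⁺ʳ ∂ ]′ (closed x y q r) }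
            ; parts = λ v m ∉ → case ∈-++⁻ F m of λ
                { (inj₁ q) → let pv = q , ∉ ∘ ∈-++⁺ˡ in case bounded v pv of λ { (H , le , cov) →
                    H , le , λ x y cx r ¬cy → cov x y (toF pv cx) r (λ cy → ¬cy (wk-mono fromF cy)) }
                ; (inj₂ q) → let pv = q , ∉ ∘ ∈-++⁺ʳ S' in case parts v q (∉ ∘ ∈-++⁺ʳ S') of λ { (H , le , cov) →
                    H , le , λ x y cx r ¬cy → cov x y (toU pv cx) r (λ cy → ¬cy (wk-mono fromU cy)) } }
            ; cells = λ { zero → cell ; (suc i) → widen (cells i) }
            ; disj = λ { zero zero _ _ _ → refl
                       ; zero (suc k) v p q → ⊥-elim (proj₂ (fresh v (cellF v p)) (Cell.Q⊂U (cells k) v q))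
                       ; (suc i) zero v p q → ⊥-elim (proj₂ (fresh v (cellF v q)) (Cell.Q⊂U (cells i) v p))
                       ; (suc i) (suc k) v p q → cong suc (disj i k v p q) } }
            where
            shuffle : ∀ a b c → a + (b + c) ≡ b + (a + c)
            shuffle a b c = trans (≡-sym (+-assoc a b c)) (trans (cong (_+ c) (+-comm a b)) (+-assoc b a c))

dn-→ : ∀ {A B : Set} → (A → DN B) → DN (A → B)
dn-→ {A} f = em A >>= λ { (yes x) → dn-map (λ y _ → y) (f x) ; (no ¬x) → return (λ x → contradiction x ¬x) }

module PeelResult {n : ℕ} (G : Graph n) (t′ : ℕ) (1≤t′ : 1 ≤ t′) (X₀ : List (Fin n)) (hits : Wheels.Hits G t′ X₀)
  (s : ℕ) (s≡ : s ≡ havenOrder (suc t′)) (D₁ : ℕ) where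

  open Wheels G t′
  open Peeling G t′ X₀ hits s s≡ D₁

  private
    R = Adj G
    sR = adj-sym G
    t = suc t′

  Stuck : ℕ → Set
  Stuck j = Σ (State j) λ st → ¬ ∃ (Step.Cand st)

  peel-one : ∀ {j} → State j → DN (Stuck j ⊎ State (suc j))
  peel-one st = em (∃ (Step.Cand st)) >>= λ
    { (no ∄) → return (inj₁ (st , ∄))
    ; (yes (F , c)) → Step.minimal st (length F) F ≤-refl c >>= λ { (F , c , min) →
        let module T = Step.Take st F c min in T.breaker >>= λ { (S₁ , S₁≤ , small) →
        let module C = T.Cut S₁ S₁≤ small in
        dn-Fin (λ v → dn-→ (C.component v)) >>= λ bounded →
        dn-Fin (λ v → dn-→ (C.cheap-comp v)) >>= λ ch →
        C.new-cell ch >>= λ { (cell , cellF) → return (inj₂ (C.Next.next bounded cell cellF)) } } } }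

  run : ∀ j → DN ((∃ λ j' → j' ≤ j × Stuck j') ⊎ State j)
  run zero = return (inj₂ start)
  run (suc j) = run j >>= λ
    { (inj₁ (j' , le , st)) → return (inj₁ (j' , m≤n⇒m≤1+n le , st))
    ; (inj₂ st) → peel-one st >>= λ { (inj₁ stuck) → return (inj₁ (j , n≤1+n j , stuck)) ; (inj₂ st') → return (inj₂ st') } }

  record Protrusions (k : ℕ) : Set where
    field
      Z : List (Fin n)
      X₀⊂Z : ∀ v → v ∈ X₀ → v ∈ Z
      Z≤ : length Z ≤ k
      small : ∀ v → v ∉ Z → Bounded D₂ (Comp R (_∉ Z) v)

  -- Inside `U` the parts are bounded already. A component outside `U` has all its neighbours in
  -- `Xs`, so with empty `∂` it would be a candidate unless these number at most `D₁`.
  from-stuck : ∀ j → Stuck j → DN (Protrusions (length X₀ + j * D' + j * suc s))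
  from-stuck j (st , ∄) = dn-Fin (λ v → dn-→ (bounded v)) >>= λ small → return (record
      { Z = Z ; X₀⊂Z = λ v → ∈-++⁺ˡ ∘ X₀⊂ v ; Z≤ = ≤-trans (≤-reflexive (length-++ Xs)) (+-mono-≤ Xs≤ S≤) ; small = small })
    where
    open State st
    Z = Xs ++ S
    inU : ∀ {v x} → v ∈ U → Wk R (_∉ Z) v x → Wk R (λ x → x ∈ U × x ∉ S) v x
    inU v∈ (stop ∉) = stop (v∈ , ∉ ∘ ∈-++⁺ʳ Xs)
    inU {v} v∈ (go ∉ r w) with closed v _ v∈ r
    ... | inj₁ q = go (v∈ , ∉ ∘ ∈-++⁺ʳ Xs) r (inU q w)
    ... | inj₂ q = ⊥-elim (wk-start w (∈-++⁺ˡ q))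
    outU : ∀ {v x} → v ∉ U → Wk R (_∉ Z) v x → x ∉ U
    outU v∉ (stop _) = v∉
    outU {v} v∉ (go ∉ r w) = outU (λ y∈ → case closed _ v y∈ (sR r) of λ { (inj₁ q) → v∉ q ; (inj₂ q) → ∉ (∈-++⁺ˡ q) }) w
    bounded : ∀ v → v ∉ Z → DN (Bounded D₂ (Comp R (_∉ Z) v))
    bounded v v∉ = case v ∈? U of λ
      { (yes v∈U) → return (case parts v v∈U (v∉ ∘ ∈-++⁺ʳ Xs) of λ { (H , le , cov) →
          H , le , λ x y cx r ¬cy → cov x y (inU v∈U cx) r (λ cy → ¬cy (wk-mono (λ { z (z∈ , z∉) m → case ∈-++⁻ Xs m of λ { (inj₁ q) → apart z z∈ q ; (inj₂ q) → z∉ q } }) cy)) })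
      ; (no v∉U) → enum (Comp R (_∉ Z) v) >>= λ { (K , _ , to , from) →
          poor Xs (_∈ K) (λ rich → ∄ (K , record
            { v₀ = v ; v₀∈ = to v (stop v∉)
            ; conF = λ x y px py → wk-mono to (comp-conn sR x y (from x px) (from y py))
            ; fresh = λ x x∈ → (λ q → wk-end (from x x∈) (∈-++⁺ˡ q)) , outU v∉U (from x x∈)
            ; ∂ = [] ; ∂≤ = z≤n ; ∂-out = λ _ ()
            ; bd = λ x y x∈ r y∉ → inj₂ (nbr v∉U (from x x∈) r (λ cy → y∉ (to y cy)))
            ; rich = rich })) >>= λ { (H , le , cov) →
          return (H , ≤-trans le (m≤n+m D₁ D') , λ x y cx r ¬cy → cov y (nbr v∉U cx r ¬cy) (x , to x cx , r)) } } }
      where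
      nbr : v ∉ U → ∀ {x y} → Comp R (_∉ Z) v x → R x y → ¬ Comp R (_∉ Z) v y → y ∈ Xs
      nbr v∉U {x} {y} cx r ¬cy with y ∈? Z
      ... | no ∉ = ⊥-elim (¬cy (wk-snoc cx r ∉))
      ... | yes m with ∈-++⁻ Xs m
      ... | inj₁ q = q
      ... | inj₂ q with closed y x (S⊂U y q) (sR r)
      ... | inj₁ q' = ⊥-elim (outU v∉U cx q')
      ... | inj₂ q' = ⊥-elim (wk-end cx (∈-++⁺ˡ q'))

  -- Contract the cells: their representatives and `Xs` are at most (2 + D')τ vertices, and τ of
  -- them have degree at least `D₁`. The choice of `D₁` makes this denser than `denseD` allows, and
  -- the contracted sets all cost at most `κ`.
  module Dense (τ : ℕ) (1≤τ : 1 ≤ τ) (X₀≤ : length X₀ ≤ τ) (st : State τ) (Λ : ℕ) (big : (2 + D') * τ < 2 ^ Λ)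
    (D₁≡ : D₁ ≡ suc (denseD t * (2 + D'))) where
    open State st
    module Cel (i : Fin τ) = Cell (cells i)

    rep∉Xs : ∀ i → Cel.rep i ∉ Xs
    rep∉Xs i = apart _ (Cel.Q⊂U i _ (Cel.rep∈ i))
    rep-inj : ∀ i k → Cel.rep i ≡ Cel.rep k → i ≡ k
    rep-inj i k e = disj i k _ (Cel.rep∈ i) (subst (_∈ Cel.Q k) (≡-sym e) (Cel.rep∈ k))

    isRep : Fin n → Bool
    isRep u = ⌊ any? (λ i → Cel.rep i ≟ u) ⌋
    A : Fin n → Bool
    A u = ⌊ u ∈? Xs ⌋ ∨ isRep u
    e q : BRel {n}
    e u v = ⌊ any? (λ i → (Cel.rep i ≟ u) ×-dec (v ∈? Cel.Y i)) ⌋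
    q u v = e u v ∨ e v u
    e-true : ∀ i {v} → v ∈ Cel.Y i → e (Cel.rep i) v ≡ true
    e-true i {v} v∈ = does-true (any? (λ k → (Cel.rep k ≟ Cel.rep i) ×-dec (v ∈? Cel.Y k))) (i , refl , v∈)
    true-e : ∀ {u v} → e u v ≡ true → ∃ λ i → Cel.rep i ≡ u × v ∈ Cel.Y i
    true-e {u} {v} = true-does (any? (λ i → (Cel.rep i ≟ u) ×-dec (v ∈? Cel.Y i)))
    q-sym : ∀ u v → q u v ≡ q v u
    q-sym u v = bool-ext (flip u v) (flip v u)
      where
      flip : ∀ u v → q u v ≡ true → q v u ≡ true
      flip u v h = [ (λ p → ∨-trueʳ {e v u} p) , (λ p → ∨-trueˡ p) ]′ (∨-true {e u v} h)
    q-irr : ∀ v → q v v ≡ false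
    q-irr v = ¬true λ h → bad ([ id , id ]′ (∨-true {e v v} h))
      where
      bad : e v v ≡ true → ⊥
      bad h with true-e h
      ... | i , refl , m = rep∉Xs i (proj₁ (Cel.nbY i _ m))
    Q : Graph n
    Q = record { adj = q ; sym = q-sym ; irrefl = q-irr }

    cover : List (Fin n)
    cover = Xs ++ map Cel.rep (allFin τ)
    cardA : card A ≤ (2 + D') * τ
    cardA = ≤-trans (card-cover A cover inCover) (≤-trans (≤-reflexive (length-++ Xs))
      (≤-trans (+-mono-≤ (≤-trans Xs≤ (+-monoˡ-≤ (τ * D') X₀≤)) (≤-reflexive (trans (length-map Cel.rep (allFin τ)) (length-allFin τ))))
        (≤-reflexive (arith τ D'))))
      where
      arith : ∀ τ D → (τ + τ * D) + τ ≡ (2 + D) * τ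
      arith = solve 2 (λ τ D → (τ :+ τ :* D) :+ τ := (num 2 :+ D) :* τ) refl
      inCover : ∀ v → A v ≡ true → v ∈ cover
      inCover v h with ∨-true {⌊ v ∈? Xs ⌋} h
      ... | inj₁ p = ∈-++⁺ˡ (true-does (v ∈? Xs) p)
      ... | inj₂ p with true-does (any? (λ i → Cel.rep i ≟ v)) p
      ... | i , refl = ∈-++⁺ʳ Xs (∈-map⁺ Cel.rep (∈-allFin i))
    isRep-true : ∀ i → isRep (Cel.rep i) ≡ true
    isRep-true i = does-true (any? (λ k → Cel.rep k ≟ Cel.rep i)) (i , refl)
    reps : τ ≤ card isRep
    reps = ≤-trans (≤-reflexive (≡-sym (trans (length-map Cel.rep (allFin τ)) (length-allFin τ))))
      (card-list isRep (map Cel.rep (allFin τ)) (unique-map (λ {i} {k} → rep-inj i k) (allFin⁺ τ))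
        (λ v m → case ∈-map⁻ Cel.rep {xs = allFin τ} m of λ { (i , _ , refl) → isRep-true i }))
    pairs≥ : D₁ * τ ≤ pairs q A
    pairs≥ = ≤-trans (*-monoʳ-≤ D₁ reps) (≤-trans (≤-reflexive (≡-sym (∑-* D₁ (λ u → b2n (isRep u))))) (∑-mono row))
      where
      row : ∀ u → D₁ * b2n (isRep u) ≤ ∑ (λ v → b2n (A u ∧ (A v ∧ q u v)))
      row u = go′ (tr? (isRep u))
        where
        go′ : Dec (isRep u ≡ true) → D₁ * b2n (isRep u) ≤ ∑ (λ v → b2n (A u ∧ (A v ∧ q u v)))
        go′ (no h) = ≤-trans (≤-reflexive (trans (cong (D₁ *_) (b2n-false h)) (*-zeroʳ D₁))) z≤n
        go′ (yes h) = ≤-trans (≤-reflexive (trans (cong (D₁ *_) (b2n-true h)) (*-identityʳ D₁))) (deg≥ (true-does (any? (λ i → Cel.rep i ≟ u)) h))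
          where
          deg≥ : (∃ λ i → Cel.rep i ≡ u) → D₁ ≤ ∑ (λ v → b2n (A u ∧ (A v ∧ q u v)))
          deg≥ (i , refl) = ≤-trans (≤-reflexive (≡-sym (Cel.lenY i))) (card-list (λ v → A u ∧ (A v ∧ q u v)) (Cel.Y i) (Cel.uY i)
            λ v m → ∧-intro (∨-trueʳ {⌊ u ∈? Xs ⌋} h) (∧-intro (∨-trueˡ (does-true (v ∈? Xs) (proj₁ (Cel.nbY i v m)))) (∨-trueˡ (e-true i m))))
    dense : denseD t * card A < pairs q A
    dense = <-≤-trans (≤-<-trans (*-monoʳ-≤ (denseD t) cardA) strict) pairs≥
      where
      strict : denseD t * ((2 + D') * τ) < D₁ * τ
      strict = ≤-trans (≤-reflexive (cong suc (≡-sym (*-assoc (denseD t) (2 + D') τ))))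
        (≤-trans (+-monoˡ-≤ (denseD t * (2 + D') * τ) 1≤τ) (≤-reflexive (cong (_* τ) (≡-sym D₁≡))))

    c : Fin n → Maybe (Fin n)
    c v = label (v ∈? Xs) (any? (λ i → v ∈? Cel.Q i))
      where
      label : Dec (v ∈ Xs) → Dec (∃ λ i → v ∈ Cel.Q i) → Maybe (Fin n)
      label (yes _) _ = just v
      label (no _) (yes (i , _)) = just (Cel.rep i)
      label (no _) (no _) = nothing
    c-X : ∀ {v} → v ∈ Xs → c v ≡ just v
    c-X {v} v∈ with v ∈? Xs
    ... | yes _ = refl
    ... | no ∉ = contradiction v∈ ∉
    c-Q : ∀ i {v} → v ∈ Cel.Q i → c v ≡ just (Cel.rep i)
    c-Q i {v} v∈ with v ∈? Xs | any? (λ i → v ∈? Cel.Q i)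
    ... | yes x | _ = ⊥-elim (apart v (Cel.Q⊂U i v v∈) x)
    ... | no _ | yes (k , m) = cong (just ∘ Cel.rep) (disj k i v m v∈)
    ... | no _ | no ∄ = contradiction (i , v∈) ∄
    c-inv : ∀ {v a} → c v ≡ just a → (v ∈ Xs × v ≡ a) ⊎ ∃ λ i → v ∈ Cel.Q i × Cel.rep i ≡ a
    c-inv {v} h with v ∈? Xs | any? (λ i → v ∈? Cel.Q i)
    ... | yes x | _ = inj₁ (x , just-injective h)
    ... | no _ | yes (i , m) = inj₂ (i , m , just-injective h)
    con : ∀ a → Conn R (λ v → c v ≡ just a)
    con a u v cu cv with c-inv cu | c-inv cv
    ... | inj₁ (_ , refl) | inj₁ (_ , refl) = stop cu
    ... | inj₁ (x , refl) | inj₂ (i , _ , refl) = ⊥-elim (rep∉Xs i x)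
    ... | inj₂ (i , _ , refl) | inj₁ (x , refl) = ⊥-elim (rep∉Xs i x)
    ... | inj₂ (i , ui , ei) | inj₂ (k , vk , ek) with rep-inj i k (trans ei (≡-sym ek))
    ... | refl = wk-mono (λ z z∈ → trans (c-Q i z∈) (cong just ei)) (Cel.conQ i u v ui vk)
    cheap-class : ∀ a → Cheap κ (λ v → c v ≡ just a)
    cheap-class a with any? (λ i → Cel.rep i ≟ a)
    ... | yes (i , refl) = cheap-⊆ (λ v cv → case c-inv cv of λ
          { (inj₁ (x , refl)) → ⊥-elim (rep∉Xs i x)
          ; (inj₂ (k , vk , ek)) → subst (λ z → v ∈ Cel.Q z) (rep-inj k i ek) vk }) (Cel.cheap i)
    ... | no ∄ = cheap-≤ (s≤s z≤n) (cheap-⊆ (λ v cv → case c-inv cv of λ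
          { (inj₁ (_ , h)) → h ; (inj₂ (k , _ , ek)) → ⊥-elim (∄ (k , ek)) }) (cheap-one a))
    real : ∀ a b → q a b ≡ true → ∃ λ u → ∃ λ v → c u ≡ just a × c v ≡ just b × R u v
    real a b h = [ (λ p → half p) , (λ p → case half p of λ { (u , v , cu , cv , r) → v , u , cv , cu , sR r }) ]′ (∨-true {e a b} h)
      where
      half : ∀ {a b} → e a b ≡ true → ∃ λ u → ∃ λ v → c u ≡ just a × c v ≡ just b × R u v
      half {a} {b} p with true-e {a} {b} p
      ... | i , refl , m with Cel.nbY i b m
      ... | b∈ , x , x∈ , r = x , b , c-Q i x∈ , c-X b∈ , r

    cheap-model : CheapModel (denseSize t Λ * κ)
    cheap-model = finish (dense-wheel Q t′ 1≤t′ A Λ (≤-<-trans cardA big) dense)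
      where
      finish : (Σ (Model Q (wheelAdj t)) λ M → ∃ λ T → length T ≤ denseSize t Λ × (∀ v → v ∈ T → A v ≡ true) × (∀ v → InModel M v → v ∈ T)) →
        CheapModel (denseSize t Λ * κ)
      finish (M , T , T≤ , _ , inT) = case lift-cheap Q c con M T inT (λ i _ → cheap-class i) (λ i j _ _ → real i j) of λ
        { (M' , ch) → M' , cheap-≤ (*-monoˡ-≤ κ T≤) ch }

  protrusions : ∀ τ → 1 ≤ τ → length X₀ ≤ τ → ∀ Λ → (2 + D') * τ < 2 ^ Λ → D₁ ≡ suc (denseD t * (2 + D')) →
    DN (CheapModel (denseSize t Λ * κ) ⊎ Protrusions (τ * suc (D' + suc s)))
  protrusions τ 1≤τ X₀≤ Λ big D₁≡ = run τ >>= λ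
    { (inj₂ st) → return (inj₁ (Dense.cheap-model τ 1≤τ X₀≤ st Λ big D₁≡))
    ; (inj₁ (j , j≤ , stuck)) → from-stuck j stuck >>= λ P → return (inj₂ (record
        { Z = Protrusions.Z P ; X₀⊂Z = Protrusions.X₀⊂Z P ; small = Protrusions.small P
        ; Z≤ = ≤-trans (Protrusions.Z≤ P) (≤-trans (+-mono-≤ (+-mono-≤ X₀≤ (*-monoˡ-≤ D' j≤)) (*-monoˡ-≤ (suc s) j≤)) (≤-reflexive (arith τ D' (suc s)))) })) }
    where
    arith : ∀ τ D s → τ + τ * D + τ * s ≡ τ * suc (D + s)
    arith = solve 3 (λ τ D s → τ :+ τ :* D :+ τ :* s := τ :* (num 1 :+ (D :+ s))) refl

-- Contracting the components of G − Z

module Contract {n : ℕ} (G : Graph n) (t′ : ℕ) (1≤t′ : 1 ≤ t′) (X₀ : List (Fin n)) (hits : Wheels.Hits G t′ X₀)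
  (Z : List (Fin n)) (X₀⊂Z : ∀ v → v ∈ X₀ → v ∈ Z) (D₂ : ℕ)
  (small : ∀ v → v ∉ Z → ∃ λ H → length H ≤ D₂ ×
    (∀ x y → Comp (Adj G) (_∉ Z) v x → Adj G x y → ¬ Comp (Adj G) (_∉ Z) v y → y ∈ H))
  (d : ℕ) (d≡ : d ≡ denseD (suc t′)) where

  open Wheels G t′

  R : Rel {n}
  R = Adj G
  sR : Sym R
  sR = adj-sym G
  t : ℕ
  t = suc t′

  C : Fin n → Fin n → Set
  C = Comp R (_∉ Z)

  C-sym : ∀ {u v} → C u v → C v u
  C-sym = wk-rev sR

  Nbr : Fin n → Fin n → Set
  Nbr v z = z ∈ Z × ∃ λ x → C v x × R x z

  nbr-move : ∀ {u v z} → C u v → Nbr v z → Nbr u z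
  nbr-move w (z∈ , x , cx , r) = z∈ , x , w ⊙ cx , r

  nbr-list : ∀ v → v ∉ Z → ∃ λ H → length H ≤ D₂ × (∀ z → Nbr v z → z ∈ H)
  nbr-list v v∉ with small v v∉
  ... | H , le , cov = H , le , λ { z (z∈ , x , cx , r) → cov x z cx r (λ cz → wk-end cz z∈) }

  cheap-C : ∀ v → v ∉ Z → Cheap D₂ (C v)
  cheap-C v v∉ with small v v∉
  ... | H , le , cov = cheap-closed {X = X₀} hits le (λ x cx m → wk-end cx (X₀⊂Z x m)) cov

  -- Components of G − Z with distinct pairs of neighbours: contracting them realises
  -- the edges xᵢyᵢ simultaneously.
  record SDR (p : ℕ) : Set where
    field
      r x y : Fin p → Fin n
      r∉ : ∀ i → r i ∉ Z
      nx : ∀ i → Nbr (r i) (x i)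
      ny : ∀ i → Nbr (r i) (y i)
      x≢y : ∀ i → x i ≢ y i
      comps : ∀ i j → C (r i) (r j) → i ≡ j
      pairs≢ : ∀ i j → (x i ≡ x j × y i ≡ y j) ⊎ (x i ≡ y j × y i ≡ x j) → i ≡ j

    J : Fin n → Fin n → Set
    J a b = ∃ λ i → (x i ≡ a × y i ≡ b) ⊎ (x i ≡ b × y i ≡ a)

    J? : ∀ a b → Dec (J a b)
    J? a b = any? λ i → ((x i ≟ a) ×-dec (y i ≟ b)) ⊎-dec ((x i ≟ b) ×-dec (y i ≟ a))

  -- The neighbourhood in `Z` of every component not chosen becomes a clique once the chosen
  -- components have been turned into the edges `J`.
  Maximal : ∀ {p} → SDR p → Set
  Maximal S = ∀ v → v ∉ Z → (∃ λ i → C (SDR.r S i) v) ⊎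
    (∀ a b → Nbr v a → Nbr v b → a ≡ b ⊎ (R a b ⊎ SDR.J S a b))

  private
    extend : ∀ {p} (S : SDR p) v → v ∉ Z → ¬ (∃ λ i → C (SDR.r S i) v) → ∀ a b → Nbr v a → Nbr v b → a ≢ b → ¬ SDR.J S a b → SDR (suc p)
    extend S v v∉ new a b na nb a≢b ¬J = record
      { r = λ { zero → v ; (suc i) → r i } ; x = λ { zero → a ; (suc i) → x i } ; y = λ { zero → b ; (suc i) → y i }
      ; r∉ = λ { zero → v∉ ; (suc i) → r∉ i }
      ; nx = λ { zero → na ; (suc i) → nx i } ; ny = λ { zero → nb ; (suc i) → ny i }
      ; x≢y = λ { zero → a≢b ; (suc i) → x≢y i }
      ; comps = λ { zero zero _ → refl ; zero (suc j) c → ⊥-elim (new (j , C-sym c))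
                  ; (suc i) zero c → ⊥-elim (new (i , c)) ; (suc i) (suc j) c → cong suc (comps i j c) }
      ; pairs≢ = λ { zero zero _ → refl
                   ; zero (suc j) (inj₁ (p , q)) → ⊥-elim (¬J (j , inj₁ (≡-sym p , ≡-sym q)))
                   ; zero (suc j) (inj₂ (p , q)) → ⊥-elim (¬J (j , inj₂ (≡-sym q , ≡-sym p)))
                   ; (suc i) zero (inj₁ (p , q)) → ⊥-elim (¬J (i , inj₁ (p , q)))
                   ; (suc i) zero (inj₂ (p , q)) → ⊥-elim (¬J (i , inj₂ (p , q)))
                   ; (suc i) (suc j) h → cong suc (pairs≢ i j h) } }
      where open SDR S

    grow : ∀ {p} (S : SDR p) → DN (Maximal S ⊎ SDR (suc p))
    grow {p} S = em (SDR (suc p)) >>= λ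
      { (yes S') → return (inj₂ S')
      ; (no ∄) → dn-map inj₁ (dn-Fin λ v → dn-→ λ v∉ → em (∃ λ i → C (SDR.r S i) v) >>= λ
          { (yes h) → return (inj₁ h)
          ; (no new) → dn-map inj₂ (dn-Fin λ a → dn-Fin λ b → dn-→ λ na → dn-→ λ nb → return (decide ∄ v v∉ new a b na nb)) }) }
      where
      decide : ¬ SDR (suc p) → ∀ v → v ∉ Z → ¬ (∃ λ i → C (SDR.r S i) v) → ∀ a b → Nbr v a → Nbr v b → a ≡ b ⊎ (R a b ⊎ SDR.J S a b)
      decide ∄ v v∉ new a b na nb with a ≟ b | SDR.J? S a b
      ... | yes e | _ = inj₁ e
      ... | no _ | yes j = inj₂ (inj₂ j)
      ... | no ne | no ¬j = ⊥-elim (∄ (extend S v v∉ new a b na nb ne ¬j))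

  build-sdr : ∀ p → DN ((∃ λ p' → p' ≤ p × Σ (SDR p') Maximal) ⊎ SDR p)
  build-sdr zero = return (inj₂ (record { r = λ () ; x = λ () ; y = λ () ; r∉ = λ () ; nx = λ () ; ny = λ () ; x≢y = λ () ; comps = λ () ; pairs≢ = λ () }))
  build-sdr (suc p) = build-sdr p >>= λ
    { (inj₁ (p' , le , S)) → return (inj₁ (p' , m≤n⇒m≤1+n le , S))
    ; (inj₂ S) → grow S >>= λ { (inj₁ max) → return (inj₁ (p , n≤1+n p , S , max)) ; (inj₂ S') → return (inj₂ S') } }

  -- Every subset of a minimal dense set is sparse, so a small model in it needs few of the contracted components.
  minimal-dense : ∀ (q : BRel {n}) m A → card A ≤ m → d * card A < pairs q A →
    DN (∃ λ A' → (∀ v → A' v ≡ true → A v ≡ true) × d * card A' < pairs q A' × (∀ B → card B < card A' → (∀ v → B v ≡ true → A' v ≡ true) → pairs q B ≤ d * card B))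
  minimal-dense q m A le dn = em (∃ λ B → card B < card A × (∀ v → B v ≡ true → A v ≡ true) × d * card B < pairs q B) >>= λ
    { (no ∄) → return (A , (λ _ e → e) , dn , λ B lt sub → ≮⇒≥ (λ h → ∄ (B , lt , sub , h)))
    ; (yes (B , lt , sub , h)) → descend m le B lt sub h }
    where
    descend : ∀ m → card A ≤ m → ∀ B → card B < card A → (∀ v → B v ≡ true → A v ≡ true) → d * card B < pairs q B → _
    descend zero le B lt sub h = contradiction (≤-trans lt le) λ ()
    descend (suc m) le B lt sub h = minimal-dense q m B (≤-pred (≤-trans lt le)) h >>= λ
      { (A' , sub' , dn' , min) → return (A' , (λ v e → sub v (sub' v e)) , dn' , min) }

  -- More than `d` chosen pairs per vertex of `Z` make the graph `J` on `Z` dense, so `J` itself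
  -- contains a small wheel.
  module Crowded {p : ℕ} (S : SDR p) where
    open SDR S

    j : BRel {n}
    j a b = ⌊ J? a b ⌋

    J-flip : ∀ {a b} → J a b → J b a
    J-flip (i , inj₁ (p , q)) = i , inj₂ (p , q)
    J-flip (i , inj₂ (p , q)) = i , inj₁ (p , q)

    jGraph : Graph n
    jGraph = record { adj = j
      ; sym = λ a b → bool-ext (λ h → does-true (J? b a) (J-flip (true-does (J? a b) h))) (λ h → does-true (J? a b) (J-flip (true-does (J? b a) h)))
      ; irrefl = λ v → ¬true λ h → case true-does (J? v v) h of λ
          { (i , inj₁ (e , e')) → x≢y i (trans e (≡-sym e')) ; (i , inj₂ (e , e')) → x≢y i (trans e (≡-sym e')) } }

    within : (Fin n → Bool) → Fin p → Bool
    within T i = T (x i) ∧ T (y i)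

    -- Distinct indices give distinct ordered pairs by `pairs≢`; the count runs over the first
    -- coordinate.
    count-within : ∀ T → ∑ (λ i → b2n (within T i)) ≤ pairs j T
    count-within T = ≤-trans (≤-reflexive fibres) (∑-mono row)
      where
      F : Fin n → Fin p → ℕ
      F u i = b2n ⌊ x i ≟ u ⌋ * b2n (within T i)
      fibres : ∑ (λ i → b2n (within T i)) ≡ ∑ (λ u → ∑ (F u))
      fibres = trans (∑-cong {p} {λ i → b2n (within T i)} {λ i → ∑ λ u → F u i} (λ i → ≡-sym (∑-at (x i) (λ _ → b2n (within T i)))))
        (∑-swap (λ i u → F u i))
      row : ∀ u → ∑ (F u) ≤ ∑ (λ v → b2n (T u ∧ (T v ∧ j u v)))
      row u = ≤-trans (∑-mono pt) (≤-trans (≤-reflexive (≡-sym (trans (length-map y (listOf sel)) (length-listOf sel))))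
          (card-list (λ v → T u ∧ (T v ∧ j u v)) (map y (listOf sel)) (uniq (listOf sel) (unique-listOf sel) (listOf-∈ sel)) inside))
        where
        sel : Fin p → Bool
        sel i = ⌊ x i ≟ u ⌋ ∧ within T i
        pt : ∀ i → F u i ≤ b2n (sel i)
        pt i with ⌊ x i ≟ u ⌋
        ... | true = ≤-reflexive (+-identityʳ _)
        ... | false = z≤n
        sel-x : ∀ {i} → sel i ≡ true → x i ≡ u
        sel-x {i} h = true-does (x i ≟ u) (proj₁ (∧-true h))
        uniq : ∀ L → Unique L → (∀ i → i ∈ L → sel i ≡ true) → Unique (map y L)
        uniq [] _ _ = []
        uniq (i ∷ L) (i∉ ∷ uL) h = All-∉ (λ m → case ∈-map⁻ y m of λ { (k , k∈ , e) →
            ∉-All i∉ (subst (_∈ L) (≡-sym (pairs≢ i k (inj₁ (trans (sel-x (h i (here refl))) (≡-sym (sel-x (h k (there k∈)))) , e)))) k∈) })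
          ∷ uniq L uL (λ k k∈ → h k (there k∈))
        inside : ∀ v → v ∈ map y (listOf sel) → T u ∧ (T v ∧ j u v) ≡ true
        inside v m with ∈-map⁻ y m
        ... | i , i∈ , refl with listOf-∈ sel i i∈
        ... | h with ∧-true {T (x i)} (proj₂ (∧-true {⌊ x i ≟ u ⌋} h))
        ... | Tx , Ty = ∧-intro (trans (cong T (≡-sym (sel-x h))) Tx) (∧-intro Ty (does-true (J? u (y i)) (i , inj₁ (sel-x h , refl))))

    zset : Fin n → Bool
    zset v = ⌊ v ∈? Z ⌋

    card-zset : card zset ≤ length Z
    card-zset = card-cover zset Z (λ v → true-does (v ∈? Z))

    all-within : p ≤ pairs j zset
    all-within = ≤-trans (≤-reflexive (≡-sym ones)) (count-within zset)
      where
      ones : ∑ (λ i → b2n (within zset i)) ≡ p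
      ones = trans (∑-cong {p} {λ i → b2n (within zset i)} {λ _ → 1} (λ i → b2n-true (∧-intro (does-true (x i ∈? Z) (proj₁ (nx i))) (does-true (y i ∈? Z) (proj₁ (ny i)))))) (count p)
        where
        count : ∀ p → ∑ {p} (λ _ → 1) ≡ p
        count zero = refl
        count (suc p) = cong suc (count p)

    cost : ℕ
    cost = suc ((suc (suc d)) * D₂)

    module Lift (clist : Fin p → List (Fin n)) (to : ∀ i v → C (r i) v → v ∈ clist i) (from : ∀ i v → v ∈ clist i → C (r i) v)
      (A' : Fin n → Bool)
      (min : ∀ B → card B < card A' → (∀ v → B v ≡ true → A' v ≡ true) → pairs j B ≤ d * card B)
      (M : Model jGraph (wheelAdj t)) (T : List (Fin n)) (T⊂A' : ∀ v → v ∈ T → A' v ≡ true) (inT : ∀ v → InModel M v → v ∈ T) where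

      T′ : Fin n → Bool
      T′ v = ⌊ v ∈? T ⌋
      sel : Fin p → Bool
      sel = within T′
      sel-true : ∀ {i} → x i ∈ T → y i ∈ T → sel i ≡ true
      sel-true {i} a b = ∧-intro (does-true (x i ∈? T) a) (does-true (y i ∈? T) b)

      -- Minimality of `A'` covers proper subsets only, and `T` may be all of `A'`. One vertex is
      -- taken out, the sparse bound used for the rest, and its degree added back twice; hence
      -- `suc (suc d)`.
      few : length (listOf sel) ≤ length T * suc (suc d)
      few = ≤-trans (≤-reflexive (length-listOf sel)) (≤-trans (count-within T′) (≤-trans bound (*-monoˡ-≤ (suc (suc d)) (card-cover T′ T (λ v → true-does (v ∈? T))))))
        where
        v₀ : Fin n
        v₀ = proj₁ (nonempty M zero)
        v₀∈ : T′ v₀ ≡ true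
        v₀∈ = does-true (v₀ ∈? T) (inT v₀ (λ e → case trans (≡-sym (proj₂ (nonempty M zero))) e of λ ()))
        T⁻ = without T′ v₀
        sub : ∀ v → T′ v ≡ true → A' v ≡ true
        sub v e = T⊂A' v (true-does (v ∈? T) e)
        deg≤ : deg j T′ v₀ ≤ card T′
        deg≤ = card-mono (λ u → T′ u ∧ j v₀ u) T′ (λ u e → proj₁ (∧-true e))
        open ≤-Reasoning
        bound : pairs j T′ ≤ card T′ * suc (suc d)
        bound = begin
          pairs j T′                                 ≤⟨ pairs-without j T′ v₀ (Graph.sym jGraph) ⟩
          pairs j T⁻ + (deg j T′ v₀ + deg j T′ v₀)   ≤⟨ +-mono-≤ (min T⁻ (<-≤-trans (card-without T′ v₀ v₀∈) (card-mono T′ A' sub)) (λ v e → sub v (without-sub T′ v₀ v e))) (+-mono-≤ deg≤ deg≤) ⟩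
          d * card T⁻ + (card T′ + card T′)          ≤⟨ +-monoˡ-≤ _ (*-monoʳ-≤ d (card-mono T⁻ T′ (without-sub T′ v₀))) ⟩
          d * card T′ + (card T′ + card T′)          ≡⟨ arith d (card T′) ⟩
          card T′ * suc (suc d) ∎
          where
          arith : ∀ d c → d * c + (c + c) ≡ c * suc (suc d)
          arith = solve 2 (λ d c → d :* c :+ (c :+ c) := c :* (num 2 :+ d)) refl

      Owner : Fin n → Set
      Owner v = ∃ λ i → sel i ≡ true × v ∈ clist i

      owner? : ∀ v → Dec (Owner v)
      owner? v = any? (λ i → tr? (sel i) ×-dec (v ∈? clist i))

      label : ∀ v → Dec (v ∈ Z) → Dec (Owner v) → Maybe (Fin n)
      label v (yes _) _ = just v
      label v (no _) (yes (i , _)) = just (x i)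
      label v (no _) (no _) = nothing

      c : Fin n → Maybe (Fin n)
      c v = label v (v ∈? Z) (owner? v)

      c-Z : ∀ {v} → v ∈ Z → c v ≡ just v
      c-Z {v} v∈ with v ∈? Z
      ... | yes _ = refl
      ... | no ∉ = contradiction v∈ ∉
      same : ∀ i k v → v ∈ clist i → v ∈ clist k → i ≡ k
      same i k v a b = comps i k (from i v a ⊙ C-sym (from k v b))
      c-C : ∀ i {v} → sel i ≡ true → v ∈ clist i → c v ≡ just (x i)
      c-C i {v} s m = at (v ∈? Z) (owner? v)
        where
        at : ∀ a b → label v a b ≡ just (x i)
        at (yes z) _ = ⊥-elim (wk-end (from i v m) z)
        at (no _) (yes (k , _ , m')) = cong (just ∘ x) (same k i v m' m)
        at (no _) (no ∄) = contradiction (i , s , m) ∄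
      c-inv : ∀ {v a} → c v ≡ just a → (v ∈ Z × v ≡ a) ⊎ ∃ λ i → sel i ≡ true × v ∈ clist i × x i ≡ a
      c-inv {v} {a} = at (v ∈? Z) (owner? v)
        where
        at : ∀ p q → label v p q ≡ just a → (v ∈ Z × v ≡ a) ⊎ ∃ λ i → sel i ≡ true × v ∈ clist i × x i ≡ a
        at (yes z) _ h = inj₁ (z , just-injective h)
        at (no _) (yes (i , s , m)) h = inj₂ (i , s , m , just-injective h)

      to-centre : ∀ a u → c u ≡ just a → Wk R (λ v → c v ≡ just a) u a
      to-centre a u cu with c-inv cu
      ... | inj₁ (_ , refl) = stop cu
      ... | inj₂ (i , s , m , refl) with nx i
      ... | z∈ , w , cw , e = wk-snoc (wk-mono (λ z cz → c-C i s (to i z cz)) inside) e (c-Z z∈)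
        where
        inside : Wk R (C (r i)) u w
        inside = comp-conn sR u w (from i u m) cw
      conn : ∀ a → Conn R (λ v → c v ≡ just a)
      conn a = conn-root sR a (to-centre a)

      real : ∀ a b → InModel M a → InModel M b → Adj jGraph a b → ∃ λ u → ∃ λ v → c u ≡ just a × c v ≡ just b × R u v
      real a b ma mb h with true-does (J? a b) h
      ... | i , inj₁ (refl , refl) with ny i
      ... | z∈ , w , cw , e = w , y i , c-C i (sel-true (inT _ ma) (inT _ mb)) (to i w cw) , c-Z z∈ , e
      real a b ma mb h | i , inj₂ (refl , refl) with ny i
      ... | z∈ , w , cw , e = y i , w , c-Z z∈ , c-C i (sel-true (inT _ mb) (inT _ ma)) (to i w cw) , sR e

      lifted : Σ WM λ M' → ∀ v → InModel M' v → ∃ λ i → c v ≡ just i × InModel M i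
      lifted = lift (wheel-nbr {n} t (s≤s z≤n)) G jGraph c conn M real

      cheap-model : CheapModel (length T * cost)
      cheap-model = proj₁ lifted , cheap-≤ le (cheap-⊆ where-is
          (cheap-∪ (cheap-family (λ a v → v ≡ a) T (λ a _ → cheap-one a))
                   (cheap-family C (map r (listOf sel)) (λ u m → case ∈-map⁻ r m of λ { (i , _ , refl) → cheap-C (r i) (r∉ i) }))))
        where
        where-is : ∀ v → InModel (proj₁ lifted) v → (∃ λ a → a ∈ T × v ≡ a) ⊎ (∃ λ u → u ∈ map r (listOf sel) × C u v)
        where-is v m with proj₂ lifted v m
        ... | a , cv , ma with c-inv cv
        ... | inj₁ (_ , e) = inj₁ (a , inT a ma , e)
        ... | inj₂ (i , s , m' , _) = inj₂ (r i , ∈-map⁺ r (∈-listOf sel i s) , from i v m')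
        le : length T * 1 + length (map r (listOf sel)) * D₂ ≤ length T * cost
        le = ≤-trans (+-monoʳ-≤ (length T * 1) (*-monoˡ-≤ D₂ (≤-trans (≤-reflexive (length-map r (listOf sel))) few))) (≤-reflexive (arith (length T) (suc (suc d)) D₂))
          where
          arith : ∀ a b c → a * 1 + a * b * c ≡ a * suc (b * c)
          arith = solve 3 (λ a b c → a :* num 1 :+ a :* b :* c := a :* (num 1 :+ b :* c)) refl

    crowded : ∀ Λ → length Z < 2 ^ Λ → d * length Z < p → DN (CheapModel (denseSize t Λ * cost))
    crowded Λ Z< lt = minimal-dense j (card zset) zset ≤-refl (≤-<-trans (*-monoʳ-≤ d card-zset) (<-≤-trans lt all-within)) >>= λ
      { (A' , A'⊂ , dn , min) → dn-Fin (λ i → enum (C (r i))) >>= λ cl →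
        return (finish A' min cl (dense-wheel jGraph t′ 1≤t′ A' Λ (≤-<-trans (≤-trans (card-mono A' zset A'⊂) card-zset) Z<) (subst (λ z → z * card A' < pairs j A') d≡ dn))) }
      where
      finish : ∀ A' → (∀ B → card B < card A' → (∀ v → B v ≡ true → A' v ≡ true) → pairs j B ≤ d * card B) →
        (∀ i → ∃ λ L → Unique L × (∀ v → C (r i) v → v ∈ L) × (∀ v → v ∈ L → C (r i) v)) →
        (Σ (Model jGraph (wheelAdj t)) λ M → ∃ λ T → length T ≤ denseSize t Λ × (∀ v → v ∈ T → A' v ≡ true) × (∀ v → InModel M v → v ∈ T)) →
        CheapModel (denseSize t Λ * cost)
      finish A' min cl (M , T , T≤ , T⊂A' , inT) = proj₁ cm , cheap-≤ (*-monoˡ-≤ cost T≤) (proj₂ cm)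
        where
        cm = Lift.cheap-model (λ i → proj₁ (cl i)) (λ i → proj₁ (proj₂ (proj₂ (cl i)))) (λ i → proj₂ (proj₂ (proj₂ (cl i)))) A' min M T T⊂A' inT

Packing : ∀ {n} → Graph n → ℕ → ℕ → Set
Packing G t k = Σ (Fin k → Model G (wheelAdj t)) PairwiseDisjoint

in-model? : ∀ {n h} {G : Graph n} {adjH : Fin h → Fin h → Bool} (M : Model G adjH) v → Dec (InModel M v)
in-model? M v with assign M v
... | just _ = yes λ ()
... | nothing = no λ h → h refl

-- The contracted minor and the labels of its pieces

module Contracted {n : ℕ} (G : Graph n) (t′ : ℕ) (1≤t′ : 1 ≤ t′) (X₀ : List (Fin n)) (hits : Wheels.Hits G t′ X₀)
  (Z : List (Fin n)) (X₀⊂Z : ∀ v → v ∈ X₀ → v ∈ Z) (D₂ : ℕ) (1≤D₂ : 1 ≤ D₂)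
  (small : ∀ v → v ∉ Z → ∃ λ H → length H ≤ D₂ ×
    (∀ x y → Comp (Adj G) (_∉ Z) v x → Adj G x y → ¬ Comp (Adj G) (_∉ Z) v y → y ∈ H))
  (d : ℕ) (d≡ : d ≡ denseD (suc t′)) (1≤d : 1 ≤ d) where

  open Wheels G t′
  open Contract G t′ 1≤t′ X₀ hits Z X₀⊂Z D₂ small d d≡

  model-meets : ∀ M → ∃ λ v → InModel M v × v ∈ X₀
  model-meets M with any? (λ v → in-model? M v ×-dec (v ∈? X₀))
  ... | yes h = h
  ... | no ∄ = ⊥-elim (hits M λ v m v∈ → ∄ (v , m , v∈))

  module Atoms {p : ℕ} (S : SDR p) (max : Maximal S)
    (clist nl : Fin p → List (Fin n))
    (to : ∀ i v → C (SDR.r S i) v → v ∈ clist i) (from : ∀ i v → v ∈ clist i → C (SDR.r S i) v)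
    (nl-u : ∀ i → Unique (nl i)) (nl-to : ∀ i z → Nbr (SDR.r S i) z → z ∈ nl i) (nl-from : ∀ i z → z ∈ nl i → Nbr (SDR.r S i) z) where
    open SDR S

    nl≤ : ∀ i → length (nl i) ≤ D₂
    nl≤ i with nbr-list (r i) (r∉ i)
    ... | H , le , cov = ≤-trans (unique-⊆ (nl-u i) (λ z m → cov z (nl-from i z m))) le

    zset : Fin n → Bool
    zset v = ⌊ v ∈? Z ⌋
    g : BRel {n}
    g u v = ⌊ any? (λ i → (r i ≟ u) ×-dec (v ∈? nl i)) ⌋
    I-adj : BRel {n}
    I-adj u v = (zset u ∧ (zset v ∧ adj G u v)) ∨ (g u v ∨ g v u)

    data Link (u v : Fin n) : Set where
      direct : u ∈ Z → v ∈ Z → R u v → Link u v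
      down   : ∀ i → r i ≡ u → v ∈ nl i → Link u v
      up     : ∀ i → r i ≡ v → u ∈ nl i → Link u v

    link-flip : ∀ {u v} → Link u v → Link v u
    link-flip (direct a b e) = direct b a (sR e)
    link-flip (down i e m) = up i e m
    link-flip (up i e m) = down i e m

    I-link : ∀ {u v} → I-adj u v ≡ true → Link u v
    I-link {u} {v} h with ∨-true {zset u ∧ (zset v ∧ adj G u v)} h
    ... | inj₁ q with ∧-true {zset u} q
    ... | a , q' with ∧-true {zset v} q'
    ... | b , e = direct (true-does (u ∈? Z) a) (true-does (v ∈? Z) b) e
    I-link {u} {v} h | inj₂ q with ∨-true {g u v} q
    ... | inj₁ a with true-does (any? (λ i → (r i ≟ u) ×-dec (v ∈? nl i))) a
    ... | i , e , m = down i e m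
    I-link {u} {v} h | inj₂ q | inj₂ b with true-does (any? (λ i → (r i ≟ v) ×-dec (u ∈? nl i))) b
    ... | i , e , m = up i e m

    link-I : ∀ {u v} → Link u v → I-adj u v ≡ true
    link-I {u} {v} (direct a b e) = ∨-trueˡ (∧-intro (does-true (u ∈? Z) a) (∧-intro (does-true (v ∈? Z) b) e))
    link-I {u} {v} (down i e m) = ∨-trueʳ {zset u ∧ (zset v ∧ adj G u v)} (∨-trueˡ (does-true (any? (λ i → (r i ≟ u) ×-dec (v ∈? nl i))) (i , e , m)))
    link-I {u} {v} (up i e m) = ∨-trueʳ {zset u ∧ (zset v ∧ adj G u v)} (∨-trueʳ {g u v} (does-true (any? (λ i → (r i ≟ v) ×-dec (u ∈? nl i))) (i , e , m)))

    -- The minor of `G` in which each chosen component is contracted to its representative and all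
    -- other components of `G` - `Z` are deleted; the remaining vertices of the index type are
    -- isolated.
    I : Graph n
    I = record { adj = I-adj
      ; sym = λ u v → bool-ext (link-I ∘ link-flip ∘ I-link {u} {v}) (link-I ∘ link-flip ∘ I-link {v} {u})
      ; irrefl = λ v → ¬true λ h → no-loop (I-link {v} {v} h) }
      where
      no-loop : ∀ {v} → ¬ Link v v
      no-loop (direct _ _ e) = adj-irr G e refl
      no-loop (down i refl m) = r∉ i (proj₁ (nl-from i _ m))
      no-loop (up i refl m) = r∉ i (proj₁ (nl-from i _ m))

    A : Fin n → Bool
    A u = zset u ∨ ⌊ any? (λ i → r i ≟ u) ⌋
    A-Z : ∀ {u} → u ∈ Z → A u ≡ true
    A-Z {u} m = ∨-trueˡ (does-true (u ∈? Z) m)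
    A-r : ∀ i → A (r i) ≡ true
    A-r i = ∨-trueʳ {zset (r i)} (does-true (any? (λ k → r k ≟ r i)) (i , refl))
    A-edge : ∀ u v → I-adj u v ≡ true → A u ≡ true
    A-edge u v h with I-link {u} {v} h
    ... | direct a _ _ = A-Z a
    ... | down i refl _ = A-r i
    ... | up i _ m = A-Z (proj₁ (nl-from i u m))
    cardA : card A ≤ length Z + p
    cardA = ≤-trans (card-cover A (Z ++ map r (allFin p)) cov)
      (≤-reflexive (trans (length-++ Z) (cong (length Z +_) (trans (length-map r (allFin p)) (length-allFin p)))))
      where
      cov : ∀ v → A v ≡ true → v ∈ Z ++ map r (allFin p)
      cov v h with ∨-true {zset v} h
      ... | inj₁ q = ∈-++⁺ˡ (true-does (v ∈? Z) q)
      ... | inj₂ q with true-does (any? (λ i → r i ≟ v)) q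
      ... | i , refl = ∈-++⁺ʳ Z (∈-map⁺ r (∈-allFin i))

    Owner : Fin n → Set
    Owner v = ∃ λ i → v ∈ clist i
    owner? : ∀ v → Dec (Owner v)
    owner? v = any? (λ i → v ∈? clist i)
    label : ∀ v → Dec (v ∈ Z) → Dec (Owner v) → Maybe (Fin n)
    label v (yes _) _ = just v
    label v (no _) (yes (i , _)) = just (r i)
    label v (no _) (no _) = nothing
    c : Fin n → Maybe (Fin n)
    c v = label v (v ∈? Z) (owner? v)
    c-Z : ∀ {v} → v ∈ Z → c v ≡ just v
    c-Z {v} v∈ with v ∈? Z
    ... | yes _ = refl
    ... | no ∉ = contradiction v∈ ∉
    same : ∀ i k v → v ∈ clist i → v ∈ clist k → i ≡ k
    same i k v a b = comps i k (from i v a ⊙ C-sym (from k v b))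
    r-inj : ∀ i k → r i ≡ r k → i ≡ k
    r-inj i k e = comps i k (subst (C (r i)) e (stop (r∉ i)))
    c-C : ∀ i {v} → v ∈ clist i → c v ≡ just (r i)
    c-C i {v} m = at (v ∈? Z) (owner? v)
      where
      at : ∀ a b → label v a b ≡ just (r i)
      at (yes z) _ = ⊥-elim (wk-end (from i v m) z)
      at (no _) (yes (k , m')) = cong (just ∘ r) (same k i v m' m)
      at (no _) (no ∄) = contradiction (i , m) ∄
    c-inv : ∀ {v a} → c v ≡ just a → (v ∈ Z × v ≡ a) ⊎ ∃ λ i → v ∈ clist i × r i ≡ a
    c-inv {v} {a} = at (v ∈? Z) (owner? v)
      where
      at : ∀ p q → label v p q ≡ just a → (v ∈ Z × v ≡ a) ⊎ ∃ λ i → v ∈ clist i × r i ≡ a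
      at (yes z) _ h = inj₁ (z , just-injective h)
      at (no _) (yes (i , m)) h = inj₂ (i , m , just-injective h)
    conn : ∀ a → Conn R (λ v → c v ≡ just a)
    conn a u v cu cv with c-inv cu | c-inv cv
    ... | inj₁ (_ , refl) | inj₁ (_ , refl) = stop cu
    ... | inj₁ (z , refl) | inj₂ (i , _ , refl) = ⊥-elim (r∉ i z)
    ... | inj₂ (i , _ , refl) | inj₁ (z , refl) = ⊥-elim (r∉ i z)
    ... | inj₂ (i , ui , ei) | inj₂ (k , vk , ek) with r-inj i k (trans ei (≡-sym ek))
    ... | refl = wk-mono (λ w cw → trans (c-C i (to i w cw)) (cong just ei)) (comp-conn sR u v (from i u ui) (from i v vk))
    cheap-class : ∀ a → Cheap D₂ (λ v → c v ≡ just a)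
    cheap-class a with any? (λ i → r i ≟ a)
    ... | yes (i , refl) = cheap-⊆ (λ v cv → case c-inv cv of λ
          { (inj₁ (z , refl)) → ⊥-elim (r∉ i z)
          ; (inj₂ (k , vk , ek)) → from i v (subst (λ w → v ∈ clist w) (r-inj k i ek) vk) }) (cheap-C (r i) (r∉ i))
    ... | no ∄ = cheap-≤ 1≤D₂ (cheap-⊆ (λ v cv → case c-inv cv of λ
          { (inj₁ (_ , h)) → h ; (inj₂ (k , _ , ek)) → ⊥-elim (∄ (k , ek)) }) (cheap-one a))
    real : ∀ {a b} → Link a b → ∃ λ u → ∃ λ v → c u ≡ just a × c v ≡ just b × R u v
    real (direct p q e) = _ , _ , c-Z p , c-Z q , e
    real (down i refl m) with nl-from i _ m
    ... | z∈ , w , cw , e = w , _ , c-C i (to i w cw) , c-Z z∈ , e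
    real (up i refl m) with nl-from i _ m
    ... | z∈ , w , cw , e = _ , w , c-Z z∈ , c-C i (to i w cw) , sR e

    small-cheap : ∀ {k} → SmallModel I t k → CheapModel (k * D₂)
    small-cheap (M , T , T≤ , inT) = proj₁ cm , cheap-≤ (*-monoˡ-≤ D₂ T≤) (proj₂ cm)
      where
      cm = lift-cheap I c conn M T inT (λ i _ → cheap-class i) (λ a b _ _ h → real (I-link {a} {b} h))

    module Labels {K : ℕ} (ℓ : Fin n → Fin n) (W : List (Fin n))
      (classes : ∀ a → ∃ λ L → length L ≤ K × (∀ u → A u ≡ true → u ∉ W → ℓ u ≡ a → u ∈ L))
      (edge : ∀ u v → Adj I u v → u ∉ W → v ∉ W → ℓ u ≡ ℓ v) where

      at : ∀ u → Dec (∃ λ i → r i ≡ u) → List (Fin n)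
      at u (yes (i , _)) = nl i
      at u (no _) = []
      around : Fin n → List (Fin n)
      around u = at u (any? (λ i → r i ≟ u))
      around-r : ∀ i z → z ∈ nl i → z ∈ around (r i)
      around-r i z m with any? (λ k → r k ≟ r i)
      ... | yes (k , e') = subst (λ w → z ∈ nl w) (≡-sym (r-inj k i e')) m
      ... | no ∄ = contradiction (i , refl) ∄
      around≤ : ∀ u → length (around u) ≤ D₂
      around≤ u with any? (λ i → r i ≟ u)
      ... | yes (i , _) = nl≤ i
      ... | no _ = z≤n
      -- A deleted representative stands for a component that may be too large to delete; its at
      -- most `D₂` neighbours are deleted in its place.
      W⁺ : List (Fin n)
      W⁺ = W ++ concatMap around W
      W⁺≤ : length W⁺ ≤ length W * suc D₂
      W⁺≤ = ≤-trans (≤-reflexive (length-++ W)) (≤-trans (+-monoʳ-≤ (length W) (length-concatMap around W (λ u _ → around≤ u)))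
        (≤-reflexive (≡-sym (*-suc (length W) D₂))))
      ∉W : ∀ {v} → v ∉ W⁺ → v ∉ W
      ∉W h m = h (∈-++⁺ˡ m)

      through : ∀ i {a b} → Nbr (r i) a → Nbr (r i) b → a ∉ W⁺ → b ∉ W⁺ → ℓ a ≡ ℓ b
      through i {a} {b} na nb a∉ b∉ = trans (edge a (r i) (link-I (up i refl (nl-to i a na))) (∉W a∉) ri∉)
          (edge (r i) b (link-I (down i refl (nl-to i b nb))) ri∉ (∉W b∉))
        where
        ri∉ : r i ∉ W
        ri∉ m = a∉ (∈-++⁺ʳ W (∈-concatMap⁺ around m (around-r i a (nl-to i a na))))

      -- For a chosen component the two neighbours are linked through its representative. For any
      -- other, maximality makes them equal, adjacent, or the pair of a chosen component, so the
      -- components missing from `I` cannot join different labels.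
      consistent : ∀ {v a b} → v ∉ Z → Nbr v a → Nbr v b → a ∉ W⁺ → b ∉ W⁺ → ℓ a ≡ ℓ b
      consistent {v} {a} {b} v∉ na nb a∉ b∉ with max v v∉
      ... | inj₁ (i , w) = through i (nbr-move w na) (nbr-move w nb) a∉ b∉
      ... | inj₂ h with h a b na nb
      ... | inj₁ refl = refl
      ... | inj₂ (inj₁ e) = edge a b (link-I (direct (proj₁ na) (proj₁ nb) e)) (∉W a∉) (∉W b∉)
      ... | inj₂ (inj₂ (i , inj₁ (refl , refl))) = through i (nx i) (ny i) a∉ b∉
      ... | inj₂ (inj₂ (i , inj₂ (refl , refl))) = through i (ny i) (nx i) a∉ b∉

      -- A vertex outside `Z` takes the label of the surviving neighbours of its component in `Z`,
      -- on which `consistent` makes them agree.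
      Labelled : Fin n → Fin n → Set
      Labelled a v = (v ∈ Z → ℓ v ≡ a) × (v ∉ Z → ∃ λ z → Nbr v z × z ∉ W⁺ × ℓ z ≡ a)

      carry : ∀ {a u v} → u ∉ W⁺ → v ∉ W⁺ → R u v → Labelled a u → Labelled a v
      carry {a} {u} {v} u∉ v∉ e (inZ , outZ) = case u ∈? Z of λ
        { (yes uz) → (λ vz → trans (edge v u (link-I (direct vz uz (sR e))) (∉W v∉) (∉W u∉)) (inZ uz)) ,
                     (λ ¬vz → u , (uz , v , stop ¬vz , sR e) , u∉ , inZ uz)
        ; (no ¬uz) → case outZ ¬uz of λ { (z , nz , z∉ , ez) →
            (λ vz → trans (consistent ¬uz (vz , u , stop ¬uz , e) nz v∉ z∉) ez) ,
            (λ ¬vz → z , nbr-move (go ¬vz (sR e) (stop ¬uz)) nz , z∉ , ez) } }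

      spread-label : ∀ {a P u v} → Wk R P u v → (∀ x → P x → x ∉ W⁺) → Labelled a u → Labelled a v
      spread-label (stop _) _ l = l
      spread-label (go p e w) h l = spread-label w h (carry (h _ p) (h _ (wk-start w)) e l)

      Has : Fin n → Set
      Has a = Σ WM λ M → Avoids M W⁺ × ∃ λ z → InModel M z × z ∈ Z × ℓ z ≡ a

      label-all : ∀ {a} ((M , _) : Has a) → ∀ v → InModel M v → Labelled a v
      label-all (M , av , z , mz , z∈ , e) v mv = spread-label (model-conn M z v mz mv) av ((λ _ → e) , λ z∉ → contradiction z∈ z∉)

      labels-agree : ∀ {a b v} → v ∉ W⁺ → Labelled a v → Labelled b v → a ≡ b
      labels-agree {v = v} v∉ (inZ , outZ) (inZ' , outZ') = case v ∈? Z of λ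
        { (yes vz) → trans (≡-sym (inZ vz)) (inZ' vz)
        ; (no ¬vz) → case outZ ¬vz of λ { (z , nz , z∉ , ez) → case outZ' ¬vz of λ { (z' , nz' , z'∉ , ez') →
            trans (≡-sym ez) (trans (consistent ¬vz nz nz' z∉ z'∉) ez') } } }

      -- The label spreads along a model that avoids `W⁺`, so models with different labels are
      -- disjoint and fewer than `k` labels carry models. Every model meets `X₀`, hence `Z`, so
      -- deleting the classes of these labels destroys what `W⁺` leaves.
      hitting : ∀ k → ¬ Packing G t k → DN (∃ λ Y → Hits Y × length Y ≤ length W * suc D₂ + k * K)
      hitting k ¬pack = pick Has k >>= λ
        { (inj₁ (L , uL , refl , sat)) → ⊥-elim (¬pack ((λ i → proj₁ (sat _ (∈-lookup i))) , λ i j i≢j v mi mj →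
            i≢j (unique-lookup uL i j (labels-agree (proj₁ (proj₂ (sat _ (∈-lookup i))) v mi) (label-all (sat _ (∈-lookup i)) v mi) (label-all (sat _ (∈-lookup j)) v mj)))))
        ; (inj₂ (L , L< , cov)) → return (W⁺ ++ concatMap class L , hit L cov ,
            ≤-trans (≤-reflexive (length-++ W⁺)) (+-mono-≤ W⁺≤ (≤-trans (length-concatMap class L (λ a _ → proj₁ (proj₂ (classes a)))) (*-monoˡ-≤ K (<⇒≤ L<))))) }
        where
        class : Fin n → List (Fin n)
        class a = proj₁ (classes a)
        hit : ∀ L → (∀ a → Has a → a ∈ L) → Hits (W⁺ ++ concatMap class L)
        hit L cov M av with model-meets M
        ... | z , mz , z∈X = av z mz (∈-++⁺ʳ W⁺ (∈-concatMap⁺ class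
                (cov (ℓ z) (M , (λ v m q → av v m (∈-++⁺ˡ q)) , z , mz , X₀⊂Z z z∈X , refl))
                (proj₂ (proj₂ (classes (ℓ z))) z (A-Z (X₀⊂Z z z∈X)) (λ q → av z mz (∈-++⁺ˡ (∈-++⁺ˡ q))) refl)))

  finale : ∀ {p} (S : SDR p) → Maximal S → ∀ Λ → length Z + p < 2 ^ Λ → ∀ e k → ¬ Packing G t k →
    DN (CheapModel (denseSize t Λ * fragK d e * D₂) ⊎
        ∃ λ w → ∃ λ Y → Hits Y × e * w ≤ length Z + p × length Y ≤ w * suc D₂ + k * fragK d e)
  finale S max Λ fits e k ¬pack =
    dn-Fin (λ i → enum (C (SDR.r S i))) >>= λ cl →
    dn-Fin (λ i → enum (Nbr (SDR.r S i))) >>= λ nb →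
    let module At = Atoms S max (λ i → proj₁ (cl i)) (λ i → proj₁ (nb i))
          (λ i → proj₁ (proj₂ (proj₂ (cl i)))) (λ i → proj₂ (proj₂ (proj₂ (cl i))))
          (λ i → proj₁ (proj₂ (nb i))) (λ i → proj₁ (proj₂ (proj₂ (nb i)))) (λ i → proj₂ (proj₂ (proj₂ (nb i)))) in
    [ (λ sm → return (inj₁ (At.small-cheap sm)))
    , (λ { (ℓ , W , eW , classes , edge) → dn-map (λ { (Y , hit , le) → inj₂ (length W , Y , hit , ≤-trans eW At.cardA , le) })
           (At.Labels.hitting ℓ W classes edge k ¬pack) }) ]′
    (fragment t′ d e 1≤t′ d≡ 1≤d At.I At.A At.A-edge Λ (≤-<-trans At.cardA fits))

-- `C` bounds the size of `Z` per vertex of the hitting set, and `E` that of `Z` with the chosen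
-- components added. `e` is set so that the deleted vertices with their neighbours make up at most
-- half of the hitting set. `c` sums the costs per vertex of the three possible small models.
module Constants (s d D₁ : ℕ) where
  h D' D₂ κ C E e K cost c : ℕ
  h = suc (s + s)
  D' = h + h
  D₂ = D' + D₁
  κ = suc (D₁ * (suc (suc s) * suc D₂))
  C = suc (D' + suc s)
  E = (2 + d) * C
  e = E * (2 * suc D₂)
  K = fragK d e
  cost = suc (suc (suc d) * D₂)
  c = κ + (cost + K * D₂)

module _ (t′ : ℕ) (1≤t′ : 1 ≤ t′) (s : ℕ) (s≡ : s ≡ havenOrder (suc t′)) (d : ℕ) (d≡ : d ≡ denseD (suc t′)) (1≤d : 1 ≤ d)
  (D₁ : ℕ) (D₁≡ : D₁ ≡ suc (denseD (suc t′) * (2 + (suc (s + s) + suc (s + s))))) where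

  open Constants s d D₁

  cheap-model : ∀ {n} (G : Graph n) (X₀ : List (Fin n)) → Wheels.Hits G t′ X₀ →
    (∀ Y → Wheels.Hits G t′ Y → length X₀ ≤ length Y) →
    ∀ k → 2 * (k * K) < length X₀ → ¬ Packing G (suc t′) k →
    ∀ Λ → (E + (2 + D')) * length X₀ < 2 ^ Λ → DN (Wheels.CheapModel G t′ (denseSize (suc t′) Λ * c))
  cheap-model {n} G X₀ hits min k large ¬pack Λ fits =
    PR.protrusions τ 1≤τ ≤-refl Λ (≤-<-trans (*-monoˡ-≤ τ (m≤n+m (2 + D') E)) fits) D₁≡ >>= λ
      { (inj₁ (M , ch)) → return (M , cheap-≤ (*-monoʳ-≤ DS (m≤m+n κ _)) ch)
      ; (inj₂ P) → second P }
    where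
    open Wheels G t′
    τ = length X₀
    DS = denseSize (suc t′) Λ
    1≤τ : 1 ≤ τ
    1≤τ = ≤-trans (s≤s z≤n) large
    1≤D₁ : 1 ≤ D₁
    1≤D₁ = ≤-trans (s≤s z≤n) (≤-reflexive (≡-sym D₁≡))
    module PR = PeelResult G t′ 1≤t′ X₀ hits s s≡ D₁
    second : PR.Protrusions (τ * suc (D' + suc s)) → DN (CheapModel (DS * c))
    second P = Ct.build-sdr p₀ >>= λ
      { (inj₂ S) → Ct.Crowded.crowded S Λ (≤-<-trans (≤-trans (m≤m+n (length Z) p₀) Z+p) E<) (s≤s (*-monoʳ-≤ d Z≤′)) >>= λ
          { (M , ch) → return (M , cheap-≤ (*-monoʳ-≤ DS (≤-trans (m≤m+n cost (K * D₂)) (m≤n+m _ κ))) ch) }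
      ; (inj₁ (p , p≤ , S , max)) → Cd.finale S max Λ (≤-<-trans (≤-trans (+-monoʳ-≤ (length Z) p≤) Z+p) E<) e k ¬pack >>= λ
          { (inj₁ (M , ch)) → return (M , cheap-≤ (≤-trans (≤-reflexive (*-assoc DS K D₂)) (*-monoʳ-≤ DS (≤-trans (m≤n+m (K * D₂) cost) (m≤n+m _ κ)))) ch)
          ; (inj₂ (w , Y , hitY , ew , Y≤)) → ⊥-elim (too-small w (≤-trans ew (≤-trans (+-monoʳ-≤ (length Z) p≤) Z+p)) (≤-trans (min Y hitY) Y≤)) } }
      where
      open PR.Protrusions P
      1≤D₂ : 1 ≤ D₂
      1≤D₂ = ≤-trans 1≤D₁ (m≤n+m D₁ D')
      module Ct = Contract G t′ 1≤t′ X₀ hits Z X₀⊂Z D₂ small d d≡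
      module Cd = Contracted G t′ 1≤t′ X₀ hits Z X₀⊂Z D₂ 1≤D₂ small d d≡ 1≤d
      N = τ * C
      Z≤′ : length Z ≤ N
      Z≤′ = Z≤
      1≤N : 1 ≤ N
      1≤N = *-mono-≤ 1≤τ (s≤s z≤n)
      p₀ = suc (d * N)
      E< : E * τ < 2 ^ Λ
      E< = ≤-<-trans (*-monoˡ-≤ τ (m≤m+n E (2 + D'))) fits
      Z+p : length Z + p₀ ≤ E * τ
      Z+p = ≤-trans (+-mono-≤ Z≤′ (+-monoˡ-≤ (d * N) 1≤N)) (≤-reflexive (arith d τ C))
        where
        arith : ∀ d τ C → τ * C + (τ * C + d * (τ * C)) ≡ (2 + d) * C * τ
        arith = solve 3 (λ d τ C → τ :* C :+ (τ :* C :+ d :* (τ :* C)) := (num 2 :+ d) :* C :* τ) refl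
      -- The new hitting set has at most τ/2 + kK vertices, fewer than τ by `large`, which
      -- contradicts minimality.
      too-small : ∀ w → e * w ≤ E * τ → τ ≤ w * suc D₂ + k * K → ⊥
      too-small w ew τ≤ = <⇒≱ large (+-cancelˡ-≤ τ _ _ (begin
        τ + τ                         ≤⟨ +-mono-≤ τ≤ τ≤ ⟩
        (w * suc D₂ + k * K) + (w * suc D₂ + k * K) ≡⟨ arith₁ w (suc D₂) (k * K) ⟩
        2 * suc D₂ * w + 2 * (k * K)  ≤⟨ +-monoˡ-≤ (2 * (k * K)) w≤ ⟩
        τ + 2 * (k * K) ∎))
        where
        open ≤-Reasoning
        1≤E : 1 ≤ E
        1≤E = *-mono-≤ {1} {2 + d} {1} {C} (s≤s z≤n) (s≤s z≤n)
        cancel : ∀ E a b → 1 ≤ E → E * a ≤ E * b → a ≤ b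
        cancel E a b 1≤E = *-cancelˡ-≤ E {{>-nonZero 1≤E}}
        w≤ : 2 * suc D₂ * w ≤ τ
        w≤ = cancel E (2 * suc D₂ * w) τ 1≤E (≤-trans (≤-reflexive (≡-sym (*-assoc E (2 * suc D₂) w))) ew)
        arith₁ : ∀ w D x → (w * D + x) + (w * D + x) ≡ 2 * D * w + 2 * x
        arith₁ = solve 3 (λ w D x → (w :* D :+ x) :+ (w :* D :+ x) := num 2 :* D :* w :+ num 2 :* x) refl

-- Packing greedily

module _ {n : ℕ} where

  alive : List (Fin n) → Fin n → Bool
  alive L v = not ⌊ v ∈? L ⌋

  alive-true : ∀ {L v} → v ∉ L → alive L v ≡ true
  alive-true {L} {v} v∉ with v ∈? L
  ... | yes p = contradiction p v∉
  ... | no _ = refl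

  true-alive : ∀ {L v} → alive L v ≡ true → v ∉ L
  true-alive {L} {v} h with v ∈? L
  ... | no p = p

  -- The vertex type is kept and deleted vertices become isolated, so that models and hitting sets
  -- of both graphs live on the same vertices.
  delete : List (Fin n) → Graph n → Graph n
  delete L G = record
    { adj = λ u v → adj G u v ∧ (alive L u ∧ alive L v)
    ; sym = λ u v → bool-ext (flip u v) (flip v u)
    ; irrefl = λ v → ¬true (λ h → true≢false (proj₁ (∧-true {adj G v v} h)) (irrefl G v)) }
    where
    flip : ∀ u v → adj G u v ∧ (alive L u ∧ alive L v) ≡ true → adj G v u ∧ (alive L v ∧ alive L u) ≡ true
    flip u v h with ∧-true {adj G u v} h
    ... | e , ab with ∧-true {alive L u} ab
    ... | a , b = ∧-intro (adj-sym G e) (∧-intro b a)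

  delete-adj : ∀ L G {u v} → Adj (delete L G) u v → Adj G u v × u ∉ L × v ∉ L
  delete-adj L G {u} {v} h with ∧-true {adj G u v} h
  ... | e , ab with ∧-true {alive L u} ab
  ... | a , b = e , true-alive a , true-alive b

  adj-delete : ∀ L G {u v} → Adj G u v → u ∉ L → v ∉ L → Adj (delete L G) u v
  adj-delete L G e a b = ∧-intro e (∧-intro (alive-true a) (alive-true b))

module _ {n : ℕ} (t′ : ℕ) (L : List (Fin n)) (G : Graph n) where

  private
    t = suc t′
    G⁻ = delete L G
    in-model : ∀ {G : Graph n} (M : Model G (wheelAdj t)) {v x} → assign M v ≡ just x → InModel M v
    in-model M p q with () ← trans (≡-sym p) q

  undelete : Model G⁻ (wheelAdj t) → Model G (wheelAdj t)
  undelete M = record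
    { assign = assign M ; nonempty = nonempty M
    ; connected = λ x u v p q → to-walk (wk-map (λ e → proj₁ (delete-adj L G e)) (λ _ → id) (from-walk (connected M x u v p q)))
    ; edges = λ x y e → case edges M x y e of λ { (u , v , p , q , r) → u , v , p , q , proj₁ (delete-adj L G r) } }

  -- Every vertex of a model has an incident edge: towards the rest of its branch set or, if the
  -- walk there is trivial, towards a neighbouring branch set. Deleted vertices have none.
  undelete-avoids : (M : Model G⁻ (wheelAdj t)) → ∀ v → InModel M v → v ∉ L
  undelete-avoids M v m = at (assign M v) refl
    where
    at : ∀ (a : Maybe (Fin (suc t))) → assign M v ≡ a → v ∉ L
    at nothing e = contradiction e m
    at (just x) e with wheel-nbr {n} t (s≤s z≤n) x
    ... | y , xy with edges M x y xy
    ... | u , w , pu , pw , r with from-walk (connected M x v u e pu)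
    ... | stop _ = proj₁ (proj₂ (delete-adj L G r))
    ... | go _ r' _ = proj₁ (proj₂ (delete-adj L G r'))

  redelete : (M : Model G (wheelAdj t)) → (∀ v → InModel M v → v ∉ L) → Model G⁻ (wheelAdj t)
  redelete M av = record
    { assign = assign M ; nonempty = nonempty M
    ; connected = λ x u v p q → to-walk (walk (from-walk (connected M x u v p q)))
    ; edges = λ x y e → case edges M x y e of λ { (u , v , p , q , r) → u , v , p , q , adj-delete L G r (av u (in-model M p)) (av v (in-model M q)) } }
    where
    walk : ∀ {x u v} → Wk (Adj G) (λ w → assign M w ≡ just x) u v → Wk (Adj G⁻) (λ w → assign M w ≡ just x) u v
    walk (stop p) = stop p
    walk (go p r w) = go p (adj-delete L G r (av _ (in-model M p)) (av _ (in-model M (wk-start w)))) (walk w)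

  packing-undelete : ∀ {k} → Packing G⁻ t k → Packing G t k
  packing-undelete (Ms , dis) = (λ i → undelete (Ms i)) , dis

  open Wheels using (Hits)

  -- A model that avoids `Y ++ X` misses `L`, so it survives the deletion of `L` and would be hit by
  -- `Y`. With `X` of cost size, deleting a whole cheap model lowers the hitting number only by its
  -- cost.
  hits-undelete : ∀ {X Y} → (∀ M → Wheels.Avoids G t′ M (Y ++ X) → ∀ v → InModel M v → v ∉ L) →
    Hits G⁻ t′ Y → Hits G t′ (Y ++ X)
  hits-undelete {X} {Y} cl hit M av = hit (redelete M (cl M av)) (λ v m → av v m ∘ ∈-++⁺ˡ)

  hits-delete : ∀ {X} → Hits G t′ X → Hits G⁻ t′ X
  hits-delete hit M av = hit (undelete M) av

module _ (t′ : ℕ) where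
  open Wheels

  minimal-hitting : ∀ {n} (G : Graph n) m X → length X ≤ m → Hits G t′ X →
    DN (∃ λ X' → Hits G t′ X' × length X' ≤ length X × (∀ Y → Hits G t′ Y → length X' ≤ length Y))
  minimal-hitting G m X le hit = em (∃ λ Y → Hits G t′ Y × length Y < length X) >>= λ
    { (no ∄) → return (X , hit , ≤-refl , λ Y hY → ≮⇒≥ (λ lt → ∄ (Y , hY , lt)))
    ; (yes (Y , hY , lt)) → descend m le Y hY lt }
    where
    descend : ∀ m → length X ≤ m → ∀ Y → Hits G t′ Y → length Y < length X → _
    descend zero le Y hY lt = contradiction (≤-trans lt le) λ ()
    descend (suc m) le Y hY lt = minimal-hitting G m Y (≤-pred (≤-trans lt le)) hY >>= λ
      { (X' , h , l , mn) → return (X' , h , ≤-trans l (<⇒≤ lt) , mn) }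

  -- Deleting one vertex lowers the hitting number by at most one, so some induced subgraph attains the value T.
  reduce : ∀ {n} T (rest : List (Fin n)) (G : Graph n) → (∀ (M : WM G t′) v → InModel M v → v ∈ rest) →
    (∀ Y → Hits G t′ Y → T ≤ length Y) → ∀ {k} → ¬ Packing G (suc t′) k →
    DN (∃ λ (G' : Graph n) → (∀ Y → Hits G' t′ Y → T ≤ length Y) × ¬ Packing G' (suc t′) k × ∃ λ X → Hits G' t′ X × length X ≤ T)
  reduce T [] G inR lb ¬p = return (G , lb , ¬p , [] , (λ M av → case model-some G t′ M of λ { (v , m) → case inR M v m of λ () }) , z≤n)
  reduce {n} T (v ∷ rest) G inR lb {k} ¬p = em (∃ λ X → Hits G⁻ t′ X × length X < T) >>= λ
    { (yes (X , hX , lt)) → return (G , lb , ¬p , X ++ v ∷ [] ,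
        hits-undelete t′ (v ∷ []) G {v ∷ []} {X} (λ M av u mu → λ { (here refl) → av u mu (∈-++⁺ʳ X (here refl)) }) hX ,
        ≤-trans (≤-reflexive (trans (length-++ X) (+-comm (length X) 1))) lt)
    ; (no ∄) → reduce T rest G⁻ inR' (λ Y hY → ≮⇒≥ (λ lt → ∄ (Y , hY , lt))) (¬p ∘ packing-undelete t′ (v ∷ []) G) }
    where
    G⁻ = delete (v ∷ []) G
    inR' : ∀ (M : WM G⁻ t′) u → InModel M u → u ∈ rest
    inR' M u mu with inR (undelete t′ (v ∷ []) G M) u mu
    ... | here refl = ⊥-elim (undelete-avoids t′ (v ∷ []) G M u mu (here refl))
    ... | there m = m

  -- Cheap models are available while the hitting number is at least `b`. The upper bound `T`
  -- survives all deletions, so one cost `Λ′` serves every round.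
  module Greedy (Λ′ b T k : ℕ)
    (find-cheap : ∀ {n} (G : Graph n) X → Hits G t′ X → (∀ Y → Hits G t′ Y → length X ≤ length Y) →
      b ≤ length X → length X ≤ T → ¬ Packing G (suc t′) k → DN (CheapModel G t′ Λ′)) where

    greedy : ∀ {n} j (G : Graph n) → ¬ Packing G (suc t′) k → (∀ Y → Hits G t′ Y → b + j * Λ′ ≤ length Y) →
      ∀ X → Hits G t′ X → length X ≤ T → DN (Packing G (suc t′) j)
    greedy zero G _ _ _ _ _ = return ((λ ()) , λ ())
    greedy {n} (suc j) G ¬p lb X hX X≤ = do
      X' , hX' , X'≤ , mn ← minimal-hitting G (length X) X ≤-refl hX
      M , H , H≤ , ch ← find-cheap G X' hX' mn (≤-trans (m≤m+n b _) (lb X' hX')) (≤-trans X'≤ X≤) ¬p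
      let VM = listOf (λ v → ⌊ in-model? M v ⌋)
          inVM : ∀ v → InModel M v → v ∈ VM
          inVM v m = ∈-listOf (λ v → ⌊ in-model? M v ⌋) v (does-true (in-model? M v) m)
          VM-in : ∀ v → v ∈ VM → InModel M v
          VM-in v m = true-does (in-model? M v) (listOf-∈ (λ v → ⌊ in-model? M v ⌋) v m)
      Ms , dis ← greedy j (delete VM G) (¬p ∘ packing-undelete t′ VM G)
        (λ Y hY → +-cancelʳ-≤ Λ′ _ _ (≤-trans (≤-reflexive (arith b (j * Λ′) Λ′))
          (≤-trans (lb (Y ++ H) (hits-undelete t′ VM G {H} {Y} (λ M' av v m q → ch M' (λ u mu → av u mu ∘ ∈-++⁺ʳ Y) v m (VM-in v q)) hY))
            (≤-trans (≤-reflexive (length-++ Y)) (+-monoʳ-≤ (length Y) H≤)))))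
        X (hits-delete t′ VM G hX) X≤
      return (join M VM inVM Ms dis)
      where
      arith : ∀ b x y → b + x + y ≡ b + (y + x)
      arith b x y = trans (+-assoc b x y) (cong (b +_) (+-comm x y))
      join : (M : WM G t′) (VM : List (Fin n)) → (∀ v → InModel M v → v ∈ VM) →
        (Ms : Fin j → Model (delete VM G) (wheelAdj (suc t′))) → PairwiseDisjoint Ms → Packing G (suc t′) (suc j)
      join M VM inVM Ms dis = all , apart
        where
        all : Fin (suc j) → WM G t′
        all zero = M
        all (suc i) = undelete t′ VM G (Ms i)
        apart : PairwiseDisjoint all
        apart zero zero ne _ _ _ = ne refl
        apart zero (suc i) _ v m m' = undelete-avoids t′ VM G (Ms i) v m' (inVM v m)
        apart (suc i) zero _ v m m' = undelete-avoids t′ VM G (Ms i) v m (inVM v m')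
        apart (suc i) (suc l) ne v m m' = dis i l (λ e → ne (cong suc e)) v m m'

    -- If every hitting set were larger than `T`, an induced subgraph would have hitting number
    -- exactly `T`, enough to pay for `k` rounds at `Λ′` each; the models found would be the
    -- excluded packing.
    hitting-bound : b + k * Λ′ ≤ T → ∀ {n} (G : Graph n) → ¬ Packing G (suc t′) k → DN (∃ λ X → Hits G t′ X × length X ≤ T)
    hitting-bound fits {n} G ¬p = em (∃ λ X → Hits G t′ X × length X ≤ T) >>= λ
      { (yes h) → return h
      ; (no ∄) → reduce T (allFin n) G (λ M v _ → ∈-allFin v) (λ Y hY → <⇒≤ (≰⇒> (λ le → ∄ (Y , hY , le)))) ¬p >>= λ
          { (G' , lb , ¬p' , X , hX , X≤) → greedy k G' ¬p' (λ Y hY → ≤-trans fits (lb Y hY)) X hX X≤ >>= λ pk → ⊥-elim (¬p' pk) } }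

-- Decidability

Searchable : Set → Set₁
Searchable X = ∀ {P : X → Set} → (∀ x → Dec (P x)) → Dec (∃ P)

search-Maybe : ∀ {X} → Searchable X → Searchable (Maybe X)
search-Maybe s {P} P? with P? nothing | s (λ x → P? (just x))
... | yes p | _ = yes (nothing , p)
... | no _ | yes (x , p) = yes (just x , p)
... | no q | no ∄ = no λ { (nothing , p) → q p ; (just x , p) → ∄ (x , p) }

search-Vec : ∀ {X} → Searchable X → ∀ k → Searchable (Vec X k)
search-Vec s zero {P} P? = dec-map (λ p → [] , p) (λ { ([] , p) → p }) (P? [])
search-Vec s (suc k) {P} P? = dec-map (λ { (x , v , p) → x ∷ v , p }) (λ { (x ∷ v , p) → x , v , p })
  (s (λ x → search-Vec s k (λ v → P? (x ∷ v))))

-- By `last-exit` a walk to another vertex need not return to its start, so the start can be struck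
-- from the list, which makes the search finite.
reach? : ∀ {n} {R : Rel {n}} → (∀ u v → Dec (R u v)) → ∀ m (L : List (Fin n)) → length L ≤ m → ∀ u w → Dec (Wk R (_∈ L) u w)
reach? R? m L le u w with u ∈? L
... | no u∉ = no (λ wk → u∉ (wk-start wk))
reach? R? zero (_ ∷ _) () u w | yes _
reach? {R = R} R? (suc m) L le u w | yes u∈ with u ≟ w
... | yes refl = yes (stop u∈)
... | no u≢w = dec-map join split
        (any? λ v → R? u v ×-dec reach? R? m (remove u L) (≤-pred (≤-trans (length-remove u∈) le)) v w)
  where
  join : (∃ λ v → R u v × Wk R (_∈ remove u L) v w) → Wk R (_∈ L) u w
  join (v , r , wk) = go u∈ r (wk-mono (λ x m → proj₁ (∈-remove⁻ {L = L} m)) wk)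
  split : Wk R (_∈ L) u w → ∃ λ v → R u v × Wk R (_∈ remove u L) v w
  split wk with last-exit wk (λ e → u≢w (≡-sym e))
  ... | v , r , wk' = v , r , wk-mono (λ { x (x∈ , ne) → ∈-remove⁺ x∈ ne }) wk'

walk? : ∀ {n} (G : Graph n) {P : Fin n → Set} → (∀ v → Dec (P v)) → ∀ u w → Dec (Walk G P u w)
walk? {n} G P? u w = dec-map
  (λ wk → to-walk (wk-mono (λ x m → proj₂ (∈-filter⁻ P? {xs = allFin n} m)) wk))
  (λ wk → wk-mono (λ x p → ∈-filter⁺ P? (∈-allFin x) p) (from-walk wk))
  (reach? (λ u v → tr? (adj G u v)) (length (filter P? (allFin n))) (filter P? (allFin n)) ≤-refl u w)

module _ {n h : ℕ} (G : Graph n) (adjH : Fin h → Fin h → Bool) where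

  Assignment : Set
  Assignment = Vec (Maybe (Fin h)) n

  IsModel : (Fin n → Maybe (Fin h)) → Set
  IsModel f = (∀ x → ∃ λ v → f v ≡ just x) ×
    (∀ x u v → f u ≡ just x → f v ≡ just x → Walk G (λ w → f w ≡ just x) u v) ×
    (∀ x y → adjH x y ≡ true → ∃ λ u → ∃ λ v → f u ≡ just x × f v ≡ just y × adj G u v ≡ true)

  is-model? : ∀ f → Dec (IsModel f)
  is-model? f = all? (λ x → any? (λ v → same? (f v) (just x))) ×-dec
    (all? (λ x → all? λ u → all? λ v → same? (f u) (just x) →-dec (same? (f v) (just x) →-dec walk? G (λ w → same? (f w) (just x)) u v)) ×-dec
     all? (λ x → all? λ y → tr? (adjH x y) →-dec any? (λ u → any? λ v → same? (f u) (just x) ×-dec (same? (f v) (just y) ×-dec tr? (adj G u v)))))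
    where
    same? : (a b : Maybe (Fin h)) → Dec (a ≡ b)
    same? = Maybe.≡-dec _≟_

  to-model : ∀ f → IsModel f → Model G adjH
  to-model f (a , b , c) = record { assign = f ; nonempty = a ; connected = b ; edges = c }

  -- Vectors can be searched exhaustively by recursion on their length. Only pointwise agreement
  -- with the assignment is used, so every condition is transported along `code-lookup`.
  code : Model G adjH → Assignment
  code M = tabulate (assign M)

  code-lookup : ∀ M v → lookupᵛ (code M) v ≡ assign M v
  code-lookup M v = lookup∘tabulate (assign M) v

  code-model : ∀ M → IsModel (lookupᵛ (code M))
  code-model M = (λ x → case nonempty M x of λ { (v , p) → v , trans (code-lookup M v) p }) ,
    (λ x u v p q → to-walk (wk-mono (λ w e → trans (code-lookup M w) e)
      (from-walk (connected M x u v (trans (≡-sym (code-lookup M u)) p) (trans (≡-sym (code-lookup M v)) q))))) ,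
    λ x y e → case edges M x y e of λ { (u , v , p , q , r) → u , v , trans (code-lookup M u) p , trans (code-lookup M v) q , r }

  code-in : ∀ M {v} → lookupᵛ (code M) v ≢ nothing → InModel M v
  code-in M {v} ne e = ne (trans (code-lookup M v) e)

  search-assignment : Searchable Assignment
  search-assignment = search-Vec (search-Maybe any?) n

  some? : (a : Maybe (Fin h)) → Dec (a ≢ nothing)
  some? (just _) = yes λ ()
  some? nothing = no λ p → p refl

  avoiding? : ∀ X → Dec (HasModelAvoiding G adjH X)
  avoiding? X = dec-map
    (λ { (a , im , av) → to-model (lookupᵛ a) im , av })
    (λ { (M , av) → code M , code-model M , λ v m → av v (code-in M m) })
    (search-assignment λ a → is-model? (lookupᵛ a) ×-dec all? (λ v → some? (lookupᵛ a v) →-dec ¬? (v ∈ˢ? X)))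

  packing? : ∀ k → Dec (Σ (Fin k → Model G adjH) PairwiseDisjoint)
  packing? k = dec-map
    (λ { (as , im , dis) → (λ i → to-model (lookupᵛ (lookupᵛ as i)) (im i)) , dis })
    (λ { (Ms , dis) → codes Ms ,
         (λ i → subst (λ a → IsModel (lookupᵛ a)) (≡-sym (lookup∘tabulate (code ∘ Ms) i)) (code-model (Ms i))) ,
         (λ i j ne v m m' → dis i j ne v (uncode Ms i m) (uncode Ms j m')) })
    (search-Vec search-assignment k λ as → all? (λ i → is-model? (lookupᵛ (lookupᵛ as i))) ×-dec
      all? (λ i → all? λ j → ¬? (i ≟ j) →-dec all? (λ v → some? (lookupᵛ (lookupᵛ as i) v) →-dec ¬? (some? (lookupᵛ (lookupᵛ as j) v)))))
    where
    codes : (Fin k → Model G adjH) → Vec Assignment k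
    codes Ms = tabulate (λ i → code (Ms i))
    uncode : ∀ Ms i {v} → lookupᵛ (lookupᵛ (codes Ms) i) v ≢ nothing → InModel (Ms i) v
    uncode Ms i {v} ne = code-in (Ms i) (subst (λ a → lookupᵛ a v ≢ nothing) (lookup∘tabulate (code ∘ Ms) i) ne)

subset : ∀ {n} → (Fin n → Bool) → Subset n
subset A = tabulate A

∈-subset : ∀ {n} (A : Fin n → Bool) v → A v ≡ true → v FS.∈ subset A
∈-subset A v e = lookup⇒[]= v (subset A) (trans (lookup∘tabulate A v) e)

size-subset : ∀ {n} (A : Fin n → Bool) → ∣ subset A ∣ ≡ card A
size-subset {zero} A = refl
size-subset {suc n} A with A zero
... | true = cong suc (size-subset (A ∘ suc))
... | false = size-subset (A ∘ suc)

-- The choice of constants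

n<2^n : ∀ n → suc n ≤ 2 ^ n
n<2^n zero = ≤-refl
n<2^n (suc n) = +-mono-≤ (≤-trans (s≤s z≤n) (n<2^n n)) (≤-trans (n<2^n n) (≤-reflexive (≡-sym (+-identityʳ (2 ^ n)))))

log-upper : ∀ k → k ≤ 2 ^ suc ⌊log₂ k ⌋
log-upper k with k ≤? 2 ^ suc ⌊log₂ k ⌋
... | yes p = p
... | no ¬p = contradiction (⌊log₂⌋-mono-≤ (<⇒≤ (≰⇒> ¬p))) (<⇒≱ (≤-reflexive (≡-sym (⌊log₂[2^n]⌋≡n (suc ⌊log₂ k ⌋)))))

log-lower : ∀ k → 2 ≤ k → 1 ≤ ⌊log₂ k ⌋
log-lower k 2≤k = ≤-trans (≤-reflexive (≡-sym (⌊log₂[2^n]⌋≡n 1))) (⌊log₂⌋-mono-≤ 2≤k)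

-- The hitting bound `T` = 2^a k log k puts `a` into its own logarithm `rank`, and the total cost of
-- `k` models is linear in `rank`. After division by k log k the requirement reads u + g a ≤ 2^a,
-- where `u` gathers the terms free of `a`.
module Numbers (t K E c : ℕ) where
  g u m a : ℕ
  g = c * (2 + (t + t))
  u = suc (K + K) + g * (E + 5)
  m = u + (g + g)
  a = m + m

  rank : ℕ → ℕ
  rank L = E + (a + (2 + (L + L)))

  private
    open ≤-Reasoning

    -- With `a` = 2m and m = u + 2g the left side is at most m + m², and (m + 1)² ≤ 4^m.
    power : u + g * a ≤ 2 ^ a
    power = begin
      u + g * (m + m)       ≡⟨ cong (u +_) (arith g m) ⟩
      u + (g + g) * m       ≤⟨ +-mono-≤ (m≤m+n u (g + g)) (*-monoˡ-≤ m (m≤n+m (g + g) u)) ⟩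
      m + m * m             ≤⟨ m≤n+m _ (suc m) ⟩
      suc m + (m + m * m)   ≡⟨ cong (suc m +_) (≡-sym (*-suc m m)) ⟩
      suc m * suc m         ≤⟨ *-mono-≤ (n<2^n m) (n<2^n m) ⟩
      2 ^ m * 2 ^ m         ≡⟨ ≡-sym (^-distribˡ-+-* 2 m m) ⟩
      2 ^ a ∎
      where
      arith : ∀ g m → g * (m + m) ≡ (g + g) * m
      arith = solve 2 (λ g m → g :* (m :+ m) := (g :+ g) :* m) refl

  module _ (k : ℕ) (2≤k : 2 ≤ k) where
    private
      L = ⌊log₂ k ⌋
      1≤L : 1 ≤ L
      1≤L = log-lower k 2≤k
      1≤k : 1 ≤ k
      1≤k = <⇒≤ 2≤k

    T : ℕ
    T = 2 ^ a * k * L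

    -- Each factor is below a power of two, with k ≤ 2^(L+1) and L ≤ 2^L; the last 1 in the exponent
    -- makes the inequality strict.
    fits-rank : E * T < 2 ^ rank L
    fits-rank = begin-strict
      E * (2 ^ a * k * L)                     ≤⟨ *-mono-≤ (<⇒≤ (n<2^n E)) (*-mono-≤ (*-monoʳ-≤ (2 ^ a) (log-upper k)) (<⇒≤ (n<2^n L))) ⟩
      2 ^ E * (2 ^ a * 2 ^ suc L * 2 ^ L)     ≡⟨ cong (2 ^ E *_) (trans (cong (_* 2 ^ L) (≡-sym (^-distribˡ-+-* 2 a (suc L)))) (≡-sym (^-distribˡ-+-* 2 (a + suc L) L))) ⟩
      2 ^ E * 2 ^ (a + suc L + L)             ≡⟨ ≡-sym (^-distribˡ-+-* 2 E (a + suc L + L)) ⟩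
      2 ^ (E + (a + suc L + L))               <⟨ ^-monoʳ-< 2 (s≤s (s≤s z≤n)) (+-monoʳ-< E (≤-reflexive (arith a L))) ⟩
      2 ^ rank L ∎
      where
      arith : ∀ a L → suc (a + suc L + L) ≡ a + (2 + (L + L))
      arith = solve 2 (λ a L → num 1 :+ (a :+ (num 1 :+ L) :+ L) := a :+ (num 2 :+ (L :+ L))) refl

    size-bound : suc (2 * (k * K)) + k * (denseSize t (rank L) * c) ≤ T
    size-bound = begin
      suc (2 * (k * K)) + k * (denseSize t Λ * c)        ≤⟨ +-mono-≤ first (*-monoʳ-≤ k (*-monoˡ-≤ c dense≤)) ⟩
      suc (K + K) * (k * L) + k * ((2 + (t + t)) * ((E + (a + 5)) * L) * c) ≡⟨ arith₁ (suc (K + K)) k L (2 + (t + t)) E a c ⟩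
      (suc (K + K) + c * (2 + (t + t)) * (E + 5) + c * (2 + (t + t)) * a) * (k * L) ≤⟨ *-monoˡ-≤ (k * L) power ⟩
      2 ^ a * (k * L)                                    ≡⟨ ≡-sym (*-assoc (2 ^ a) k L) ⟩
      2 ^ a * k * L ∎
      where
      Λ = rank L
      arith₁ : ∀ x k L q E a c → x * (k * L) + k * (q * ((E + (a + 5)) * L) * c) ≡ (x + c * q * (E + 5) + c * q * a) * (k * L)
      arith₁ = solve 7 (λ x k L q E a c → x :* (k :* L) :+ k :* (q :* ((E :+ (a :+ num 5)) :* L) :* c) := (x :+ c :* q :* (E :+ num 5) :+ c :* q :* a) :* (k :* L)) refl
      first : suc (2 * (k * K)) ≤ suc (K + K) * (k * L)
      first = begin
        suc (2 * (k * K))       ≤⟨ +-monoˡ-≤ (2 * (k * K)) 1≤k ⟩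
        k + 2 * (k * K)         ≡⟨ arith k K ⟩
        suc (K + K) * (k * 1)   ≤⟨ *-monoʳ-≤ (suc (K + K)) (*-monoʳ-≤ k 1≤L) ⟩
        suc (K + K) * (k * L) ∎
        where
        arith : ∀ k K → k + 2 * (k * K) ≡ suc (K + K) * (k * 1)
        arith = solve 2 (λ k K → k :+ num 2 :* (k :* K) := (num 1 :+ (K :+ K)) :* (k :* num 1)) refl
      suc-rank : suc Λ ≤ (E + (a + 5)) * L
      suc-rank = begin
        suc (E + (a + (2 + (L + L))))  ≡⟨ arith E a L ⟩
        (E + (a + 3)) * 1 + 2 * L      ≤⟨ +-monoˡ-≤ (2 * L) (*-monoʳ-≤ (E + (a + 3)) 1≤L) ⟩
        (E + (a + 3)) * L + 2 * L      ≡⟨ arith′ E a L ⟩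
        (E + (a + 5)) * L ∎
        where
        arith : ∀ E a L → suc (E + (a + (2 + (L + L)))) ≡ (E + (a + 3)) * 1 + 2 * L
        arith = solve 3 (λ E a L → num 1 :+ (E :+ (a :+ (num 2 :+ (L :+ L)))) := (E :+ (a :+ num 3)) :* num 1 :+ num 2 :* L) refl
        arith′ : ∀ E a L → (E + (a + 3)) * L + 2 * L ≡ (E + (a + 5)) * L
        arith′ = solve 3 (λ E a L → (E :+ (a :+ num 3)) :* L :+ num 2 :* L := (E :+ (a :+ num 5)) :* L) refl
      dense≤ : denseSize t Λ ≤ (2 + (t + t)) * ((E + (a + 5)) * L)
      dense≤ = begin
        denseSize t Λ                                ≡⟨ denseSize-def t Λ ⟩
        suc (suc (t + t)) + (Λ + Λ) + t * Λ           ≤⟨ m≤m+n _ (t * Λ) ⟩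
        suc (suc (t + t)) + (Λ + Λ) + t * Λ + t * Λ   ≡⟨ arith t Λ ⟩
        (2 + (t + t)) * suc Λ                        ≤⟨ *-monoʳ-≤ (2 + (t + t)) suc-rank ⟩
        (2 + (t + t)) * ((E + (a + 5)) * L) ∎
        where
        arith : ∀ t Λ → suc (suc (t + t)) + (Λ + Λ) + t * Λ + t * Λ ≡ (2 + (t + t)) * suc Λ
        arith = solve 2 (λ t Λ → num 2 :+ (t :+ t) :+ (Λ :+ Λ) :+ t :* Λ :+ t :* Λ := (num 2 :+ (t :+ t)) :* (num 1 :+ Λ)) refl

module _ (t′ K E c : ℕ)
  (cm : ∀ {n} (G : Graph n) (X₀ : List (Fin n)) → Wheels.Hits G t′ X₀ →
    (∀ Y → Wheels.Hits G t′ Y → length X₀ ≤ length Y) →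
    ∀ k → 2 * (k * K) < length X₀ → ¬ Packing G (suc t′) k →
    ∀ Λ → E * length X₀ < 2 ^ Λ → DN (Wheels.CheapModel G t′ (denseSize (suc t′) Λ * c))) where

  open Numbers (suc t′) K E c

  bounded-hitting : ∀ k → 1 ≤ k → ∀ {n} (G : Graph n) → ¬ Packing G (suc t′) k →
    DN (∃ λ X → Wheels.Hits G t′ X × length X ≤ 2 ^ a * k * ⌊log₂ k ⌋)
  -- The logarithm of 1 is 0, so here the empty set must hit; it does, since a single model would
  -- already be a packing.
  bounded-hitting (suc zero) _ G ¬p = return ([] , (λ M _ → ¬p ((λ _ → M) , λ { zero zero ne → contradiction refl ne })) , z≤n)
  bounded-hitting (suc (suc k)) _ = Greedy.hitting-bound t′ (denseSize (suc t′) (rank L) * c) (suc (2 * (k₂ * K))) (T k₂ 2≤k) k₂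
      (λ G X hX mn large X≤ ¬p → cm G X hX mn k₂ large ¬p (rank L) (≤-<-trans (*-monoʳ-≤ E X≤) (fits-rank k₂ 2≤k)))
      (size-bound k₂ 2≤k)
    where
    k₂ = suc (suc k)
    L = ⌊log₂ k₂ ⌋
    2≤k : 2 ≤ k₂
    2≤k = s≤s (s≤s z≤n)

  erdős-pósa : Σ ℕ λ c → (k : ℕ) → 1 ≤ k → (n : ℕ) → (G : Graph n) →
    (Σ (Fin k → Model G (wheelAdj (suc t′))) PairwiseDisjoint)
    ⊎ (Σ (Subset n) λ X → (∣ X ∣ ≤ c * k * ⌊log₂ k ⌋) × ¬ HasModelAvoiding G (wheelAdj (suc t′)) X)
  erdős-pósa = 2 ^ a , λ k 1≤k n G → decide k 1≤k n G (packing? G (wheelAdj (suc t′)) k)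
    where
    decide : ∀ k → 1 ≤ k → ∀ n (G : Graph n) → Dec (Packing G (suc t′) k) → Packing G (suc t′) k
      ⊎ (Σ (Subset n) λ X → (∣ X ∣ ≤ 2 ^ a * k * ⌊log₂ k ⌋) × ¬ HasModelAvoiding G (wheelAdj (suc t′)) X)
    decide k 1≤k n G (yes p) = inj₁ p
    decide k 1≤k n G (no ¬p) = inj₂ (search (anySubset? (λ X → (∣ X ∣ ≤? 2 ^ a * k * ⌊log₂ k ⌋) ×-dec ¬? (avoiding? G (wheelAdj (suc t′)) X))))
      where
      search : Dec (∃ λ X → (∣ X ∣ ≤ 2 ^ a * k * ⌊log₂ k ⌋) × ¬ HasModelAvoiding G (wheelAdj (suc t′)) X) →
        Σ (Subset n) λ X → (∣ X ∣ ≤ 2 ^ a * k * ⌊log₂ k ⌋) × ¬ HasModelAvoiding G (wheelAdj (suc t′)) X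
      search (yes h) = h
      -- The existence of a small hitting set is known under double negation only, which suffices to
      -- refute this case of the exhaustive search.
      search (no ∄) = ⊥-elim (bounded-hitting k 1≤k G ¬p λ { (X , hX , le) → ∄ (subset (λ v → ⌊ v ∈? X ⌋) ,
        ≤-trans (≤-reflexive (size-subset (λ v → ⌊ v ∈? X ⌋))) (≤-trans (card-cover (λ v → ⌊ v ∈? X ⌋) X (λ v → true-does (v ∈? X))) le) ,
        λ { (M , av) → hX M (λ v m v∈ → av v m (∈-subset (λ v → ⌊ v ∈? X ⌋) v (does-true (v ∈? X) v∈))) }) })

theorem1p5 : (t : ℕ) → 3 ≤ t →
    Σ ℕ λ c → (k : ℕ) → 1 ≤ k → (n : ℕ) → (G : Graph n) →
    (Σ (Fin k → Model G (wheelAdj t)) PairwiseDisjoint)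
    ⊎ (Σ (Subset n) λ X → (∣ X ∣ ≤ c * k * ⌊log₂ k ⌋)
    × ¬ HasModelAvoiding G (wheelAdj t) X)
theorem1p5 (suc t′) (s≤s 2≤t′) = main (havenOrder (suc t′)) refl (denseD (suc t′)) refl (1≤denseD (suc t′)) _ refl
  where
  main : (s : ℕ) (s≡ : s ≡ havenOrder (suc t′)) (d : ℕ) (d≡ : d ≡ denseD (suc t′)) (1≤d : 1 ≤ d)
    (D₁ : ℕ) (D₁≡ : D₁ ≡ suc (denseD (suc t′) * (2 + (suc (s + s) + suc (s + s))))) → _
  main s s≡ d d≡ 1≤d D₁ D₁≡ = erdős-pósa t′ K (E + (2 + D')) c (cheap-model t′ (<⇒≤ 2≤t′) s s≡ d d≡ 1≤d D₁ D₁≡)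
    where open Constants s d D₁
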